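{- If $G\in\mathcal{P}^+$, then $\chi_i^{c}(G)=7$.
   Context: Incidences and coloring: an incidence of $G$ is a pair $(v,e)$ with $v$ an endpoint of the edge $e$; for a vertex $w$, $I(w)$ is the set of incidences $(u,e)$ with $e$ incident with $w$; two incidences conflict if both lie in some $I(w)$; a conflict-free incidence $k$-coloring assigns colors from a $k$-set to incidences so that conflicting incidences get distinct colors; $\chi^{c}_i(G)$ is the least such $k$. A graph is outer-1-planar if it can be drawn in the plane with all vertices on the outer boundary and each edge crossed at most once. $K_4^+$ is $K_4$ with one edge subdivided once. Configurations (graphs): $G_2$ has vertices $u,v,w,x,y$ and edges $uv,uw,vw,vx,wy$. $G_4$ has vertices $x,y,u_0,u_1,v_0,v_1,w$ and edges $xu_1,u_1u_0,u_1v_0,u_0v_1,u_0w,v_0v_1,v_0w,v_1y$. $G_8$ has vertices $x,y,u_0,u_1,u_2,v_0,v_1$ and edges $xu_2,u_2u_1,u_2v_0,u_1u_0,u_0v_0,u_0v_1,v_0v_1,v_1y$. For $t\geq1$, $H_t$ has vertices $x',y',x_0,\dots,x_t,y_0,\dots,y_t$ and edges $x'y',x'x_0,x'y_0,y'x_0,y'y_0$, $x_{i-1}x_i$ and $y_{i-1}y_i$ for $1\le i\le t$, and $x_iy_i$ for $1\le i\le t-1$. Operations: if $z$ is a vertex of degree 2 of $G$ with neighbors $z_1,z_2$ and $t\in\{2,4,8\}$, $G\sqcup_z G_t$ is obtained by deleting $z$ and adding a disjoint copy of $G_t$ with $x$ identified with $z_1$ and $y$ with $z_2$. If $z_1z_2$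 is an edge of $G$ and $t\ge1$, $G\vee_{z_1z_2}H_t$ is obtained by deleting the edge $z_1z_2$ and adding a disjoint copy of $H_t$ with $x_t$ identified with $z_1$ and $y_t$ with $z_2$. The class $\mathcal{P}$ is the smallest class of graphs containing $K_4^+$ and closed under these operations. $\mathcal{P}^+$ is the class of connected outer-1-planar graphs with maximum degree 3 containing a subgraph isomorphic to a member of $\mathcal{P}$. -}

module Defs where

open import Level using (0ℓ)
open import Data.Nat using (ℕ; zero; suc; _≤_)
open import Data.Fin using (Fin; zero; suc; toℕ; fromℕ; inject₁; _<_)
open import Data.Bool using (Bool; true; false)
open import Data.List using (length; filterᵇ)
open import Data.List using () renaming (allFin to allFinL)
open import Data.Product using (Σ; ∃; _×_; _,_)
open import Data.Sum using (_⊎_; inj₁; inj₂)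
open import Data.Empty using (⊥)
open import Data.Refinement using (Refinement; value)
open import Relation.Nullary using (¬_)
open import Relation.Binary.PropositionalEquality using (_≡_; _≢_)
open import Function.Bundles using (_↔_; _⇔_; Inverse)
open import Function.Definitions using (Injective)

-- Abstract graphs (used for the class 𝒫).  A graph is a vertex type
-- together with an adjacency relation.  All concrete graphs below are
-- defined with symmetric, irreflexive adjacency, and the operations
-- preserve this.

record Graph : Set₁ where
  field
    V   : Set
    Adj : V → V → Set
open Graph public

record Iso (G H : Graph) : Set where
  field
    bij  : V G ↔ V H
    pres : ∀ a b → Adj G a b ⇔ Adj H (Inverse.to bij a) (Inverse.to bij b)

SymClosure : {A : Set} → (A → A → Set) → A → A → Set
SymClosure E a b = E a b ⊎ E b a

-- K₄⁺ : K₄ on a,b,c,d with the edge ab subdivided by s.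

data K4V : Set where
  ka kb kc kd ks : K4V

data K4E : K4V → K4V → Set where
  eac : K4E ka kc
  ead : K4E ka kd
  ebc : K4E kb kc
  ebd : K4E kb kd
  ecd : K4E kc kd
  eas : K4E ka ks
  esb : K4E ks kb

K4⁺ : Graph
K4⁺ = record { V = K4V ; Adj = SymClosure K4E }

data G2V : Set where
  u v w x y : G2V

data G2E : G2V → G2V → Set where
  uv : G2E u v
  uw : G2E u w
  vw : G2E v w
  vx : G2E v x
  wy : G2E w y

G₂ : Graph
G₂ = record { V = G2V ; Adj = SymClosure G2E }

data G4V : Set where
  x y u0 u1 v0 v1 w : G4V

data G4E : G4V → G4V → Set where
  xu1  : G4E x u1
  u1u0 : G4E u1 u0
  u1v0 : G4E u1 v0
  u0v1 : G4E u0 v1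
  u0w  : G4E u0 w
  v0v1 : G4E v0 v1
  v0w  : G4E v0 w
  v1y  : G4E v1 y

G₄ : Graph
G₄ = record { V = G4V ; Adj = SymClosure G4E }

data G8V : Set where
  x y u0 u1 u2 v0 v1 : G8V

data G8E : G8V → G8V → Set where
  xu2  : G8E x u2
  u2u1 : G8E u2 u1
  u2v0 : G8E u2 v0
  u1u0 : G8E u1 u0
  u0v0 : G8E u0 v0
  u0v1 : G8E u0 v1
  v0v1 : G8E v0 v1
  v1y  : G8E v1 y

G₈ : Graph
G₈ = record { V = G8V ; Adj = SymClosure G8E }

data GIndex : Set where
  two four eight : GIndex

Gt : GIndex → Graph
Gt two   = G₂
Gt four  = G₄
Gt eight = G₈

Gx Gy : (t : GIndex) → V (Gt t)
Gx two   = G2V.x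
Gx four  = G4V.x
Gx eight = G8V.x
Gy two   = G2V.y
Gy four  = G4V.y
Gy eight = G8V.y

data HV (t : ℕ) : Set where
  x' y' : HV t
  xs ys : Fin (suc t) → HV t

data HE (t : ℕ) : HV t → HV t → Set where
  ex'y' : HE t x' y'
  ex'x0 : HE t x' (xs zero)
  ex'y0 : HE t x' (ys zero)
  ey'x0 : HE t y' (xs zero)
  ey'y0 : HE t y' (ys zero)
  xpath : (i : Fin t) → HE t (xs (inject₁ i)) (xs (suc i))
  ypath : (i : Fin t) → HE t (ys (inject₁ i)) (ys (suc i))
  rung  : (i : Fin (suc t)) → 1 ≤ toℕ i → suc (toℕ i) ≤ t → HE t (xs i) (ys i)

H : ℕ → Graph
H t = record { V = HV t ; Adj = SymClosure (HE t) }

Hx Hy : (t : ℕ) → HV t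
Hx t = xs (fromℕ t)
Hy t = ys (fromℕ t)

-- Gluing a gadget K with terminals kx, ky onto G at z₁, z₂:
-- a disjoint copy of K is added with kx identified with z₁ and ky
-- identified with z₂.  The vertices of G that are kept are given by a
-- (proof-irrelevant) predicate Keep, and the edges of G that are kept
-- by a relation KeepE.

module _ (G : Graph) (Keep : V G → Set) (KeepE : V G → V G → Set)
         (K : Graph) (kx ky : V K) (z₁ z₂ : V G) where

  private
    Old = Refinement (V G) Keep
    New = Refinement (V K) (λ p → p ≢ kx × p ≢ ky)

  GlueAdj : Old ⊎ New → Old ⊎ New → Set
  GlueAdj (inj₁ a) (inj₁ b) = Adj G (value a) (value b) × KeepE (value a) (value b)
  GlueAdj (inj₂ p) (inj₂ q) = Adj K (value p) (value q)
  GlueAdj (inj₁ a) (inj₂ p) =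
    (value a ≡ z₁ × Adj K kx (value p)) ⊎ (value a ≡ z₂ × Adj K ky (value p))
  GlueAdj (inj₂ p) (inj₁ a) =
    (value a ≡ z₁ × Adj K (value p) kx) ⊎ (value a ≡ z₂ × Adj K (value p) ky)

  Glue : Graph
  Glue = record { V = Old ⊎ New ; Adj = GlueAdj }

VertexOp : (G : Graph) (t : GIndex) (z z₁ z₂ : V G) → Graph
VertexOp G t z z₁ z₂ =
  Glue G (λ a → a ≢ z) (λ _ _ → Data.Unit.⊤) (Gt t) (Gx t) (Gy t) z₁ z₂
  where import Data.Unit

EdgeOp : (G : Graph) (t : ℕ) (z₁ z₂ : V G) → Graph
EdgeOp G t z₁ z₂ =
  Glue G (λ _ → Data.Unit.⊤)
       (λ a b → ¬ ((a ≡ z₁ × b ≡ z₂) ⊎ (a ≡ z₂ × b ≡ z₁)))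
       (H t) (Hx t) (Hy t) z₁ z₂
  where import Data.Unit

Degree2 : (G : Graph) (z z₁ z₂ : V G) → Set
Degree2 G z z₁ z₂ =
  z₁ ≢ z₂ × Adj G z z₁ × Adj G z z₂ × (∀ a → Adj G z a → a ≡ z₁ ⊎ a ≡ z₂)

data InP : Graph → Set₁ where
  base   : InP K4⁺
  iso    : ∀ {G G'} → Iso G G' → InP G → InP G'
  vertex : ∀ {G} (t : GIndex) (z z₁ z₂ : V G) →
           Degree2 G z z₁ z₂ → InP G → InP (VertexOp G t z z₁ z₂)
  edge   : ∀ {G} (t : ℕ) → 1 ≤ t → (z₁ z₂ : V G) →
           Adj G z₁ z₂ → InP G → InP (EdgeOp G t z₁ z₂)

module _ {n : ℕ} (A : Fin n → Fin n → Bool) where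

  IsSimple : Set
  IsSimple = (∀ a b → A a b ≡ A b a) × (∀ a → A a a ≡ false)

  data Reach : Fin n → Fin n → Set where
    here : ∀ {a} → Reach a a
    step : ∀ {a b c} → A a b ≡ true → Reach b c → Reach a c

  Connected : Set
  Connected = ∀ a b → Reach a b

  degree : Fin n → ℕ
  degree a = length (filterᵇ (A a) (allFinL n))

  MaxDegreeAtMost : ℕ → Set
  MaxDegreeAtMost d = ∀ a → degree a ≤ d

  -- Outer-1-planarity, combinatorially: the vertices are placed on a
  -- circle in the cyclic order given by an injective position map pos,
  -- edges are chords, and two edges with four distinct ends cross iff
  -- their endpoints interleave.  Each edge is crossed by at most one edge.
  Between : Fin n → Fin n → Fin n → Set
  Between i j k = (i < k × k < j) ⊎ (j < k × k < i)

  Cross : (Fin n → Fin n) → Fin n → Fin n → Fin n → Fin n → Set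
  Cross pos a b c d =
    (a ≢ c × a ≢ d × b ≢ c × b ≢ d) ×
    ((Between (pos a) (pos b) (pos c) × ¬ Between (pos a) (pos b) (pos d)) ⊎
     (¬ Between (pos a) (pos b) (pos c) × Between (pos a) (pos b) (pos d)))

  OuterOnePlanar : Set
  OuterOnePlanar =
    Σ (Fin n → Fin n) λ pos → Injective _≡_ _≡_ pos ×
      (∀ a b c d e f → A a b ≡ true → A c d ≡ true → A e f ≡ true →
         Cross pos a b c d → Cross pos a b e f →
         (c ≡ e × d ≡ f) ⊎ (c ≡ f × d ≡ e))

  ContainsSubgraph : Graph → Set
  ContainsSubgraph Hg =
    Σ (V Hg → Fin n) λ f → Injective _≡_ _≡_ f ×
      (∀ a b → Adj Hg a b → A (f a) (f b) ≡ true)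

  record InP⁺ : Set₁ where
    field
      simple      : IsSimple
      connected   : Connected
      outer1      : OuterOnePlanar
      maxdeg      : MaxDegreeAtMost 3
      member      : Graph
      memberInP   : InP member
      contains    : ContainsSubgraph member

  -- Incidences: the incidence (a, ab) for an edge ab is represented by the
  -- ordered pair (a , b) with A a b ≡ true.  A colouring assigns a colour
  -- c a b to it.  Two distinct incidences (a,ab), (p,pq) conflict iff they
  -- both lie in I(w) for some w, i.e. {a,b} ∩ {p,q} ≠ ∅.
  ConflictFree : {k : ℕ} → (Fin n → Fin n → Fin k) → Set
  ConflictFree col =
    ∀ a b p q → A a b ≡ true → A p q ≡ true → ¬ (a ≡ p × b ≡ q) →
      (a ≡ p ⊎ a ≡ q ⊎ b ≡ p ⊎ b ≡ q) → col a b ≢ col p q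

  IncColourable : ℕ → Set
  IncColourable k = Σ (Fin n → Fin n → Fin k) ConflictFree

  ConflictFreeIncChromatic≡ : ℕ → Set
  ConflictFreeIncChromatic≡ k = IncColourable k × (∀ m → IncColourable m → k ≤ m)

{-# OPTIONS --safe #-}

-- A conflict-free incidence colouring assigns to every edge a 2-set of colours, disjoint from the
-- 2-sets of the adjacent edges.
--
-- With six colours, every vertex of degree 3 sees every colour exactly once.  For a fixed colour the
-- edges carrying it therefore satisfy a parity condition, which forces the terminal edges of G₂, G₄
-- and G₈ to have disjoint 2-sets and those of H t to have equal ones, so that a colouring passes
-- from a glued graph to the graph it was built from.  For K₄⁺ it gives the two edges at the
-- subdividing vertex the same 2-set, a contradiction.
--
-- With seven colours, every outer-1-planar graph of maximum degree 3 is coloured by induction on its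
-- vertices, by removing one of: a vertex of degree at most 1, two adjacent vertices of degree 2, a
-- triangle with a vertex of degree 2, or a pair of crossing edges ac and bd whose consecutive ends
-- are joined by edges or by paths of length two.  An interval of the circle whose inner vertices have
-- no neighbours outside it, shortened as far as possible, contains one of these: the ends of two
-- crossing edges bound such intervals, because no other edge crosses either of them.
module Submission where

open import Defs hiding (u; v; w; x; y; u0; u1; u2; v0; v1; xs; ys; step; here)
open import Data.Bool as Bool using (Bool; true; false; not; _xor_)
import Data.Bool.Properties as Bool
open import Data.Bool.Solver using (module xor-∧-Solver)
open import Data.Empty using (⊥; ⊥-elim)
open import Data.Fin as Fin using (Fin; zero; suc; toℕ; fromℕ; inject₁; inject≤)
open import Data.Fin.Induction using (<-weakInduction)
import Data.Fin.Properties as Fin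
open import Data.Irrelevant using ([_])
open import Data.List using (List; []; _∷_; length; lookup; _++_; map; filter; allFin)
open import Data.List.Membership.Propositional using (_∈_; _∉_; find; lose)
open import Data.List.Membership.Propositional.Properties
  using (∈-lookup; ∈-allFin; ∈-AllPairs₂; ∈-filter⁺; ∈-filter⁻; ∈-map⁺; ∈-map⁻; ∈-++⁺ˡ; ∈-++⁺ʳ)
open import Data.List.Properties using (filter-notAll; length-++; length-map; length-tabulate; map-∘)
open import Data.List.Relation.Binary.Permutation.Propositional using (↭-sym; ↭⇒↭ₛ)
open import Data.List.Relation.Binary.Permutation.Propositional.Properties using (∈-resp-↭)
import Data.List.Relation.Binary.Permutation.Setoid.Properties as Permutation
open import Data.List.Relation.Unary.All as All using (All; []; _∷_)
import Data.List.Relation.Unary.All.Properties as All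
open import Data.List.Relation.Unary.AllPairs as AllPairs using (AllPairs; []; _∷_; allPairs?)
import Data.List.Relation.Unary.AllPairs.Properties as AllPairs
open import Data.List.Relation.Unary.Any as Any using (Any; here; there)
open import Data.List.Relation.Unary.Any.Properties using (lookup-index)
import Data.List.Relation.Unary.Any.Properties as Any
open import Data.List.Relation.Unary.Linked as Linked using (Linked; [-]; _∷_)
import Data.List.Relation.Unary.Linked.Properties as Linked
import Data.List.Relation.Unary.Sorted.TotalOrder.Properties as Sorted
open import Data.List.Relation.Unary.Unique.Propositional using (Unique)
open import Data.List.Relation.Unary.Unique.Propositional.Properties using (allFin⁺)
open import Data.List.Sort using (sort; sort-↭; sort-↗)
open import Data.Nat as ℕ using (ℕ; zero; suc; z≤n; s≤s; _<_; _≤_)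
import Data.Nat.Properties as ℕ
open import Data.Product using (Σ; ∃; _×_; _,_; proj₁; proj₂; swap)
open import Data.Refinement using (_,_)
import Data.Refinement.Properties as Refinement
open import Data.Sum as Sum using (_⊎_; inj₁; inj₂)
open import Data.Sum.Properties using (≡-dec)
open import Data.Unit using (⊤; tt)
open import Data.Vec as Vec using (Vec; []; _∷_; toList)
open import Data.Vec.Properties using (length-toList)
open import Function using (_∘_; id; case_of_; _$_)
open import Function.Bundles using (Injection; Inverse; Equivalence)
open import Function.Definitions using (Injective)
open import Function.Properties.Inverse using (↔⇒↣)
open import Relation.Binary using (DecidableEquality; DecTotalOrder; tri<; tri≈; tri>)
import Relation.Binary.Construct.On as On
open import Relation.Binary.PropositionalEquality
  using (_≡_; _≢_; refl; sym; trans; cong; cong₂; subst; subst₂; setoid; module ≡-Reasoning)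
open import Relation.Nullary using (¬_; Dec; does; proof; yes; no; Reflects; invert)
open import Relation.Nullary.Decidable
  using (dec-true; dec-false; map′; _⊎-dec_; _×-dec_; _→-dec_; ¬?; toWitness; True; decidable-stable)

open xor-∧-Solver using (Polynomial; solve; con; _:+_; _:=_)

-- The parity conditions are linear equations over the field of two elements, one for each colour
-- and each vertex of degree 3. Each gadget argument adds some of them: an edge with both ends among
-- the chosen vertices cancels, and only edges at the terminals or at a vertex of degree 2 survive.
-- With seven colours the obstacle is that an edge can touch four coloured edges, hence exclude all
-- colours. An edge touching only two leaves at least three colours, so pendant edges are coloured
-- greedily. A triangle cannot be completed when its two pendant edges have equal 2-sets, so these
-- are chosen to differ. A ladder has at most one outside edge at each of its two extreme vertices;
-- up to renaming colours only the size of the intersection of their 2-sets matters, and finitely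
-- many explicit colourings suffice. Induced subgraphs inherit the circular order and the crossing
-- condition, so the induction runs over lists of vertices sorted by position.

Pair : ℕ → Set
Pair k = Fin k × Fin k

infix 4 _∈ₚ_ _∈ₚ?_ _#_

_∈ₚ_ : ∀ {k} → Fin k → Pair k → Set
c ∈ₚ P = c ≡ proj₁ P ⊎ c ≡ proj₂ P

_∈ₚ?_ : ∀ {k} (c : Fin k) (P : Pair k) → Dec (c ∈ₚ P)
c ∈ₚ? P = (c Fin.≟ proj₁ P) ⊎-dec (c Fin.≟ proj₂ P)

Proper : ∀ {k} → Pair k → Set
Proper P = proj₁ P ≢ proj₂ P

_#_ : ∀ {k} → Pair k → Pair k → Set
P # Q = ∀ {c} → c ∈ₚ P → c ∈ₚ Q → ⊥

#-sym : ∀ {k} {P Q : Pair k} → P # Q → Q # P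
#-sym d c∈Q c∈P = d c∈P c∈Q

-- The two incidences of an edge form an unordered pair of colours, so a
-- conflict-free incidence colouring is a proper edge colouring by 2-sets.
record PairColouring {V : Set} (k : ℕ) (E : V → V → Set) : Set where
  field
    col    : V → V → Pair k
    proper : ∀ {a b} → E a b → Proper (col a b)
    flip   : ∀ {a b} → E a b → ∀ {c} → c ∈ₚ col a b → c ∈ₚ col b a
    disj   : ∀ {a b c} → E a b → E a c → b ≢ c → col a b # col a c

Edge : ∀ {n} → (Fin n → Fin n → Bool) → Fin n → Fin n → Set
Edge A a b = A a b ≡ true

lookup-injective : ∀ {X : Set} {xs : List X} → Unique xs →
  ∀ i j → lookup xs i ≡ lookup xs j → i ≡ j
lookup-injective (x∉ ∷ u) zero    zero    eq = refl
lookup-injective (x∉ ∷ u) zero    (suc j) eq = ⊥-elim (All.lookup x∉ (∈-lookup j) eq)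
lookup-injective (x∉ ∷ u) (suc i) zero    eq = ⊥-elim (All.lookup x∉ (∈-lookup i) (sym eq))
lookup-injective (x∉ ∷ u) (suc i) (suc j) eq = cong suc (lookup-injective u i j eq)

Unique-⊆⇒length≤ : ∀ {X : Set} {xs ys : List X} → Unique xs →
  (∀ {x} → x ∈ xs → x ∈ ys) → length xs ℕ.≤ length ys
Unique-⊆⇒length≤ {xs = xs} {ys} u sub = Fin.injective⇒≤ {f = λ i → Any.index (sub (∈-lookup i))}
  λ {i} {j} eq → lookup-injective u i j
    (trans (lookup-index (sub (∈-lookup i)))
      (trans (cong (lookup ys) eq) (sym (lookup-index (sub (∈-lookup j))))))

Unique⇒length≤ : ∀ {k} {xs : List (Fin k)} → Unique xs → length xs ℕ.≤ k
Unique⇒length≤ {xs = xs} u = Fin.injective⇒≤ {f = lookup xs} λ {i} {j} → lookup-injective u i j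

module _ {n : ℕ} {A : Fin n → Fin n → Bool} (simple : IsSimple A) where

  private
    A-sym : ∀ {a b} → Edge A a b → Edge A b a
    A-sym {a} {b} e = trans (proj₁ simple b a) e

    A-irr : ∀ {a b} → Edge A a b → a ≢ b
    A-irr {a} e refl with () ← trans (sym e) (proj₂ simple a)

  fromIncidence : ∀ {k} → IncColourable A k → PairColouring k (Edge A)
  fromIncidence (c , cf) = record
    { col    = λ a b → c a b , c b a
    ; proper = λ {a} {b} e → cf a b b a e (A-sym e) (A-irr e ∘ proj₁) (inj₂ (inj₁ refl))
    ; flip   = λ _ → Sum.swap
    ; disj   = λ {a} {b} {d} e f b≢d → λ
        { (inj₁ refl) (inj₁ eq) → cf a b a d e f (b≢d ∘ proj₂) (inj₁ refl) eq
        ; (inj₁ refl) (inj₂ eq) → cf a b d a e (A-sym f) (A-irr f ∘ proj₁) (inj₂ (inj₁ refl)) eq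
        ; (inj₂ refl) (inj₁ eq) → cf b a a d (A-sym e) f (A-irr e ∘ sym ∘ proj₁) (inj₂ (inj₂ (inj₁ refl))) eq
        ; (inj₂ refl) (inj₂ eq) → cf b a d a (A-sym e) (A-sym f) (b≢d ∘ proj₁) (inj₂ (inj₂ (inj₂ refl))) eq }
    }

  -- `col a b` and `col b a` agree only as sets. Both incidences of an edge are therefore read off
  -- the listing at its smaller end, which gives them different colours.
  toIncidence : ∀ {k} → PairColouring k (Edge A) → IncColourable A k
  toIncidence {k} C = c , cf
    where
    open PairColouring C
    c : Fin n → Fin n → Fin k
    c a b with a Fin.<? b
    ... | yes _ = proj₁ (col a b)
    ... | no  _ = proj₂ (col b a)

    c∈ : ∀ {a b} → Edge A a b → c a b ∈ₚ col a b
    c∈ {a} {b} e with a Fin.<? b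
    ... | yes _ = inj₁ refl
    ... | no  _ = flip (A-sym e) (inj₂ refl)

    c∈′ : ∀ {a b} → Edge A a b → c a b ∈ₚ col b a
    c∈′ e = flip e (c∈ e)

    c-proper : ∀ {a b} → Edge A a b → c a b ≢ c b a
    c-proper {a} {b} e eq with a Fin.<? b | b Fin.<? a
    ... | yes a<b | yes b<a = ℕ.<-asym a<b b<a
    ... | yes _   | no  _   = proper e eq
    ... | no  _   | yes _   = proper (A-sym e) (sym eq)
    ... | no  a≮b | no  b≮a with Fin.<-cmp a b
    ...   | tri< a<b _ _ = a≮b a<b
    ...   | tri≈ _ a≡b _ = A-irr e a≡b
    ...   | tri> _ _ b<a = b≮a b<a

    cf : ConflictFree A c
    cf a b p q e f ne (inj₁ refl) eq =
      disj e f (λ b≡q → ne (refl , b≡q)) (c∈ e) (subst (_∈ₚ col a q) (sym eq) (c∈ f))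
    cf a b p q e f ne (inj₂ (inj₁ refl)) eq with b Fin.≟ p
    ... | yes refl = c-proper e eq
    ... | no  b≢p  = disj e (A-sym f) b≢p (c∈ e) (subst (_∈ₚ col a p) (sym eq) (c∈′ f))
    cf a b p q e f ne (inj₂ (inj₂ (inj₁ refl))) eq with a Fin.≟ q
    ... | yes refl = c-proper e eq
    ... | no  a≢q  = disj (A-sym e) f a≢q (c∈′ e) (subst (_∈ₚ col b q) (sym eq) (c∈ f))
    cf a b p q e f ne (inj₂ (inj₂ (inj₂ refl))) eq =
      disj (A-sym e) (A-sym f) (λ a≡p → ne (a≡p , refl)) (c∈′ e) (subst (_∈ₚ col b p) (sym eq) (c∈′ f))

-- Parity of the colours in the gadgets

-- Otherwise `c` and the six entries would be seven distinct colours among fewer than seven.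
third-pair : ∀ {k} → k ℕ.< 7 → {c p₁ p₂ q₁ q₂ r₁ r₂ : Fin k} →
  p₁ ≢ p₂ → q₁ ≢ q₂ → r₁ ≢ r₂ →
  (p₁ , p₂) # (q₁ , q₂) → (p₁ , p₂) # (r₁ , r₂) → (q₁ , q₂) # (r₁ , r₂) →
  ¬ c ∈ₚ (p₁ , p₂) → ¬ c ∈ₚ (q₁ , q₂) → c ∈ₚ (r₁ , r₂)
third-pair k<7 {c} {p₁} {p₂} {q₁} {q₂} {r₁} {r₂} p q r pq pr qr ∉p ∉q
  with c ∈ₚ? (r₁ , r₂)
... | yes ∈r = ∈r
... | no  ∉r = ⊥-elim (ℕ.<⇒≱ k<7 (Unique⇒length≤ {xs = c ∷ p₁ ∷ p₂ ∷ q₁ ∷ q₂ ∷ r₁ ∷ r₂ ∷ []}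
  ( ((∉p ∘ inj₁) ∷ (∉p ∘ inj₂) ∷ (∉q ∘ inj₁) ∷ (∉q ∘ inj₂) ∷ (∉r ∘ inj₁) ∷ (∉r ∘ inj₂) ∷ [])
  ∷ (p ∷ pq₁₁ ∷ pq₁₂ ∷ pr₁₁ ∷ pr₁₂ ∷ [])
  ∷ (pq₂₁ ∷ pq₂₂ ∷ pr₂₁ ∷ pr₂₂ ∷ [])
  ∷ (q ∷ qr₁₁ ∷ qr₁₂ ∷ [])
  ∷ (qr₂₁ ∷ qr₂₂ ∷ [])
  ∷ (r ∷ [])
  ∷ [] ∷ [])))
  where
  pq₁₁ = λ eq → pq (inj₁ refl) (inj₁ eq)
  pq₁₂ = λ eq → pq (inj₁ refl) (inj₂ eq)
  pq₂₁ = λ eq → pq (inj₂ refl) (inj₁ eq)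
  pq₂₂ = λ eq → pq (inj₂ refl) (inj₂ eq)
  pr₁₁ = λ eq → pr (inj₁ refl) (inj₁ eq)
  pr₁₂ = λ eq → pr (inj₁ refl) (inj₂ eq)
  pr₂₁ = λ eq → pr (inj₂ refl) (inj₁ eq)
  pr₂₂ = λ eq → pr (inj₂ refl) (inj₂ eq)
  qr₁₁ = λ eq → qr (inj₁ refl) (inj₁ eq)
  qr₁₂ = λ eq → qr (inj₁ refl) (inj₂ eq)
  qr₂₁ = λ eq → qr (inj₂ refl) (inj₁ eq)
  qr₂₂ = λ eq → qr (inj₂ refl) (inj₂ eq)

bit : ∀ {k} → Fin k → Pair k → Bool
bit c P = does (c ∈ₚ? P)

bit-true : ∀ {k} {c : Fin k} {P} → c ∈ₚ P → bit c P ≡ true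
bit-true {c = c} {P} = dec-true (c ∈ₚ? P)

bit-true⁻ : ∀ {k} {c : Fin k} P → bit c P ≡ true → c ∈ₚ P
bit-true⁻ {c = c} P eq = invert (subst (Reflects _) eq (proof (c ∈ₚ? P)))

bit-false : ∀ {k} {c : Fin k} {P} → ¬ c ∈ₚ P → bit c P ≡ false
bit-false {c = c} {P} = dec-false (c ∈ₚ? P)

-- Each of the six colours lies in exactly one of the three pairs. Modulo 2 the three indicators add
-- up to 1, a form that can be chained through a gadget.
three-pairs-cover : ∀ {P Q R : Pair 6} → Proper P → Proper Q → Proper R →
  P # Q → P # R → Q # R → ∀ c → bit c P ≡ not (bit c Q xor bit c R)
three-pairs-cover {P} {Q} {R} p q r pq pr qr c with c ∈ₚ? P
... | yes c∈P rewrite bit-true {P = P} c∈P | bit-false {P = Q} (pq c∈P) | bit-false {P = R} (pr c∈P) = refl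
... | no  c∉P with c ∈ₚ? Q
...   | yes c∈Q rewrite bit-false {P = P} c∉P | bit-true {P = Q} c∈Q | bit-false {P = R} (qr c∈Q) = refl
...   | no  c∉Q
  rewrite bit-false {P = P} c∉P | bit-false {P = Q} c∉Q | bit-true {P = R} (third-pair ℕ.≤-refl p q r pq pr qr c∉P c∉Q) = refl

partner : ∀ {k} {c : Fin k} {P} → c ∈ₚ P → ∃ λ d → ∀ {e} → e ∈ₚ P → e ≡ c ⊎ e ≡ d
partner {P = _ , d} (inj₁ refl) = d , id
partner {P = d , _} (inj₂ refl) = d , Sum.swap

-- A symmetric difference of two 2-sets that meet has at most two elements.
xor-disjoint : ∀ {k} {X Y P Q : Pair k} → Proper P → Proper Q → P # Q →
  (∀ c → bit c X xor bit c Y ≡ bit c P xor bit c Q) → X # Y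
xor-disjoint {X = X} {Y} {P@(p₁ , p₂)} {Q@(q₁ , q₂)} p q pq eq {c} c∈X c∈Y =
  -- Three distinct elements of `P` and `Q` would have to lie among the two colours `d` and `e`.
  among-two p₁ p₂ q₁ (p ∘ sym) (λ e → pq (inj₁ refl) (inj₁ (sym e))) (λ e → pq (inj₂ refl) (inj₁ (sym e)))
    (inP (inj₁ refl)) (inP (inj₂ refl)) (inQ (inj₁ refl))
  where
  d e : Fin _
  d = proj₁ (partner {P = X} c∈X)
  e = proj₁ (partner {P = Y} c∈Y)

  at-c : bit c P xor bit c Q ≡ false
  at-c = trans (sym (eq c)) (cong₂ _xor_ (bit-true {P = X} c∈X) (bit-true {P = Y} c∈Y))

  -- A colour in exactly one of `X` and `Y` is not `c`, so it is the other element of `X` or of `Y`.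
  near : ∀ {z} → bit z P xor bit z Q ≡ true → z ≡ d ⊎ z ≡ e
  near {z} odd with z ∈ₚ? X
  ... | yes z∈X with proj₂ (partner {P = X} c∈X) {z} z∈X
  ...   | inj₁ refl with () ← trans (sym odd) at-c
  ...   | inj₂ z≡d = inj₁ z≡d
  near {z} odd | no z∉X with proj₂ (partner {P = Y} c∈Y) {z}
    (bit-true⁻ Y (trans (cong (_xor bit z Y) (sym (bit-false {P = X} z∉X))) (trans (eq z) odd)))
  ...   | inj₁ z≡c = ⊥-elim (z∉X (subst (_∈ₚ X) (sym z≡c) c∈X))
  ...   | inj₂ z≡e = inj₂ z≡e

  inP : ∀ {z} → z ∈ₚ P → z ≡ d ⊎ z ≡ e
  inP {z} z∈P = near (cong₂ _xor_ (bit-true {P = P} z∈P) (bit-false {P = Q} (pq z∈P)))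

  inQ : ∀ {z} → z ∈ₚ Q → z ≡ d ⊎ z ≡ e
  inQ {z} z∈Q = near (cong₂ _xor_ (bit-false {P = P} (λ z∈P → pq z∈P z∈Q)) (bit-true {P = Q} z∈Q))

  among-two : ∀ r s t → s ≢ r → t ≢ r → t ≢ s → r ≡ d ⊎ r ≡ e → s ≡ d ⊎ s ≡ e → t ≡ d ⊎ t ≡ e → ⊥
  among-two r s t sr tr ts (inj₁ refl) (inj₁ refl) _ = sr refl
  among-two r s t sr tr ts (inj₂ refl) (inj₂ refl) _ = sr refl
  among-two r s t sr tr ts (inj₁ refl) (inj₂ refl) (inj₁ refl) = tr refl
  among-two r s t sr tr ts (inj₁ refl) (inj₂ refl) (inj₂ refl) = ts refl
  among-two r s t sr tr ts (inj₂ refl) (inj₁ refl) (inj₁ refl) = ts refl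
  among-two r s t sr tr ts (inj₂ refl) (inj₁ refl) (inj₂ refl) = tr refl

module Parity {V : Set} {E : V → V → Set} (E-sym : ∀ {a b} → E a b → E b a)
              (C : PairColouring 6 E) where
  open PairColouring C public

  bit-flip : ∀ {a b} → E a b → ∀ c → bit c (col a b) ≡ bit c (col b a)
  bit-flip {a} {b} e c with c ∈ₚ? col a b
  ... | yes c∈ = trans (bit-true {P = col a b} c∈) (sym (bit-true {P = col b a} (flip e c∈)))
  ... | no  c∉ = trans (bit-false {P = col a b} c∉)
                       (sym (bit-false {P = col b a} (λ c∈ → c∉ (flip (E-sym e) c∈))))

  -- A vertex of degree 3 sees all six colours.
  star : ∀ {a b d e} → E a b → E a d → E a e → b ≢ d → b ≢ e → d ≢ e → ∀ c →
    bit c (col a b) ≡ not (bit c (col a d) xor bit c (col a e))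
  star f g h bd be de = three-pairs-cover (proper f) (proper g) (proper h)
    (disj f g bd) (disj f h be) (disj g h de)

SymClosure-sym : ∀ {X : Set} {E : X → X → Set} {a b} → SymClosure E a b → SymClosure E b a
SymClosure-sym = Sum.swap

neg : ∀ {n} → Polynomial n → Polynomial n
neg p = con true :+ p

-- `m` stands for an edge shared by the two vertices whose equations are added.
not-xor-cancel : ∀ p q m → not (p xor m) xor not (q xor m) ≡ p xor q
not-xor-cancel = solve 3 (λ p q m → neg (p :+ m) :+ neg (q :+ m) := p :+ q) refl

-- Add the equations at `ka`, `kb`, `kc` and `kd`. The constants cancel, and so does every edge
-- except the two at `ks`, since its ends are both among these four vertices.
K4⁺-not-6 : ¬ PairColouring 6 (Adj K4⁺)
K4⁺-not-6 C = disj as bs′ (λ ()) (inj₁ refl) (bit-true⁻ (col ks kb) (trans (sym (eq c₀)) (bit-true {P = col ks ka} (inj₁ refl))))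
  where
  open Parity (λ {a} {b} → SymClosure-sym {E = K4E} {a} {b}) C
  as  = inj₂ eas
  bs′ = inj₁ esb
  c₀  = proj₁ (col ks ka)
  eq : ∀ c → bit c (col ks ka) ≡ bit c (col ks kb)
  eq c = begin
    bit c (col ks ka)                                         ≡⟨ bit-flip (inj₂ eas) c ⟩
    bit c (col ka ks)                                         ≡⟨ star (inj₁ eas) (inj₁ eac) (inj₁ ead) (λ ()) (λ ()) (λ ()) c ⟩
    not (bit c (col ka kc) xor bit c (col ka kd))             ≡⟨ cong₂ (λ p q → not (p xor q))
      (trans (bit-flip (inj₁ eac) c) (star (inj₂ eac) (inj₂ ebc) (inj₁ ecd) (λ ()) (λ ()) (λ ()) c))
      (trans (bit-flip (inj₁ ead) c) (star (inj₂ ead) (inj₂ ebd) (inj₂ ecd) (λ ()) (λ ()) (λ ()) c)) ⟩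
    not (not (bit c (col kc kb) xor bit c (col kc kd)) xor not (bit c (col kd kb) xor bit c (col kd kc)))
      ≡⟨ cong not (trans (cong (λ m → not (bit c (col kc kb) xor m) xor not (bit c (col kd kb) xor bit c (col kd kc))) (bit-flip (inj₁ ecd) c))
                    (not-xor-cancel (bit c (col kc kb)) (bit c (col kd kb)) (bit c (col kd kc)))) ⟩
    not (bit c (col kc kb) xor bit c (col kd kb))             ≡⟨ cong₂ (λ p q → not (p xor q)) (bit-flip (inj₂ ebc) c) (bit-flip (inj₂ ebd) c) ⟩
    not (bit c (col kb kc) xor bit c (col kb kd))             ≡⟨ sym (star (inj₂ esb) (inj₁ ebc) (inj₁ ebd) (λ ()) (λ ()) (λ ()) c) ⟩
    bit c (col kb ks)                                         ≡⟨ bit-flip (inj₂ esb) c ⟩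
    bit c (col ks kb)                                         ∎
    where open ≡-Reasoning

-- Each of the three gadgets has an even number of vertices of degree 3. Adding their equations
-- leaves the two terminal edges on one side and, on the other, the two edges at the vertex of
-- degree 2, which is `u` here, `w` in `G₄` and `u1` in `G₈`. The latter are disjoint, so
-- `xor-disjoint` applies.
G₂-disjoint : (C : PairColouring 6 (Adj G₂)) → let open PairColouring C in
  col G2V.x G2V.v # col G2V.y G2V.w
G₂-disjoint C = xor-disjoint (proper (inj₁ uv)) (proper (inj₁ uw)) (disj (inj₁ uv) (inj₁ uw) (λ ())) λ c → begin
    bit c (col x v) xor bit c (col y w)
      ≡⟨ cong₂ _xor_
           (trans (bit-flip (inj₂ vx) c) (star (inj₁ vx) (inj₂ uv) (inj₁ vw) (λ ()) (λ ()) (λ ()) c))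
           (trans (bit-flip (inj₂ wy) c) (star (inj₁ wy) (inj₂ uw) (inj₂ vw) (λ ()) (λ ()) (λ ()) c)) ⟩
    not (bit c (col v u) xor bit c (col v w)) xor not (bit c (col w u) xor bit c (col w v))
      ≡⟨ cong₂ (λ p q → not (p xor bit c (col v w)) xor not (q xor bit c (col w v)))
           (bit-flip (inj₂ uv) c) (bit-flip (inj₂ uw) c) ⟩
    not (bit c (col u v) xor bit c (col v w)) xor not (bit c (col u w) xor bit c (col w v))
      ≡⟨ cong (λ m → not (bit c (col u v) xor m) xor not (bit c (col u w) xor bit c (col w v))) (bit-flip (inj₁ vw) c) ⟩
    not (bit c (col u v) xor bit c (col w v)) xor not (bit c (col u w) xor bit c (col w v))
      ≡⟨ not-xor-cancel (bit c (col u v)) (bit c (col u w)) (bit c (col w v)) ⟩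
    bit c (col u v) xor bit c (col u w) ∎
  where
  open G2V
  open Parity (λ {a} {b} → SymClosure-sym {E = G2E} {a} {b}) C
  open ≡-Reasoning

G₄-disjoint : (C : PairColouring 6 (Adj G₄)) → let open PairColouring C in
  col G4V.x G4V.u1 # col G4V.y G4V.v1
G₄-disjoint C = xor-disjoint (proper (inj₂ u0w)) (proper (inj₂ v0w)) (disj (inj₂ u0w) (inj₂ v0w) (λ ())) λ c → begin
    bit c (col x u1) xor bit c (col y v1)
      ≡⟨ cong₂ _xor_
           (trans (bit-flip (inj₁ xu1) c) (star (inj₂ xu1) (inj₁ u1u0) (inj₁ u1v0) (λ ()) (λ ()) (λ ()) c))
           (trans (bit-flip (inj₂ v1y) c) (star (inj₁ v1y) (inj₂ u0v1) (inj₂ v0v1) (λ ()) (λ ()) (λ ()) c)) ⟩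
    not (bit c (col u1 u0) xor bit c (col u1 v0)) xor not (bit c (col v1 u0) xor bit c (col v1 v0))
      ≡⟨ cong₂ _xor_
           (cong₂ (λ p q → not (p xor q))
             (trans (bit-flip (inj₁ u1u0) c) (star (inj₂ u1u0) (inj₁ u0v1) (inj₁ u0w) (λ ()) (λ ()) (λ ()) c))
             (trans (bit-flip (inj₁ u1v0) c) (star (inj₂ u1v0) (inj₁ v0v1) (inj₁ v0w) (λ ()) (λ ()) (λ ()) c)))
           (cong₂ (λ p q → not (p xor q)) (bit-flip (inj₂ u0v1) c) (bit-flip (inj₂ v0v1) c)) ⟩
    not (not (bit c (col u0 v1) xor bit c (col u0 w)) xor not (bit c (col v0 v1) xor bit c (col v0 w)))
      xor not (bit c (col u0 v1) xor bit c (col v0 v1))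
      ≡⟨ solve 4 (λ p q r s → neg (neg (p :+ q) :+ neg (r :+ s)) :+ neg (p :+ r) := q :+ s) refl
           (bit c (col u0 v1)) (bit c (col u0 w)) (bit c (col v0 v1)) (bit c (col v0 w)) ⟩
    bit c (col u0 w) xor bit c (col v0 w)
      ≡⟨ cong₂ _xor_ (bit-flip (inj₁ u0w) c) (bit-flip (inj₁ v0w) c) ⟩
    bit c (col w u0) xor bit c (col w v0) ∎
  where
  open G4V
  open Parity (λ {a} {b} → SymClosure-sym {E = G4E} {a} {b}) C
  open ≡-Reasoning

G₈-disjoint : (C : PairColouring 6 (Adj G₈)) → let open PairColouring C in
  col G8V.x G8V.u2 # col G8V.y G8V.v1
G₈-disjoint C = xor-disjoint (proper (inj₂ u2u1)) (proper (inj₁ u1u0)) (disj (inj₂ u2u1) (inj₁ u1u0) (λ ())) λ c → begin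
    bit c (col x u2) xor bit c (col y v1)
      ≡⟨ cong₂ _xor_
           (trans (bit-flip (inj₁ xu2) c) (star (inj₂ xu2) (inj₁ u2u1) (inj₁ u2v0) (λ ()) (λ ()) (λ ()) c))
           (trans (bit-flip (inj₂ v1y) c) (star (inj₁ v1y) (inj₂ u0v1) (inj₂ v0v1) (λ ()) (λ ()) (λ ()) c)) ⟩
    not (bit c (col u2 u1) xor bit c (col u2 v0)) xor not (bit c (col v1 u0) xor bit c (col v1 v0))
      ≡⟨ cong₂ _xor_
           (cong₂ (λ p q → not (p xor q))
             (bit-flip (inj₁ u2u1) c)
             (trans (bit-flip (inj₁ u2v0) c) (star (inj₂ u2v0) (inj₂ u0v0) (inj₁ v0v1) (λ ()) (λ ()) (λ ()) c)))
           (cong₂ (λ p q → not (p xor q)) (bit-flip (inj₂ u0v1) c) (bit-flip (inj₂ v0v1) c)) ⟩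
    not (bit c (col u1 u2) xor not (bit c (col v0 u0) xor bit c (col v0 v1)))
      xor not (bit c (col u0 v1) xor bit c (col v0 v1))
      ≡⟨ solve 4 (λ m p q r → neg (m :+ neg (p :+ r)) :+ neg (q :+ r) := m :+ neg (p :+ q)) refl
           (bit c (col u1 u2)) (bit c (col v0 u0)) (bit c (col u0 v1)) (bit c (col v0 v1)) ⟩
    bit c (col u1 u2) xor not (bit c (col v0 u0) xor bit c (col u0 v1))
      ≡⟨ cong (λ p → bit c (col u1 u2) xor not (p xor bit c (col u0 v1))) (bit-flip (inj₂ u0v0) c) ⟩
    bit c (col u1 u2) xor not (bit c (col u0 v0) xor bit c (col u0 v1))
      ≡⟨ cong (bit c (col u1 u2) xor_)
           (sym (trans (bit-flip (inj₁ u1u0) c) (star (inj₂ u1u0) (inj₁ u0v0) (inj₁ u0v1) (λ ()) (λ ()) (λ ()) c))) ⟩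
    bit c (col u1 u2) xor bit c (col u1 u0) ∎
  where
  open G8V
  open Parity (λ {a} {b} → SymClosure-sym {E = G8E} {a} {b}) C
  open ≡-Reasoning

suc-suc≢inject₁ : ∀ {n} (i : Fin n) → toℕ (suc (suc i)) ≢ toℕ (inject₁ (inject₁ i))
suc-suc≢inject₁ i eq =
  ℕ.m+1+n≢n 1 (trans eq (trans (Fin.toℕ-inject₁ (inject₁ i)) (Fin.toℕ-inject₁ i)))

-- Tells apart the two neighbours of a vertex along a side of the ladder, which lie two levels
-- apart.
level : ∀ {t} → HV t → ℕ
level x'     = 0
level y'     = 0
level (HV.xs i) = toℕ i
level (HV.ys i) = toℕ i

-- The base case adds the equations at the four vertices of the `K₄` minus an edge that closes the
-- ladder. Each further level adds the equations at the two ends of a rung, which cancels the rung.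
ladder-equal : ∀ t (C : PairColouring 6 (Adj (H (suc t)))) → let open PairColouring C in
  ∀ c i → bit c (col (HV.xs (suc i)) (HV.xs (inject₁ i))) ≡ bit c (col (HV.ys (suc i)) (HV.ys (inject₁ i)))
ladder-equal t C c = <-weakInduction _ start next
  where
  open HV
  open Parity (λ {a} {b} → SymClosure-sym {E = HE (suc t)} {a} {b}) C
  open ≡-Reasoning

  start : bit c (col (xs (suc zero)) (xs zero)) ≡ bit c (col (ys (suc zero)) (ys zero))
  start = begin
    bit c (col (xs (suc zero)) (xs zero))
      ≡⟨ trans (bit-flip (inj₂ (xpath zero)) c) (star (inj₁ (xpath zero)) (inj₂ ex'x0) (inj₂ ey'x0) (λ ()) (λ ()) (λ ()) c) ⟩
    not (bit c (col (xs zero) x') xor bit c (col (xs zero) y'))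
      ≡⟨ cong₂ (λ p q → not (p xor q))
           (trans (bit-flip (inj₂ ex'x0) c) (star (inj₁ ex'x0) (inj₁ ex'y0) (inj₁ ex'y') (λ ()) (λ ()) (λ ()) c))
           (trans (bit-flip (inj₂ ey'x0) c) (star (inj₁ ey'x0) (inj₁ ey'y0) (inj₂ ex'y') (λ ()) (λ ()) (λ ()) c)) ⟩
    not (not (bit c (col x' (ys zero)) xor bit c (col x' y')) xor not (bit c (col y' (ys zero)) xor bit c (col y' x')))
      ≡⟨ cong (λ m → not (not (bit c (col x' (ys zero)) xor m) xor not (bit c (col y' (ys zero)) xor bit c (col y' x')))) (bit-flip (inj₁ ex'y') c) ⟩
    not (not (bit c (col x' (ys zero)) xor bit c (col y' x')) xor not (bit c (col y' (ys zero)) xor bit c (col y' x')))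
      ≡⟨ cong not (not-xor-cancel (bit c (col x' (ys zero))) (bit c (col y' (ys zero))) (bit c (col y' x'))) ⟩
    not (bit c (col x' (ys zero)) xor bit c (col y' (ys zero)))
      ≡⟨ cong₂ (λ p q → not (p xor q)) (bit-flip (inj₁ ex'y0) c) (bit-flip (inj₁ ey'y0) c) ⟩
    not (bit c (col (ys zero) x') xor bit c (col (ys zero) y'))
      ≡⟨ sym (trans (bit-flip (inj₂ (ypath zero)) c) (star (inj₁ (ypath zero)) (inj₂ ex'y0) (inj₂ ey'y0) (λ ()) (λ ()) (λ ()) c)) ⟩
    bit c (col (ys (suc zero)) (ys zero)) ∎

  next : ∀ i → bit c (col (xs (suc (inject₁ i))) (xs (inject₁ (inject₁ i)))) ≡ bit c (col (ys (suc (inject₁ i))) (ys (inject₁ (inject₁ i)))) →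
               bit c (col (xs (suc (suc i))) (xs (suc (inject₁ i)))) ≡ bit c (col (ys (suc (suc i))) (ys (suc (inject₁ i))))
  next i ih = begin
    bit c (col (xs (suc (suc i))) (xs (suc (inject₁ i))))
      ≡⟨ trans (bit-flip (inj₂ (xpath (suc i))) c)
           (star (inj₁ (xpath (suc i))) (inj₂ (xpath (inject₁ i))) (inj₁ r) (λ eq → suc-suc≢inject₁ i (cong level eq)) (λ ()) (λ ()) c) ⟩
    not (bit c (col (xs (suc (inject₁ i))) (xs (inject₁ (inject₁ i)))) xor bit c (col (xs (suc (inject₁ i))) (ys (suc (inject₁ i)))))
      ≡⟨ cong₂ (λ p q → not (p xor q)) ih (bit-flip (inj₁ r) c) ⟩
    not (bit c (col (ys (suc (inject₁ i))) (ys (inject₁ (inject₁ i)))) xor bit c (col (ys (suc (inject₁ i))) (xs (suc (inject₁ i)))))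
      ≡⟨ sym (trans (bit-flip (inj₂ (ypath (suc i))) c)
           (star (inj₁ (ypath (suc i))) (inj₂ (ypath (inject₁ i))) (inj₂ r) (λ eq → suc-suc≢inject₁ i (cong level eq)) (λ ()) (λ ()) c)) ⟩
    bit c (col (ys (suc (suc i))) (ys (suc (inject₁ i)))) ∎
    where
    r : HE (suc t) (xs (suc (inject₁ i))) (ys (suc (inject₁ i)))
    -- Level `1 + i` is strictly below the terminals at level `1 + t`, where there is no rung.
    r = rung (suc (inject₁ i)) (s≤s z≤n) (s≤s (subst (λ m → suc m ℕ.≤ t) (sym (Fin.toℕ-inject₁ i)) (Fin.toℕ<n i)))

-- Gluing

pull : ∀ {V W : Set} {E : V → V → Set} {F : W → W → Set} {k} (f : V → W) → Injective _≡_ _≡_ f →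
  (∀ {a b} → E a b → F (f a) (f b)) → PairColouring k F → PairColouring k E
pull f inj hom C = record
  { col    = λ a b → col (f a) (f b)
  ; proper = proper ∘ hom
  ; flip   = flip ∘ hom
  ; disj   = λ e e′ b≢c → disj (hom e) (hom e′) (b≢c ∘ inj)
  }
  where open PairColouring C

-- A `Graph` is a bare relation. Splitting cases on the glued vertices and reading edges in both
-- directions require these properties, which are inherited along the construction of the class.
record WellFormed (G : Graph) : Set where
  field
    _≟_ : DecidableEquality (V G)
    symm : ∀ {a b} → Adj G a b → Adj G b a
    irr  : ∀ {a} → ¬ Adj G a a

module Gluing (G : Graph) (Keep : V G → Set) (KeepE : V G → V G → Set) (K : Graph) (kx ky : V K) (z₁ z₂ : V G)
  (wfG : WellFormed G) (wfK : WellFormed K) (z₁≢z₂ : z₁ ≢ z₂) where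

  private
    module G = WellFormed wfG
    module K = WellFormed wfK

  Glued = Glue G Keep KeepE K kx ky z₁ z₂

  glue-wf : (∀ {a b} → KeepE a b → KeepE b a) → WellFormed Glued
  glue-wf keepE-sym = record { _≟_ = _≟_ ; symm = λ {a} {b} → symm a b ; irr = λ {a} → irr a }
    where
    _≟_ : DecidableEquality (V Glued)
    _≟_ = ≡-dec (Refinement._≟_ G._≟_) (Refinement._≟_ K._≟_)

    symm : ∀ a b → Adj Glued a b → Adj Glued b a
    symm (inj₁ a) (inj₁ b) (e , k)          = G.symm e , keepE-sym k
    symm (inj₁ a) (inj₂ p) (inj₁ (eq , e))  = inj₁ (eq , K.symm e)
    symm (inj₁ a) (inj₂ p) (inj₂ (eq , e))  = inj₂ (eq , K.symm e)
    symm (inj₂ p) (inj₁ a) (inj₁ (eq , e))  = inj₁ (eq , K.symm e)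
    symm (inj₂ p) (inj₁ a) (inj₂ (eq , e))  = inj₂ (eq , K.symm e)
    symm (inj₂ p) (inj₂ q) e                = K.symm e

    irr : ∀ a → ¬ Adj Glued a a
    irr (inj₁ a) (e , _) = G.irr e
    irr (inj₂ p) e       = K.irr e

  module Embed (keep₁ : Keep z₁) (keep₂ : Keep z₂) (kx≢ky : kx ≢ ky) (no-xy : ¬ Adj K kx ky) where

    ζ₁ ζ₂ : V Glued
    ζ₁ = inj₁ (z₁ , [ keep₁ ])
    ζ₂ = inj₁ (z₂ , [ keep₂ ])

    embedK : V K → V Glued
    embedK p with p K.≟ kx
    ... | yes _   = ζ₁
    ... | no p≢kx with p K.≟ ky
    ...   | yes _   = ζ₂
    ...   | no p≢ky = inj₂ (p , [ p≢kx , p≢ky ])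

    embedK-x : embedK kx ≡ ζ₁
    embedK-x with kx K.≟ kx
    ... | yes _ = refl
    ... | no  n = ⊥-elim (n refl)

    embedK-y : embedK ky ≡ ζ₂
    embedK-y with ky K.≟ kx
    ... | yes e = ⊥-elim (kx≢ky (sym e))
    ... | no  _ with ky K.≟ ky
    ...   | yes _ = refl
    ...   | no  n = ⊥-elim (n refl)

    embedK-new : ∀ {p} → p ≢ kx → p ≢ ky → ∃ λ π → embedK p ≡ inj₂ π
    embedK-new {p} p≢kx p≢ky with p K.≟ kx
    ... | yes e = ⊥-elim (p≢kx e)
    ... | no  _ with p K.≟ ky
    ...   | yes e = ⊥-elim (p≢ky e)
    ...   | no  _ = _ , refl

    embedK-injective : Injective _≡_ _≡_ embedK
    embedK-injective {p} {q} eq with p K.≟ kx | q K.≟ kx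
    ... | yes refl | yes refl = refl
    ... | yes refl | no _ with q K.≟ ky
    ...   | yes refl with refl ← eq = ⊥-elim (z₁≢z₂ refl)
    ...   | no _ with () ← eq
    embedK-injective {p} {q} eq | no _ | yes refl with p K.≟ ky
    ...   | yes refl with refl ← eq = ⊥-elim (z₁≢z₂ refl)
    ...   | no _ with () ← eq
    embedK-injective {p} {q} eq | no _ | no _ with p K.≟ ky | q K.≟ ky
    ...   | yes refl | yes refl = refl
    ...   | yes refl | no _ with () ← eq
    ...   | no _ | yes refl with () ← eq
    ...   | no _ | no _ with refl ← eq = refl

    -- An edge joining the two terminals would have no counterpart in the glued graph, which is why
    -- `no-xy` is assumed.
    embedK-hom : ∀ {p q} → Adj K p q → Adj Glued (embedK p) (embedK q)
    embedK-hom {p} {q} e with p K.≟ kx | q K.≟ kx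
    ... | yes refl | yes refl = ⊥-elim (K.irr e)
    ... | yes refl | no _ with q K.≟ ky
    ...   | yes refl = ⊥-elim (no-xy e)
    ...   | no _ = inj₁ (refl , e)
    embedK-hom {p} {q} e | no _ | yes refl with p K.≟ ky
    ...   | yes refl = ⊥-elim (no-xy (K.symm e))
    ...   | no _ = inj₁ (refl , e)
    embedK-hom {p} {q} e | no _ | no _ with p K.≟ ky | q K.≟ ky
    ...   | yes refl | yes refl = ⊥-elim (K.irr e)
    ...   | yes refl | no _ = inj₂ (refl , e)
    ...   | no _ | yes refl = inj₂ (refl , e)
    ...   | no _ | no _ = e

    pullK : ∀ {k} → PairColouring k (Adj Glued) → PairColouring k (Adj K)
    pullK = pull embedK embedK-injective embedK-hom

dec-by-code : ∀ {X : Set} {k} (xs : Vec X k) (code : X → Fin k) →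
  (∀ a → Vec.lookup xs (code a) ≡ a) → DecidableEquality X
dec-by-code xs code section a b = map′
  (λ e → trans (sym (section a)) (trans (cong (Vec.lookup xs) e) (section b)))
  (cong code) (code a Fin.≟ code b)

K4⁺-wf : WellFormed K4⁺
K4⁺-wf = record { _≟_ = dec-by-code (ka ∷ kb ∷ kc ∷ kd ∷ ks ∷ []) code
                 λ { ka → refl ; kb → refl ; kc → refl ; kd → refl ; ks → refl }
               ; symm = Sum.swap ; irr = λ { (inj₁ ()) ; (inj₂ ()) } }
  where
  code : K4V → Fin 5
  code ka = Fin.# 0
  code kb = Fin.# 1
  code kc = Fin.# 2
  code kd = Fin.# 3
  code ks = Fin.# 4

G₂-wf : WellFormed G₂
G₂-wf = record { _≟_ = dec-by-code (u ∷ v ∷ w ∷ x ∷ y ∷ []) code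
                 λ { u → refl ; v → refl ; w → refl ; x → refl ; y → refl }
               ; symm = Sum.swap ; irr = λ { (inj₁ ()) ; (inj₂ ()) } }
  where
  open G2V
  code : G2V → Fin 5
  code u = Fin.# 0
  code v = Fin.# 1
  code w = Fin.# 2
  code x = Fin.# 3
  code y = Fin.# 4

G₄-wf : WellFormed G₄
G₄-wf = record { _≟_ = dec-by-code (x ∷ y ∷ u0 ∷ u1 ∷ v0 ∷ v1 ∷ w ∷ []) code
                 λ { x → refl ; y → refl ; u0 → refl ; u1 → refl ; v0 → refl ; v1 → refl ; w → refl }
               ; symm = Sum.swap ; irr = λ { (inj₁ ()) ; (inj₂ ()) } }
  where
  open G4V
  code : G4V → Fin 7
  code x = Fin.# 0
  code y = Fin.# 1
  code u0 = Fin.# 2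
  code u1 = Fin.# 3
  code v0 = Fin.# 4
  code v1 = Fin.# 5
  code w = Fin.# 6

G₈-wf : WellFormed G₈
G₈-wf = record { _≟_ = dec-by-code (x ∷ y ∷ u0 ∷ u1 ∷ u2 ∷ v0 ∷ v1 ∷ []) code
                 λ { x → refl ; y → refl ; u0 → refl ; u1 → refl ; u2 → refl ; v0 → refl ; v1 → refl }
               ; symm = Sum.swap ; irr = λ { (inj₁ ()) ; (inj₂ ()) } }
  where
  open G8V
  code : G8V → Fin 7
  code x = Fin.# 0
  code y = Fin.# 1
  code u0 = Fin.# 2
  code u1 = Fin.# 3
  code u2 = Fin.# 4
  code v0 = Fin.# 5
  code v1 = Fin.# 6

H-wf : ∀ t → WellFormed (H t)
H-wf t = record { _≟_ = eq? ; symm = Sum.swap ; irr = λ { (inj₁ e) → irr e refl ; (inj₂ e) → irr e refl } }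
  where
  open HV
  eq? : DecidableEquality (HV t)
  eq? x' x' = yes refl
  eq? x' y' = no λ ()
  eq? x' (xs _) = no λ ()
  eq? x' (ys _) = no λ ()
  eq? y' x' = no λ ()
  eq? y' y' = yes refl
  eq? y' (xs _) = no λ ()
  eq? y' (ys _) = no λ ()
  eq? (xs _) x' = no λ ()
  eq? (xs _) y' = no λ ()
  eq? (xs i) (xs j) = map′ (cong xs) (λ { refl → refl }) (i Fin.≟ j)
  eq? (xs _) (ys _) = no λ ()
  eq? (ys _) x' = no λ ()
  eq? (ys _) y' = no λ ()
  eq? (ys _) (xs _) = no λ ()
  eq? (ys i) (ys j) = map′ (cong ys) (λ { refl → refl }) (i Fin.≟ j)
  inject₁≢suc : ∀ {n} (i : Fin n) → inject₁ i ≢ suc i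
  inject₁≢suc (suc i) eq = inject₁≢suc i (Fin.suc-injective eq)
  irr : ∀ {a b} → HE t a b → a ≢ b
  irr (xpath i) eq = inject₁≢suc i (cong (λ { (xs j) → j ; _ → zero }) eq)
  irr (ypath i) eq = inject₁≢suc i (cong (λ { (ys j) → j ; _ → zero }) eq)
  irr ex'y' ()
  irr ex'x0 ()
  irr ex'y0 ()
  irr ey'x0 ()
  irr ey'y0 ()
  irr (rung i _ _) ()

-- The common interface of the three gadgets that replace a vertex of degree 2. The edges from the
-- terminals to `nx` and `ny` stand for its two edges, and `apart` is the disjointness required
-- there.
record Separator (K : Graph) (kx ky : V K) : Set where
  field
    wf    : WellFormed K
    x≢y   : kx ≢ ky
    no-xy : ¬ Adj K kx ky
    nx ny : V K
    x-nx  : Adj K kx nx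
    y-ny  : Adj K ky ny
    apart : (C : PairColouring 6 (Adj K)) → PairColouring.col C kx nx # PairColouring.col C ky ny

gadget : ∀ t → Separator (Gt t) (Gx t) (Gy t)
gadget two = record
  { wf = G₂-wf ; x≢y = λ () ; no-xy = λ { (inj₁ ()) ; (inj₂ ()) }
  ; x-nx = inj₂ vx ; y-ny = inj₂ wy ; apart = G₂-disjoint }
gadget four = record
  { wf = G₄-wf ; x≢y = λ () ; no-xy = λ { (inj₁ ()) ; (inj₂ ()) }
  ; x-nx = inj₁ xu1 ; y-ny = inj₂ v1y ; apart = G₄-disjoint }
gadget eight = record
  { wf = G₈-wf ; x≢y = λ () ; no-xy = λ { (inj₁ ()) ; (inj₂ ()) }
  ; x-nx = inj₁ xu2 ; y-ny = inj₂ v1y ; apart = G₈-disjoint }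

adjacent⇒≢ : ∀ {G} → WellFormed G → ∀ {a b} → Adj G a b → a ≢ b
adjacent⇒≢ wfG e refl = WellFormed.irr wfG e

module _ {G : Graph} (t : GIndex) (z z₁ z₂ : V G) (deg2 : Degree2 G z z₁ z₂) (wfG : WellFormed G) where
  private
    open WellFormed wfG
    module S = Separator (gadget t)
    z₁≢z₂ = proj₁ deg2
    z-z₁  = proj₁ (proj₂ deg2)
    z-z₂  = proj₁ (proj₂ (proj₂ deg2))
    only  = proj₂ (proj₂ (proj₂ deg2))
    open Gluing G (λ a → a ≢ z) (λ _ _ → ⊤) (Gt t) (Gx t) (Gy t) z₁ z₂ wfG S.wf z₁≢z₂
    open Embed (adjacent⇒≢ wfG (symm z-z₁)) (adjacent⇒≢ wfG (symm z-z₂)) S.x≢y S.no-xy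

  vertexOp-wf : WellFormed (VertexOp G t z z₁ z₂)
  vertexOp-wf = glue-wf λ _ → tt

  -- At a vertex other than `z` the colouring is the old one with a gadget edge in place of the edge
  -- to `z`. Only disjointness at `z` itself draws on the gadget.
  unglue-vertex : PairColouring 6 (Adj (VertexOp G t z z₁ z₂)) → PairColouring 6 (Adj G)
  unglue-vertex C = record
    { col    = λ a b → col′ a b (a ≟ z) (b ≟ z)
    ; proper = λ {a} {b} → proper′ (a ≟ z) (b ≟ z)
    ; flip   = λ {a} {b} → flip′ (a ≟ z) (b ≟ z)
    ; disj   = λ {a} {b} {d} → disj′ (a ≟ z) (b ≟ z) (d ≟ z)
    }
    where
    open PairColouring C

    old : ∀ a → a ≢ z → V Glued
    old a a≢z = inj₁ (a , [ a≢z ])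

    ζ₁-nx : Adj Glued ζ₁ (embedK S.nx)
    ζ₁-nx = subst (λ p → Adj Glued p (embedK S.nx)) embedK-x (embedK-hom S.x-nx)

    ζ₂-ny : Adj Glued ζ₂ (embedK S.ny)
    ζ₂-ny = subst (λ p → Adj Glued p (embedK S.ny)) embedK-y (embedK-hom S.y-ny)

    new-nx : ∃ λ π → embedK S.nx ≡ inj₂ π
    new-nx = embedK-new (adjacent⇒≢ S.wf (WellFormed.symm S.wf S.x-nx)) (λ eq → S.no-xy (subst (Adj (Gt t) (Gx t)) eq S.x-nx))

    new-ny : ∃ λ π → embedK S.ny ≡ inj₂ π
    new-ny = embedK-new (λ eq → S.no-xy (subst (λ p → Adj (Gt t) p (Gy t)) eq (WellFormed.symm S.wf S.y-ny)))
                        (adjacent⇒≢ S.wf (WellFormed.symm S.wf S.y-ny))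

    -- The edge az of G is represented by the gadget edge leaving a.
    far : ∀ a b → Dec (b ≡ z) → Dec (a ≡ z₁) → V Glued
    far a b (no b≢z) _       = old b b≢z
    far a b (yes _)  (yes _) = embedK S.nx
    far a b (yes _)  (no _)  = embedK S.ny

    far-adj : ∀ {a b} (a≢z : a ≢ z) b? a? → Adj G a b → Adj Glued (old a a≢z) (far a b b? a?)
    far-adj a≢z (no b≢z)   _          e = e , tt
    far-adj a≢z (yes refl) (yes refl) e = ζ₁-nx
    far-adj a≢z (yes refl) (no a≢z₁)  e with only _ (symm e)
    ... | inj₁ a≡z₁ = ⊥-elim (a≢z₁ a≡z₁)
    ... | inj₂ refl = ζ₂-ny

    far-injective : ∀ {a b d} b? d? a? → far a b b? a? ≡ far a d d? a? → b ≡ d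
    far-injective (no _)     (no _)     _       refl = refl
    far-injective (yes refl) (yes refl) _       _    = refl
    far-injective (no _)     (yes _)    (yes _) eq with () ← trans eq (proj₂ new-nx)
    far-injective (no _)     (yes _)    (no _)  eq with () ← trans eq (proj₂ new-ny)
    far-injective (yes _)    (no _)     (yes _) eq with () ← trans (sym eq) (proj₂ new-nx)
    far-injective (yes _)    (no _)     (no _)  eq with () ← trans (sym eq) (proj₂ new-ny)

    col′ : ∀ a b → Dec (a ≡ z) → Dec (b ≡ z) → Pair 6
    col′ a b (no a≢z) b?       = col (old a a≢z) (far a b b? (a ≟ z₁))
    col′ a b (yes a≡z) (no b≢z) = col (old b b≢z) (far b a (yes a≡z) (b ≟ z₁))
    -- An arbitrary value: there is no loop at `z`.
    col′ a b (yes _)  (yes _)  = col ζ₁ ζ₁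

    proper′ : ∀ {a b} a? b? → Adj G a b → Proper (col′ a b a? b?)
    proper′ {a} (no a≢z) b? e = proper (far-adj a≢z b? (a ≟ z₁) e)
    proper′ {b = b} (yes a≡z) (no b≢z) e = proper (far-adj b≢z (yes a≡z) (b ≟ z₁) (symm e))
    proper′ (yes refl) (yes refl) e = ⊥-elim (irr e)

    flip′ : ∀ {a b} a? b? → Adj G a b → ∀ {c} → c ∈ₚ col′ a b a? b? → c ∈ₚ col′ b a b? a?
    flip′ (no a≢z)   (no b≢z)   e = flip (e , tt)
    flip′ (no _)     (yes _)    e = id
    flip′ (yes _)    (no _)     e = id
    flip′ (yes refl) (yes refl) e = ⊥-elim (irr e)

    apart : col ζ₁ (embedK S.nx) # col ζ₂ (embedK S.ny)
    apart = subst₂ (λ p q → col p (embedK S.nx) # col q (embedK S.ny)) embedK-x embedK-y (S.apart (pullK C))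

    at-z : ∀ {b d} (b≢z : b ≢ z) (d≢z : d ≢ z) b? d? → Adj G z b → Adj G z d → b ≢ d →
      col (old b b≢z) (far b z (yes refl) b?) # col (old d d≢z) (far d z (yes refl) d?)
    at-z b≢z d≢z (yes refl) (yes refl) e f b≢d = ⊥-elim (b≢d refl)
    at-z b≢z d≢z (yes refl) (no d≢z₁)  e f b≢d with only _ f
    ... | inj₁ d≡z₁ = ⊥-elim (d≢z₁ d≡z₁)
    ... | inj₂ refl = apart
    at-z b≢z d≢z (no b≢z₁) (yes refl)  e f b≢d with only _ e
    ... | inj₁ b≡z₁ = ⊥-elim (b≢z₁ b≡z₁)
    ... | inj₂ refl = #-sym {P = col ζ₁ (embedK S.nx)} {Q = col ζ₂ (embedK S.ny)} apart
    at-z b≢z d≢z (no b≢z₁) (no d≢z₁)   e f b≢d with only _ e | only _ f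
    ... | inj₁ b≡z₁ | _         = ⊥-elim (b≢z₁ b≡z₁)
    ... | inj₂ _    | inj₁ d≡z₁ = ⊥-elim (d≢z₁ d≡z₁)
    ... | inj₂ refl | inj₂ refl = ⊥-elim (b≢d refl)

    disj′ : ∀ {a b d} a? b? d? → Adj G a b → Adj G a d → b ≢ d → col′ a b a? b? # col′ a d a? d?
    disj′ {a} (no a≢z) b? d? e f b≢d =
      disj (far-adj a≢z b? (a ≟ z₁) e) (far-adj a≢z d? (a ≟ z₁) f) (b≢d ∘ far-injective b? d? (a ≟ z₁))
    disj′ {b = b} {d} (yes refl) (no b≢z) (no d≢z) e f b≢d = at-z b≢z d≢z (b ≟ z₁) (d ≟ z₁) e f b≢d
    disj′ (yes refl) (yes refl) _          e f b≢d = ⊥-elim (irr e)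
    disj′ (yes refl) (no _)     (yes refl) e f b≢d = ⊥-elim (irr f)

module _ {G : Graph} (t : ℕ) (z₁ z₂ : V G) (z₁-z₂ : Adj G z₁ z₂) (wfG : WellFormed G) where
  private
    open WellFormed wfG
    K = H (suc t)
    wfK = H-wf (suc t)
    z₁≢z₂ = adjacent⇒≢ wfG z₁-z₂
    Kept : V G → V G → Set
    Kept a b = ¬ ((a ≡ z₁ × b ≡ z₂) ⊎ (a ≡ z₂ × b ≡ z₁))
    no-xy : ¬ Adj K (Hx (suc t)) (Hy (suc t))
    no-xy (inj₁ (rung _ _ t<t)) = ℕ.<-irrefl (cong suc (Fin.toℕ-fromℕ t)) t<t
    open Gluing G (λ _ → ⊤) Kept K (Hx (suc t)) (Hy (suc t)) z₁ z₂ wfG wfK z₁≢z₂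
    open Embed tt tt (λ ()) no-xy
    nx ny : V K
    nx = HV.xs (inject₁ (fromℕ t))
    ny = HV.ys (inject₁ (fromℕ t))

  edgeOp-wf : WellFormed (EdgeOp G (suc t) z₁ z₂)
  edgeOp-wf = glue-wf (λ k → k ∘ Sum.swap ∘ Sum.map swap swap)

  -- The edge between `z₁` and `z₂` takes, read from either end, the pair of the gadget edge at that
  -- end. Disjointness is then inherited at both ends, and the equality of the two terminal 2-sets
  -- is what makes `flip` hold.
  unglue-edge : PairColouring 6 (Adj (EdgeOp G (suc t) z₁ z₂)) → PairColouring 6 (Adj G)
  unglue-edge C = record
    { col    = λ a b → col (old a) (far a b (12? a b) (21? a b))
    ; proper = λ {a} {b} e → proper (far-adj (12? a b) (21? a b) e)
    ; flip   = λ {a} {b} → flip′ (12? a b) (21? a b) (12? b a) (21? b a)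
    ; disj   = λ {a} {b} {d} e f b≢d → disj (far-adj (12? a b) (21? a b) e) (far-adj (12? a d) (21? a d) f)
                 (b≢d ∘ far-injective (12? a b) (21? a b) (12? a d) (21? a d))
    }
    where
    open PairColouring C

    old : V G → V Glued
    old a = inj₁ (a , [ tt ])

    12? : ∀ a b → Dec (a ≡ z₁ × b ≡ z₂)
    12? a b = (a ≟ z₁) ×-dec (b ≟ z₂)

    21? : ∀ a b → Dec (a ≡ z₂ × b ≡ z₁)
    21? a b = (a ≟ z₂) ×-dec (b ≟ z₁)

    ζ₁-nx : Adj Glued ζ₁ (embedK nx)
    ζ₁-nx = subst (λ p → Adj Glued p (embedK nx)) embedK-x (embedK-hom (inj₂ (xpath (fromℕ t))))

    ζ₂-ny : Adj Glued ζ₂ (embedK ny)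
    ζ₂-ny = subst (λ p → Adj Glued p (embedK ny)) embedK-y (embedK-hom (inj₂ (ypath (fromℕ t))))

    new-nx : ∃ λ π → embedK nx ≡ inj₂ π
    new-nx = embedK-new (adjacent⇒≢ wfK (inj₁ (xpath (fromℕ t)))) (λ ())

    new-ny : ∃ λ π → embedK ny ≡ inj₂ π
    new-ny = embedK-new (λ ()) (adjacent⇒≢ wfK (inj₁ (ypath (fromℕ t))))

    far : ∀ a b → Dec (a ≡ z₁ × b ≡ z₂) → Dec (a ≡ z₂ × b ≡ z₁) → V Glued
    far a b (yes _) _       = embedK nx
    far a b (no _)  (yes _) = embedK ny
    far a b (no _)  (no _)  = old b

    far-adj : ∀ {a b} p? q? → Adj G a b → Adj Glued (old a) (far a b p? q?)
    far-adj (yes (refl , _)) _                e = ζ₁-nx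
    far-adj (no _)           (yes (refl , _)) e = ζ₂-ny
    far-adj (no n)           (no m)           e = e , Sum.[ n , m ]

    far-injective : ∀ {a b d} p? q? p′? q′? → far a b p? q? ≡ far a d p′? q′? → b ≡ d
    far-injective (yes (_ , refl)) _                (yes (_ , refl)) _                _    = refl
    far-injective (yes (refl , _)) _                (no _)           (yes (eq , _))   _    = ⊥-elim (z₁≢z₂ eq)
    far-injective (yes _)          _                (no _)           (no _)           eq with () ← trans (sym eq) (proj₂ new-nx)
    far-injective (no _)           (yes (eq , _))   (yes (refl , _)) _                _    = ⊥-elim (z₁≢z₂ eq)
    far-injective (no _)           (yes (_ , refl)) (no _)           (yes (_ , refl)) _    = refl
    far-injective (no _)           (yes _)          (no _)           (no _)           eq with () ← trans (sym eq) (proj₂ new-ny)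
    far-injective (no _)           (no _)           (yes _)          _                eq with () ← trans eq (proj₂ new-nx)
    far-injective (no _)           (no _)           (no _)           (yes _)          eq with () ← trans eq (proj₂ new-ny)
    far-injective (no _)           (no _)           (no _)           (no _)           refl = refl

    same : ∀ c → bit c (col ζ₁ (embedK nx)) ≡ bit c (col ζ₂ (embedK ny))
    same c = subst₂ (λ p q → bit c (col p (embedK nx)) ≡ bit c (col q (embedK ny))) embedK-x embedK-y
      (ladder-equal t (pullK C) c (fromℕ t))

    flip′ : ∀ {a b} p? q? p′? q′? → Adj G a b → ∀ {c} →
      c ∈ₚ col (old a) (far a b p? q?) → c ∈ₚ col (old b) (far b a p′? q′?)
    flip′ (yes (refl , refl)) _ (yes (eq , _)) _ e = ⊥-elim (z₁≢z₂ (sym eq))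
    flip′ (yes (refl , refl)) _ (no _) (yes _) e {c} c∈ =
      bit-true⁻ (col ζ₂ (embedK ny)) (trans (sym (same c)) (bit-true {P = col ζ₁ (embedK nx)} c∈))
    flip′ (yes (refl , refl)) _ (no _) (no n) e = ⊥-elim (n (refl , refl))
    flip′ (no _) (yes (refl , refl)) (yes _) _ e {c} c∈ =
      bit-true⁻ (col ζ₁ (embedK nx)) (trans (same c) (bit-true {P = col ζ₂ (embedK ny)} c∈))
    flip′ (no _) (yes (refl , refl)) (no n) _ e = ⊥-elim (n (refl , refl))
    flip′ (no n) (no m) (yes (eq , eq′)) _ e = ⊥-elim (m (eq′ , eq))
    flip′ (no n) (no m) (no _) (yes (eq , eq′)) e = ⊥-elim (n (eq′ , eq))
    flip′ (no n) (no m) (no _) (no _) e = flip (e , Sum.[ n , m ])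

-- The lower bound: six colours never suffice

𝒫-wf : ∀ {G} → InP G → WellFormed G
𝒫-wf base = K4⁺-wf
𝒫-wf (iso {G} {G'} i p) = record
  { _≟_  = λ a b → map′ (λ e → trans (sym (strictlyInverseˡ a)) (trans (cong to e) (strictlyInverseˡ b))) (cong from) (from a G.≟ from b)
  ; symm = λ {a} {b} e → subst₂ (Adj G') (strictlyInverseˡ b) (strictlyInverseˡ a) (Equivalence.to (Iso.pres i (from b) (from a)) (G.symm
      (Equivalence.from (Iso.pres i (from a) (from b)) (subst₂ (Adj G') (sym (strictlyInverseˡ a)) (sym (strictlyInverseˡ b)) e))))
  ; irr  = λ {a} e → G.irr (Equivalence.from (Iso.pres i (from a) (from a)) (subst₂ (Adj G') (sym (strictlyInverseˡ a)) (sym (strictlyInverseˡ a)) e))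
  }
  where
  module G = WellFormed (𝒫-wf p)
  open Inverse (Iso.bij i)
𝒫-wf (vertex t z z₁ z₂ deg2 p) = vertexOp-wf t z z₁ z₂ deg2 (𝒫-wf p)
𝒫-wf (edge (suc t) _ z₁ z₂ e p) = edgeOp-wf t z₁ z₂ e (𝒫-wf p)

𝒫-not-6 : ∀ {G} → InP G → ¬ PairColouring 6 (Adj G)
𝒫-not-6 base = K4⁺-not-6
𝒫-not-6 (iso i p) C = 𝒫-not-6 p (pull (Inverse.to (Iso.bij i)) (Injection.injective (↔⇒↣ (Iso.bij i))) (Equivalence.to (Iso.pres i _ _)) C)
𝒫-not-6 (vertex t z z₁ z₂ deg2 p) C = 𝒫-not-6 p (unglue-vertex t z z₁ z₂ deg2 (𝒫-wf p) C)
𝒫-not-6 (edge (suc t) _ z₁ z₂ e p) C = 𝒫-not-6 p (unglue-edge t z₁ z₂ e (𝒫-wf p) C)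

IncColourable-mono : ∀ {n} {A : Fin n → Fin n → Bool} {k m} → k ℕ.≤ m → IncColourable A k → IncColourable A m
IncColourable-mono k≤m (c , cf) = (λ a b → inject≤ (c a b) k≤m) ,
  λ a b p q e f ne sh eq → cf a b p q e f ne sh (Fin.inject≤-injective k≤m k≤m _ _ eq)

-- At most six colours can be regarded as six, and a colouring restricts along every injective map
-- that preserves edges, so an embedding that is not induced is enough.
𝒫⁺-lower-bound : ∀ {n} {A : Fin n → Fin n → Bool} → InP⁺ A → ∀ m → IncColourable A m → 7 ℕ.≤ m
𝒫⁺-lower-bound P m C with 7 ℕ.≤? m
... | yes 7≤m = 7≤m
... | no  7≰m = ⊥-elim (𝒫-not-6 memberInP (pull f inj (λ {a} {b} → hom a b)
                  (fromIncidence simple (IncColourable-mono (ℕ.≤-pred (ℕ.≰⇒> 7≰m)) C))))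
  where
  open InP⁺ P
  f   = proj₁ contains
  inj = proj₁ (proj₂ contains)
  hom = proj₂ (proj₂ contains)

-- Choosing colours among seven

abstract
  fresh : ∀ {k} (xs : List (Fin k)) → length xs < k → ∃ λ c → c ∉ xs
  fresh {k} xs short with Fin.any? (λ c → ¬? (Any.any? (c Fin.≟_) xs))
  ... | yes found = found
  ... | no  none  = ⊥-elim (ℕ.<⇒≱ short (subst (ℕ._≤ length xs) (length-tabulate id)
        (Unique-⊆⇒length≤ (allFin⁺ k) λ {c} _ → decidable-stable (Any.any? (c Fin.≟_) xs) λ c∉ → none (c , c∉))))

∉⇒All≢ : ∀ {X : Set} {c : X} xs → c ∉ xs → All (c ≢_) xs
∉⇒All≢ []       _  = []
∉⇒All≢ (x ∷ xs) c∉ = (c∉ ∘ here) ∷ ∉⇒All≢ xs (c∉ ∘ there)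

-- `frame` takes `j` so large that the result enumerates all seven colours.
grow : ∀ {k} j {xs : List (Fin k)} → Unique xs → j ℕ.+ length xs ℕ.≤ k →
  ∃ λ (ys : Vec (Fin k) j) → Unique (toList ys ++ xs)
grow zero    u _ = [] , u
grow (suc j) {xs} u le with ys , u′ ← grow j u (ℕ.≤-trans (ℕ.n≤1+n _) le)
  with c , c∉ ← fresh (toList ys ++ xs) (subst (_< _)
      (sym (trans (length-++ (toList ys)) (cong (ℕ._+ length xs) (length-toList ys)))) le)
  = c ∷ ys , ∉⇒All≢ _ c∉ ∷ u′

-- `F` and `G` exclude at most four colours. The first colour of `P` also avoids `R`, which makes at
-- most six exclusions; the second only has to differ from the first. Avoiding `R` ensures that `P`
-- and `R` are different sets, as `triangle` requires.
pick : ∀ (F G R : Pair 7) → ∃ λ P → Proper P × P # F × P # G × ¬ proj₁ P ∈ₚ R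
pick (f₁ , f₂) (g₁ , g₂) (r₁ , r₂)
  with c , c∉ ← fresh (f₁ ∷ f₂ ∷ g₁ ∷ g₂ ∷ r₁ ∷ r₂ ∷ []) (s≤s (s≤s (s≤s (s≤s (s≤s (s≤s (s≤s z≤n)))))))
  with d , d∉ ← fresh (c ∷ f₁ ∷ f₂ ∷ g₁ ∷ g₂ ∷ []) (s≤s (s≤s (s≤s (s≤s (s≤s (s≤s z≤n))))))
  = (c , d) , (λ eq → d∉ (here (sym eq)))
  , (λ { (inj₁ refl) (inj₁ e) → c∉ (here e) ; (inj₁ refl) (inj₂ e) → c∉ (there (here e))
       ; (inj₂ refl) (inj₁ e) → d∉ (there (here e)) ; (inj₂ refl) (inj₂ e) → d∉ (there (there (here e))) })
  , (λ { (inj₁ refl) (inj₁ e) → c∉ (there (there (here e))) ; (inj₁ refl) (inj₂ e) → c∉ (there (there (there (here e))))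
       ; (inj₂ refl) (inj₁ e) → d∉ (there (there (there (here e)))) ; (inj₂ refl) (inj₂ e) → d∉ (there (there (there (there (here e))))) })
  , (λ { (inj₁ e) → c∉ (there (there (there (there (here e))))) ; (inj₂ e) → c∉ (there (there (there (there (there (here e)))))) })

data Form : Set where
  same meet apart : Form

pattern 0F = zero
pattern 1F = suc 0F
pattern 2F = suc 1F
pattern 3F = suc 2F
pattern 4F = suc 3F
pattern 5F = suc 4F
pattern 6F = suc 5F

-- The high numbers come from `grow`, which puts new colours in front, so that the prescribed ones
-- occupy the last positions.
first : Pair 7
first = 6F , 5F

second : Form → Pair 7
second same  = 6F , 5F
second meet  = 6F , 4F
second apart = 4F , 3F

recolour : ∀ {k l} → (Fin k → Fin l) → Pair k → Pair l
recolour c (i , j) = c i , c j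

infix 4 _⊆ₚ_

_⊆ₚ_ : ∀ {k} → Pair k → Pair k → Set
P ⊆ₚ Q = ∀ {d} → d ∈ₚ P → d ∈ₚ Q

-- Up to a permutation of the seven colours, two 2-sets are determined by the size of their intersection.
record Frame (S T : Pair 7) : Set where
  field
    c     : Fin 7 → Fin 7
    inj   : Injective _≡_ _≡_ c
    form  : Form
    S⊆    : S ⊆ₚ recolour c first
    T⊆    : T ⊆ₚ recolour c (second form)

frame : ∀ S T → Proper S → Proper T → Frame S T
frame S@(s₁ , s₂) T@(t₁ , t₂) s t with t₁ ∈ₚ? S | t₂ ∈ₚ? S
... | yes t₁∈ | yes t₂∈
  with ys@(_ ∷ _ ∷ _ ∷ _ ∷ _ ∷ []) , u ←
    grow 5 {s₂ ∷ s₁ ∷ []} (((s ∘ sym) ∷ []) ∷ [] ∷ []) ℕ.≤-refl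
  = record { c = lookup (toList ys ++ s₂ ∷ s₁ ∷ []) ; inj = lookup-injective u _ _ ; form = same
           ; S⊆ = id ; T⊆ = λ { (inj₁ refl) → t₁∈ ; (inj₂ refl) → t₂∈ } }
... | yes (inj₁ refl) | no t₂∉
  with ys@(_ ∷ _ ∷ _ ∷ _ ∷ []) , u ←
    grow 4 {t₂ ∷ s₂ ∷ s₁ ∷ []} (((t₂∉ ∘ inj₂) ∷ (t₂∉ ∘ inj₁) ∷ []) ∷ ((s ∘ sym) ∷ []) ∷ [] ∷ []) ℕ.≤-refl
  = record { c = lookup (toList ys ++ t₂ ∷ s₂ ∷ s₁ ∷ []) ; inj = lookup-injective u _ _
           ; form = meet ; S⊆ = id ; T⊆ = id }
-- The shared colour is now the second one of `S`; listing `S` in the opposite order keeps the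
-- shared colour in the last position.
... | yes (inj₂ refl) | no t₂∉
  with ys@(_ ∷ _ ∷ _ ∷ _ ∷ []) , u ←
    grow 4 {t₂ ∷ s₁ ∷ s₂ ∷ []} (((t₂∉ ∘ inj₁) ∷ (t₂∉ ∘ inj₂) ∷ []) ∷ (s ∷ []) ∷ [] ∷ []) ℕ.≤-refl
  = record { c = lookup (toList ys ++ t₂ ∷ s₁ ∷ s₂ ∷ []) ; inj = lookup-injective u _ _
           ; form = meet ; S⊆ = Sum.swap ; T⊆ = id }
... | no t₁∉ | yes (inj₁ refl)
  with ys@(_ ∷ _ ∷ _ ∷ _ ∷ []) , u ←
    grow 4 {t₁ ∷ s₂ ∷ s₁ ∷ []} (((t₁∉ ∘ inj₂) ∷ (t₁∉ ∘ inj₁) ∷ []) ∷ ((s ∘ sym) ∷ []) ∷ [] ∷ []) ℕ.≤-refl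
  = record { c = lookup (toList ys ++ t₁ ∷ s₂ ∷ s₁ ∷ []) ; inj = lookup-injective u _ _
           ; form = meet ; S⊆ = id ; T⊆ = Sum.swap }
... | no t₁∉ | yes (inj₂ refl)
  with ys@(_ ∷ _ ∷ _ ∷ _ ∷ []) , u ←
    grow 4 {t₁ ∷ s₁ ∷ s₂ ∷ []} (((t₁∉ ∘ inj₁) ∷ (t₁∉ ∘ inj₂) ∷ []) ∷ (s ∷ []) ∷ [] ∷ []) ℕ.≤-refl
  = record { c = lookup (toList ys ++ t₁ ∷ s₁ ∷ s₂ ∷ []) ; inj = lookup-injective u _ _
           ; form = meet ; S⊆ = Sum.swap ; T⊆ = Sum.swap }
... | no t₁∉ | no t₂∉
  with ys@(_ ∷ _ ∷ _ ∷ []) , u ← grow 3 {t₂ ∷ t₁ ∷ s₂ ∷ s₁ ∷ []}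
    (((t ∘ sym) ∷ (t₂∉ ∘ inj₂) ∷ (t₂∉ ∘ inj₁) ∷ []) ∷ ((t₁∉ ∘ inj₂) ∷ (t₁∉ ∘ inj₁) ∷ []) ∷ ((s ∘ sym) ∷ []) ∷ [] ∷ []) ℕ.≤-refl
  = record { c = lookup (toList ys ++ t₂ ∷ t₁ ∷ s₂ ∷ s₁ ∷ []) ; inj = lookup-injective u _ _
           ; form = apart ; S⊆ = id ; T⊆ = id }

-- Disjointness as a finite conjunction, which is decided by evaluation on explicit colours and then
-- transported along an injection.
_##_ : ∀ {k} → Pair k → Pair k → Set
(i , j) ## (k , l) = i ≢ k × i ≢ l × j ≢ k × j ≢ l

_##?_ : ∀ {k} (P Q : Pair k) → Dec (P ## Q)
(i , j) ##? (k , l) = ¬? (i Fin.≟ k) ×-dec ¬? (i Fin.≟ l) ×-dec ¬? (j Fin.≟ k) ×-dec ¬? (j Fin.≟ l)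

##⇒# : ∀ {k l} {c : Fin k → Fin l} → Injective _≡_ _≡_ c → ∀ {P Q} → P ## Q → recolour c P # recolour c Q
##⇒# inj (p , q , r , s) (inj₁ refl) (inj₁ e) = p (inj e)
##⇒# inj (p , q , r , s) (inj₁ refl) (inj₂ e) = q (inj e)
##⇒# inj (p , q , r , s) (inj₂ refl) (inj₁ e) = r (inj e)
##⇒# inj (p , q , r , s) (inj₂ refl) (inj₂ e) = s (inj e)

-- A triangle z p q whose vertices p and q carry pendant edges coloured P and Q.
triangle : ∀ P Q → Proper P → Proper Q → ¬ proj₁ P ∈ₚ Q → ∃ λ zp → ∃ λ zq → ∃ λ pq →
  Proper zp × Proper zq × Proper pq × zp # P × pq # P × zq # Q × pq # Q × zp # zq × zp # pq × zq # pq
triangle P Q p q p∉Q with frame P Q p q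
-- Equal pendant pairs would leave five colours for the six that the triangle needs; the hypothesis
-- on the first colour of `P` excludes this.
... | record { c = c ; inj = inj ; form = same ; S⊆ = P⊆ ; T⊆ = Q⊆ } = ⊥-elim (p∉Q (same-set (P⊆ (inj₁ refl))))
  where
  q₁ = Q⊆ (inj₁ refl)
  q₂ = Q⊆ (inj₂ refl)
  same-set : proj₁ P ∈ₚ recolour c first → proj₁ P ∈ₚ Q
  same-set (inj₁ e) with q₁ | q₂
  ... | inj₁ e₁ | _       = inj₁ (trans e (sym e₁))
  ... | inj₂ _  | inj₁ e₂ = inj₂ (trans e (sym e₂))
  ... | inj₂ e₁ | inj₂ e₂ = ⊥-elim (q (trans e₁ (sym e₂)))
  same-set (inj₂ e) with q₁ | q₂
  ... | inj₂ e₁ | _       = inj₁ (trans e (sym e₁))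
  ... | inj₁ _  | inj₂ e₂ = inj₂ (trans e (sym e₂))
  ... | inj₁ e₁ | inj₁ e₂ = ⊥-elim (q (trans e₁ (sym e₂)))
... | record { c = c ; inj = inj
           ; form = meet ; S⊆ = P⊆ ; T⊆ = Q⊆ }
  -- `zp` uses the colour of `Q` missing from `P`, and `zq` that of `P` missing from `Q`. The other
  -- four entries are the colours outside both.
  = recolour c (4F , 3F) , recolour c (5F , 2F) , recolour c (0F , 1F)
  , (λ e → case inj e of λ ()) , (λ e → case inj e of λ ()) , (λ e → case inj e of λ ())
  , (λ a b → by (4F , 3F) first a (P⊆ b)) , (λ a b → by (0F , 1F) first a (P⊆ b))
  , (λ a b → by (5F , 2F) (second meet) a (Q⊆ b)) , (λ a b → by (0F , 1F) (second meet) a (Q⊆ b))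
  , by (4F , 3F) (5F , 2F) , by (4F , 3F) (0F , 1F) , by (5F , 2F) (0F , 1F)
  where
  by : ∀ X Y → {True (X ##? Y)} → recolour c X # recolour c Y
  by X Y {ok} = ##⇒# inj (toWitness ok)
... | record { c = c ; inj = inj ; form = apart ; S⊆ = P⊆ ; T⊆ = Q⊆ }
  = recolour c (4F , 3F) , recolour c (6F , 5F) , recolour c (0F , 1F)
  , (λ e → case inj e of λ ()) , (λ e → case inj e of λ ()) , (λ e → case inj e of λ ())
  , (λ a b → by (4F , 3F) first a (P⊆ b)) , (λ a b → by (0F , 1F) first a (P⊆ b))
  , (λ a b → by (6F , 5F) (second apart) a (Q⊆ b)) , (λ a b → by (0F , 1F) (second apart) a (Q⊆ b))
  , by (4F , 3F) (6F , 5F) , by (4F , 3F) (0F , 1F) , by (6F , 5F) (0F , 1F)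
  where
  by : ∀ X Y → {True (X ##? Y)} → recolour c X # recolour c Y
  by X Y {ok} = ##⇒# inj (toWitness ok)

-- Extending a colouring by finitely many coloured edges

Entry : Set → Set
Entry V = V × V × Pair 7

colour : ∀ {V} → Entry V → Pair 7
colour (_ , _ , P) = P

Joins : ∀ {V : Set} → V → V → Entry V → Set
Joins x y (u , v , _) = (x ≡ u × y ≡ v) ⊎ (x ≡ v × y ≡ u)

Meet : ∀ {V : Set} → Entry V → Entry V → Set
Meet (u , v , _) (u′ , v′ , _) = (u ≡ u′ ⊎ u ≡ v′) ⊎ (v ≡ u′ ⊎ v ≡ v′)

Joins-swap : ∀ {V : Set} {x y : V} {e} → Joins x y e → Joins y x e
Joins-swap (inj₁ (p , q)) = inj₂ (q , p)
Joins-swap (inj₂ (p , q)) = inj₁ (q , p)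

joins-meet : ∀ {V : Set} {x y z : V} {e e′} → Joins x y e → Joins x z e′ → Meet e e′
joins-meet (inj₁ (refl , _)) (inj₁ (refl , _)) = inj₁ (inj₁ refl)
joins-meet (inj₁ (refl , _)) (inj₂ (refl , _)) = inj₁ (inj₂ refl)
joins-meet (inj₂ (refl , _)) (inj₁ (refl , _)) = inj₂ (inj₁ refl)
joins-meet (inj₂ (refl , _)) (inj₂ (refl , _)) = inj₂ (inj₂ refl)

joins-unique : ∀ {V : Set} {x y z : V} {e} → Joins x y e → Joins x z e → y ≡ z
joins-unique (inj₁ (refl , refl)) (inj₁ (refl , refl)) = refl
joins-unique (inj₁ (refl , refl)) (inj₂ (refl , refl)) = refl
joins-unique (inj₂ (refl , refl)) (inj₁ (refl , refl)) = refl
joins-unique (inj₂ (refl , refl)) (inj₂ (refl , refl)) = refl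

module Overlay {V : Set} (_≟_ : DecidableEquality V) where

  joins? : ∀ x y (e : Entry V) → Dec (Joins x y e)
  joins? x y (u , v , _) = ((x ≟ u) ×-dec (y ≟ v)) ⊎-dec ((x ≟ v) ×-dec (y ≟ u))

  overlay : List (Entry V) → (V → V → Pair 7) → V → V → Pair 7
  overlay []      col x y = col x y
  overlay (e ∷ T) col x y with joins? x y e
  ... | yes _ = colour e
  ... | no  _ = overlay T col x y

  overlay-result : ∀ T col x y →
    (∃ λ e → e ∈ T × Joins x y e × overlay T col x y ≡ colour e) ⊎
    (All (λ e → ¬ Joins x y e) T × overlay T col x y ≡ col x y)
  overlay-result []      col x y = inj₂ ([] , refl)
  overlay-result (e ∷ T) col x y with joins? x y e
  ... | yes j = inj₁ (e , here refl , j , refl)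
  ... | no ¬j with overlay-result T col x y
  ...   | inj₁ (f , f∈ , j , eq) = inj₁ (f , there f∈ , j , eq)
  ...   | inj₂ (¬js , eq)        = inj₂ (¬j ∷ ¬js , eq)

  overlay-flip : ∀ T col {x y} → (All (λ e → ¬ Joins x y e) T → ∀ {c} → c ∈ₚ col x y → c ∈ₚ col y x) →
    ∀ {c} → c ∈ₚ overlay T col x y → c ∈ₚ overlay T col y x
  overlay-flip []      col         f = f []
  overlay-flip (e ∷ T) col {x} {y} f with joins? x y e | joins? y x e
  ... | yes _ | yes _ = id
  ... | yes j | no ¬j = ⊥-elim (¬j (Joins-swap {e = e} j))
  ... | no ¬j | yes j = ⊥-elim (¬j (Joins-swap {e = e} j))
  ... | no ¬j | no  _ = overlay-flip T col λ ¬js → f (¬j ∷ ¬js)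

  module _ {E E′ : V → V → Set} (E′-sym : ∀ {x y} → E′ x y → E′ y x)
    (C : PairColouring 7 E′) (T : List (Entry V)) where
    open PairColouring C

    Free : Entry V → Set
    Free (u , v , P) = (∀ {w} → E′ u w → col u w # P) × (∀ {w} → E′ v w → col v w # P)

    -- Conflicts are of three kinds: between old edges, excluded by `C`; between an old and a new
    -- edge, excluded by `Free`; and between new edges, excluded by the first hypothesis.
    extend : AllPairs (λ e f → Meet e f → colour e # colour f) T → All (Proper ∘ colour) T → All Free T →
      (∀ {x y} → E x y → E′ x y ⊎ Any (Joins x y) T) → PairColouring 7 E
    extend compat propers free cover = record
      { col    = overlay T col
      ; proper = proper′
      ; flip   = λ {x} {y} e → overlay-flip T col (λ ¬js → flip (old e ¬js))
      ; disj   = disj′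
      }
      where
      old : ∀ {x y} → E x y → All (λ e → ¬ Joins x y e) T → E′ x y
      old e ¬js with cover e
      ... | inj₁ e′ = e′
      ... | inj₂ j∈ with f , f∈ , j ← find j∈ = ⊥-elim (All.lookup ¬js f∈ j)

      proper′ : ∀ {x y} → E x y → Proper (overlay T col x y)
      proper′ {x} {y} e with overlay-result T col x y
      ... | inj₁ (f , f∈ , _ , eq) rewrite eq = All.lookup propers f∈
      ... | inj₂ (¬js , eq)        rewrite eq = proper (old e ¬js)

      free-at : ∀ {x y z f} → f ∈ T → Joins x y f → E′ x z → col x z # colour f
      free-at f∈ (inj₁ (refl , _)) e = proj₁ (All.lookup free f∈) e
      free-at f∈ (inj₂ (refl , _)) e = proj₂ (All.lookup free f∈) e

      disj′ : ∀ {x y z} → E x y → E x z → y ≢ z → overlay T col x y # overlay T col x z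
      disj′ {x} {y} {z} e e′ y≢z with overlay-result T col x y | overlay-result T col x z
      ... | inj₁ (f , f∈ , j , eq) | inj₂ (¬js , eq′) rewrite eq | eq′ =
              #-sym {P = col x z} {Q = colour f} (free-at f∈ j (old e′ ¬js))
      ... | inj₂ (¬js , eq) | inj₁ (f , f∈ , j , eq′) rewrite eq | eq′ = free-at f∈ j (old e ¬js)
      ... | inj₂ (¬js , eq) | inj₂ (¬js′ , eq′)       rewrite eq | eq′ = disj (old e ¬js) (old e′ ¬js′) y≢z
      ... | inj₁ (f , f∈ , j , eq) | inj₁ (f′ , f′∈ , j′ , eq′) rewrite eq | eq′
          with ∈-AllPairs₂ compat f∈ f′∈
      ...   | inj₁ refl      = ⊥-elim (y≢z (joins-unique {e = f} j j′))
      ...   | inj₂ (inj₁ d)  = d (joins-meet {e = f} {f′} j j′)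
      ...   | inj₂ (inj₂ d)  = #-sym {P = colour f′} {Q = colour f} (d (joins-meet {e = f′} {f} j′ j))

-- The crossing configuration and its explicit colourings

Slot : Set
Slot = Fin 7

-- The vertices of a crossing pair of edges ac and bd, in the order a, b, c, d, followed by the
-- interior vertices of the links ab, bc, cd.  A link is an edge or a path of length two; the
-- slots of absent interior vertices are unused.
data Link : Set where
  short long : Link

-- The vertex met first when a link is entered from the end opposite to `s`.
via : ∀ {X : Set} → Link → X → X → X
via short s z = s
via long  s z = z

inner : ∀ {X : Set} → Link → X → List X
inner short z = []
inner long  z = z ∷ []

link-entries : Link → Slot → Slot → Slot → Pair 7 → Pair 7 → List (Entry Slot)
link-entries short s z t P Q = (s , t , P) ∷ []
link-entries long  s z t P Q = (s , z , P) ∷ (z , t , Q) ∷ []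

pattern _·_ i j = i , j
infix 6 _·_

-- The colours of ac and bd, and then of the first and last edges of the links ab, bc, cd, when the
-- other edge at a is coloured first and the other edge at d is coloured second f; found by search.
colours : Link → Link → Link → Form → Vec (Pair 7) 8
colours short short short same  = 0F · 1F ∷ 0F · 1F ∷ 2F · 3F ∷ 2F · 3F ∷ 4F · 5F ∷ 4F · 5F ∷ 2F · 3F ∷ 2F · 3F ∷ []
colours short short short meet  = 0F · 1F ∷ 0F · 1F ∷ 2F · 3F ∷ 2F · 3F ∷ 4F · 5F ∷ 4F · 5F ∷ 2F · 3F ∷ 2F · 3F ∷ []
colours short short short apart = 0F · 1F ∷ 0F · 1F ∷ 2F · 3F ∷ 2F · 3F ∷ 4F · 5F ∷ 4F · 5F ∷ 2F · 6F ∷ 2F · 6F ∷ []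
colours short short long  same  = 0F · 1F ∷ 0F · 1F ∷ 2F · 3F ∷ 2F · 3F ∷ 4F · 5F ∷ 4F · 5F ∷ 2F · 6F ∷ 3F · 4F ∷ []
colours short short long  meet  = 0F · 1F ∷ 0F · 1F ∷ 2F · 3F ∷ 2F · 3F ∷ 4F · 5F ∷ 4F · 5F ∷ 2F · 6F ∷ 3F · 5F ∷ []
colours short short long  apart = 0F · 1F ∷ 0F · 1F ∷ 2F · 3F ∷ 2F · 3F ∷ 4F · 5F ∷ 4F · 5F ∷ 2F · 3F ∷ 5F · 6F ∷ []
colours short long  short same  = 0F · 1F ∷ 0F · 1F ∷ 2F · 3F ∷ 2F · 3F ∷ 4F · 5F ∷ 2F · 6F ∷ 3F · 4F ∷ 3F · 4F ∷ []
colours short long  short meet  = 0F · 1F ∷ 0F · 1F ∷ 2F · 3F ∷ 2F · 3F ∷ 4F · 5F ∷ 2F · 6F ∷ 3F · 5F ∷ 3F · 5F ∷ []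
colours short long  short apart = 0F · 1F ∷ 0F · 1F ∷ 2F · 3F ∷ 2F · 3F ∷ 4F · 5F ∷ 2F · 3F ∷ 5F · 6F ∷ 5F · 6F ∷ []
colours short long  long  same  = 0F · 1F ∷ 0F · 1F ∷ 2F · 3F ∷ 2F · 3F ∷ 4F · 5F ∷ 2F · 3F ∷ 4F · 5F ∷ 2F · 3F ∷ []
colours short long  long  meet  = 0F · 1F ∷ 0F · 1F ∷ 2F · 3F ∷ 2F · 3F ∷ 4F · 5F ∷ 2F · 3F ∷ 4F · 5F ∷ 2F · 3F ∷ []
colours short long  long  apart = 0F · 1F ∷ 0F · 1F ∷ 2F · 3F ∷ 2F · 3F ∷ 4F · 5F ∷ 2F · 3F ∷ 4F · 5F ∷ 2F · 6F ∷ []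
colours long  short short same  = 0F · 1F ∷ 0F · 1F ∷ 2F · 3F ∷ 4F · 5F ∷ 2F · 6F ∷ 2F · 6F ∷ 3F · 4F ∷ 3F · 4F ∷ []
colours long  short short meet  = 0F · 1F ∷ 0F · 1F ∷ 2F · 3F ∷ 4F · 5F ∷ 2F · 6F ∷ 2F · 6F ∷ 3F · 5F ∷ 3F · 5F ∷ []
colours long  short short apart = 0F · 1F ∷ 0F · 1F ∷ 2F · 3F ∷ 4F · 5F ∷ 2F · 3F ∷ 2F · 3F ∷ 5F · 6F ∷ 5F · 6F ∷ []
colours long  short long  same  = 0F · 1F ∷ 0F · 1F ∷ 2F · 3F ∷ 4F · 5F ∷ 2F · 3F ∷ 2F · 3F ∷ 4F · 5F ∷ 2F · 3F ∷ []
colours long  short long  meet  = 0F · 1F ∷ 0F · 1F ∷ 2F · 3F ∷ 4F · 5F ∷ 2F · 3F ∷ 2F · 3F ∷ 4F · 5F ∷ 2F · 3F ∷ []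
colours long  short long  apart = 0F · 1F ∷ 0F · 1F ∷ 2F · 3F ∷ 4F · 5F ∷ 2F · 3F ∷ 2F · 3F ∷ 4F · 5F ∷ 2F · 6F ∷ []
colours long  long  short same  = 0F · 1F ∷ 0F · 1F ∷ 2F · 3F ∷ 4F · 5F ∷ 2F · 3F ∷ 4F · 5F ∷ 2F · 3F ∷ 2F · 3F ∷ []
colours long  long  short meet  = 0F · 1F ∷ 0F · 1F ∷ 2F · 3F ∷ 4F · 5F ∷ 2F · 3F ∷ 4F · 5F ∷ 2F · 3F ∷ 2F · 3F ∷ []
colours long  long  short apart = 0F · 1F ∷ 0F · 1F ∷ 2F · 3F ∷ 4F · 5F ∷ 2F · 3F ∷ 4F · 5F ∷ 2F · 6F ∷ 2F · 6F ∷ []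
colours long  long  long  same  = 0F · 1F ∷ 0F · 1F ∷ 2F · 3F ∷ 4F · 5F ∷ 2F · 3F ∷ 4F · 5F ∷ 2F · 6F ∷ 3F · 4F ∷ []
colours long  long  long  meet  = 0F · 1F ∷ 0F · 1F ∷ 2F · 3F ∷ 4F · 5F ∷ 2F · 3F ∷ 4F · 5F ∷ 2F · 6F ∷ 3F · 5F ∷ []
colours long  long  long  apart = 0F · 1F ∷ 0F · 1F ∷ 2F · 3F ∷ 4F · 5F ∷ 2F · 3F ∷ 4F · 5F ∷ 2F · 3F ∷ 5F · 6F ∷ []

module Ladder (ℓ₁ ℓ₂ ℓ₃ : Link) where

  -- `interior` lists the vertices to be deleted; `a` and `d` stay. `used` follows the circular
  -- order, so that distinctness comes from an increasing chain of indices.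
  interior used : List Slot
  interior = 1F ∷ 2F ∷ inner ℓ₁ 4F ++ inner ℓ₂ 5F ++ inner ℓ₃ 6F
  used     = 0F ∷ inner ℓ₁ 4F ++ 1F ∷ inner ℓ₂ 5F ++ 2F ∷ inner ℓ₃ 6F ++ 3F ∷ []

  neighbours : Slot → List Slot
  neighbours 1F = via ℓ₁ 0F 4F ∷ via ℓ₂ 2F 5F ∷ 3F ∷ []
  neighbours 2F = 0F ∷ via ℓ₂ 1F 5F ∷ via ℓ₃ 3F 6F ∷ []
  neighbours 4F = 0F ∷ 1F ∷ []
  neighbours 5F = 1F ∷ 2F ∷ []
  neighbours 6F = 2F ∷ 3F ∷ []
  neighbours _  = []

  -- Besides `c`, the vertex `a` loses this neighbour on the link `ab`, and `d` is treated likewise.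
  -- With degree at most 3, each keeps at most one outside edge.
  a′ d′ : Slot
  a′ = via ℓ₁ 1F 4F
  d′ = via ℓ₃ 2F 6F

  entries : Form → List (Entry Slot)
  entries f with ac ∷ bd ∷ p ∷ p′ ∷ q ∷ q′ ∷ r ∷ r′ ∷ [] ← colours ℓ₁ ℓ₂ ℓ₃ f =
    (0F , 2F , ac) ∷ (1F , 3F , bd) ∷
    link-entries ℓ₁ 0F 4F 1F p p′ ++ link-entries ℓ₂ 1F 5F 2F q q′ ++ link-entries ℓ₃ 2F 6F 3F r r′

  -- What a new edge owes to the old colouring at one of its ends: nothing at a deleted vertex, and
  -- at `a` or `d` disjointness from the one outside edge.
  End : Form → Slot → Pair 7 → Set
  End f s P = s ∈ interior ⊎ (s ≡ 0F × P ## first) ⊎ (s ≡ 3F × P ## second f)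

  Used : Entry Slot → Set
  Used (s , t , _) = s ∈ used × t ∈ used

  record Valid (f : Form) : Set where
    field
      compatible : AllPairs (λ e e′ → Used e × Used e′ × (Meet e e′ → colour e ## colour e′)) (entries f)
      properness : All (Proper ∘ colour) (entries f)
      ends       : All (λ (s , t , P) → End f s P × End f t P) (entries f)
      complete   : All (λ s → All (λ t → Any (Joins s t) (entries f)) (neighbours s)) interior
      inside     : All (_∈ used) interior
      a′-inside  : a′ ∈ interior × a′ ≢ 2F
      d′-inside  : d′ ∈ interior × d′ ≢ 1F

  open import Data.List.Membership.DecPropositional (Fin._≟_ {7}) using (_∈?_)
  open Overlay (Fin._≟_ {7}) using (joins?)

  valid? : ∀ f → Dec (Valid f)
  valid? f = map′
    (λ (c , p , e , co , i , a , d) → record { compatible = c ; properness = p ; ends = e ; complete = co ; inside = i ; a′-inside = a ; d′-inside = d })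
    (λ V → let open Valid V in compatible , properness , ends , complete , inside , a′-inside , d′-inside)
    (allPairs? (λ e e′ → used? e ×-dec used? e′ ×-dec (meet? e e′ →-dec (colour e ##? colour e′))) (entries f)
      ×-dec All.all? (λ e → ¬? (proj₁ (colour e) Fin.≟ proj₂ (colour e))) (entries f)
      ×-dec All.all? (λ (s , t , P) → end? s P ×-dec end? t P) (entries f)
      ×-dec All.all? (λ s → All.all? (λ t → Any.any? (joins? s t) (entries f)) (neighbours s)) interior
      ×-dec All.all? (_∈? used) interior
      ×-dec ((a′ ∈? interior) ×-dec ¬? (a′ Fin.≟ 2F))
      ×-dec ((d′ ∈? interior) ×-dec ¬? (d′ Fin.≟ 1F)))
    where
    used? : ∀ e → Dec (Used e)
    used? (s , t , _) = (s ∈? used) ×-dec (t ∈? used)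
    meet? : ∀ (e e′ : Entry Slot) → Dec (Meet e e′)
    meet? (s , t , _) (s′ , t′ , _) =
      ((s Fin.≟ s′) ⊎-dec (s Fin.≟ t′)) ⊎-dec ((t Fin.≟ s′) ⊎-dec (t Fin.≟ t′))
    end? : ∀ s P → Dec (End f s P)
    end? s P = (s ∈? interior) ⊎-dec ((s Fin.≟ 0F) ×-dec (P ##? first)) ⊎-dec ((s Fin.≟ 3F) ×-dec (P ##? second f))

all-links? : ∀ {P : Link → Set} → (∀ ℓ → Dec (P ℓ)) → Dec (∀ ℓ → P ℓ)
all-links? P? = map′ (λ { (s , l) short → s ; (s , l) long → l }) (λ f → f short , f long) (P? short ×-dec P? long)

all-forms? : ∀ {P : Form → Set} → (∀ f → Dec (P f)) → Dec (∀ f → P f)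
all-forms? P? = map′ (λ { (s , m , a) same → s ; (s , m , a) meet → m ; (s , m , a) apart → a })
  (λ f → f same , f meet , f apart) (P? same ×-dec P? meet ×-dec P? apart)

abstract
  -- Eight choices of links and three forms give 24 finite checks, settled by evaluation.
  ladder-valid : ∀ ℓ₁ ℓ₂ ℓ₃ f → Ladder.Valid ℓ₁ ℓ₂ ℓ₃ f
  ladder-valid = toWitness {a? = all-links? λ ℓ₁ → all-links? λ ℓ₂ → all-links? λ ℓ₃ → all-forms? λ f → Ladder.valid? ℓ₁ ℓ₂ ℓ₃ f} tt

-- Subgraphs and the restoration of a pendant edge

module Ambient {n : ℕ} (A : Fin n → Fin n → Bool) (simple : IsSimple A)
  (degree≤3 : ∀ {x} {ys : List (Fin n)} → Unique ys → All (Edge A x) ys → length ys ℕ.≤ 3) where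

  open Overlay (Fin._≟_ {n})

  A-sym : ∀ {a b} → Edge A a b → Edge A b a
  A-sym {a} {b} e = trans (proj₁ simple b a) e

  A-irr : ∀ {a b} → Edge A a b → a ≢ b
  A-irr {a} e refl with () ← trans (sym e) (proj₂ simple a)

  record Subgraph : Set₁ where
    field
      E     : Fin n → Fin n → Set
      E?    : ∀ x y → Dec (E x y)
      E-sym : ∀ {x y} → E x y → E y x
      E⇒A   : ∀ {x y} → E x y → Edge A x y

  open Subgraph

  Colouring : Subgraph → Set
  Colouring G = PairColouring 7 (E G)

  open PairColouring

  -- If `x` has no edge, an arbitrary proper pair is returned, so that `frame` can be applied in
  -- every case.
  palette₁ : ∀ (G : Subgraph) (C : Colouring G) x → (∀ {y z} → E G x y → E G x z → y ≡ z) →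
    ∃ λ P → Proper P × (∀ {y} → E G x y → col C x y ≡ P)
  palette₁ G C x unique with Fin.any? (E? G x)
  ... | yes (y , e) = col C x y , proper C e , λ e′ → cong (col C x) (unique e′ e)
  ... | no  none    = (0F , 1F) , (λ ()) , λ e → ⊥-elim (none (_ , e))

  palette₂ : ∀ (G : Subgraph) (C : Colouring G) x →
    (∀ {w y z} → E G x w → E G x y → E G x z → w ≢ y → w ≢ z → y ≢ z → ⊥) →
    ∃ λ F → ∃ λ H → ∀ {y} → E G x y → col C x y ≡ F ⊎ col C x y ≡ H
  palette₂ G C x no-three with Fin.any? (E? G x)
  ... | no none     = (0F , 1F) , (0F , 1F) , λ e → ⊥-elim (none (_ , e))
  ... | yes (y , e) with Fin.any? (λ z → E? G x z ×-dec ¬? (y Fin.≟ z))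
  ...   | no none             = col C x y , col C x y , only
    where
    only : ∀ {z} → E G x z → col C x z ≡ col C x y ⊎ col C x z ≡ col C x y
    only {z} e′ with y Fin.≟ z
    ... | yes refl = inj₁ refl
    ... | no  y≢z  = ⊥-elim (none (z , e′ , y≢z))
  ...   | yes (z , e′ , y≢z) = col C x y , col C x z , both
    where
    both : ∀ {w} → E G x w → col C x w ≡ col C x y ⊎ col C x w ≡ col C x z
    both {w} e″ with y Fin.≟ w | z Fin.≟ w
    ... | yes refl | _        = inj₁ refl
    ... | no  _    | yes refl = inj₂ refl
    ... | no  y≢w  | no  z≢w  = ⊥-elim (no-three e e′ e″ y≢z y≢w z≢w)

  -- `elsewhere` preserves what is known about a first pendant edge while a second one is attached.
  -- `R` is a pair from which `P` has to differ.
  record Pendant (G′ G : Subgraph) (C : Colouring G′) (p : Fin n) (R : Pair 7) : Set where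
    field
      C⁺        : Colouring G
      P         : Pair 7
      P-proper  : Proper P
      P∉R       : ¬ proj₁ P ∈ₚ R
      at-p      : ∀ {y} → E G p y → col C⁺ p y ≡ P
      elsewhere : ∀ {x y} → x ≢ p → y ≢ p → col C⁺ x y ≡ col C x y

  -- The neighbour of `p` has at most two coloured edges, because `p` is a further neighbour of it
  -- and degrees are at most 3. These edges exclude at most four colours, and `pick` does the rest.
  pendant : ∀ {G′ G} (C : Colouring G′) p R → (∀ {y} → ¬ E G′ p y) →
    (∀ {y z} → E G p y → E G p z → y ≡ z) → (∀ {x y} → E G x y → E G′ x y ⊎ (x ≡ p ⊎ y ≡ p)) →
    Pendant G′ G C p R
  pendant {G′} {G} C p R isolated unique cover = attach
    where
    no-three : ∀ {u} → E G p u → ∀ {w y z} → E G′ u w → E G′ u y → E G′ u z → w ≢ y → w ≢ z → y ≢ z → ⊥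
    no-three p-u e₁ e₂ e₃ d₁ d₂ d₃ = ℕ.<-irrefl refl (degree≤3
      ((p≢ e₁ ∷ p≢ e₂ ∷ p≢ e₃ ∷ []) ∷ (d₁ ∷ d₂ ∷ []) ∷ (d₃ ∷ []) ∷ [] ∷ [])
      (A-sym (E⇒A G p-u) ∷ E⇒A G′ e₁ ∷ E⇒A G′ e₂ ∷ E⇒A G′ e₃ ∷ []))
      where
      p≢ : ∀ {u w} → E G′ u w → p ≢ w
      p≢ e refl = isolated (E-sym G′ e)

    attach : Pendant G′ G C p R
    attach with Fin.any? (E? G p)
    ... | no none with P , pr , _ , _ , ∉R ← pick R R R = record
      { C⁺ = extend (E-sym G′) C [] [] [] [] cover′
      ; P = P ; P-proper = pr ; P∉R = ∉R
      ; at-p = λ e → ⊥-elim (none (_ , e)) ; elsewhere = λ _ _ → refl }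
      where
      cover′ : ∀ {x y} → E G x y → E G′ x y ⊎ Any (Joins x y) []
      cover′ e with cover e
      ... | inj₁ e′          = inj₁ e′
      ... | inj₂ (inj₁ refl) = ⊥-elim (none (_ , e))
      ... | inj₂ (inj₂ refl) = ⊥-elim (none (_ , E-sym G e))
    ... | yes (u , p-u)
        with F , H , FH ← palette₂ G′ C u (no-three p-u)
        with P , pr , P#F , P#H , ∉R ← pick F H R = record
      { C⁺ = extend (E-sym G′) C T ([] ∷ []) (pr ∷ []) (((λ e → ⊥-elim (isolated e)) , free (P#F , P#H) FH) ∷ []) cover′
      ; P = P ; P-proper = pr ; P∉R = ∉R ; at-p = at-p ; elsewhere = elsewhere }
      where
      T : List (Entry (Fin n))
      T = (p , u , P) ∷ []
      free : P # F × P # H → (∀ {y} → E G′ u y → col C u y ≡ F ⊎ col C u y ≡ H) → ∀ {w} → E G′ u w → col C u w # P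
      free (P#F , P#H) FH {w} e with FH e
      ... | inj₁ eq rewrite eq = #-sym {P = P} {Q = F} P#F
      ... | inj₂ eq rewrite eq = #-sym {P = P} {Q = H} P#H
      cover′ : ∀ {x y} → E G x y → E G′ x y ⊎ Any (Joins x y) T
      cover′ e with cover e
      ... | inj₁ e′          = inj₁ e′
      ... | inj₂ (inj₁ refl) = inj₂ (here (inj₁ (refl , unique e p-u)))
      ... | inj₂ (inj₂ refl) = inj₂ (here (inj₂ (unique (E-sym G e) p-u , refl)))
      at-p : ∀ {y} → E G p y → overlay T (col C) p y ≡ P
      at-p {y} e with overlay-result T (col C) p y
      ... | inj₁ (_ , here refl , _ , eq) = eq
      ... | inj₂ (¬j ∷ [] , _)            = ⊥-elim (¬j (inj₁ (refl , unique e p-u)))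
      elsewhere : ∀ {x y} → x ≢ p → y ≢ p → overlay T (col C) x y ≡ col C x y
      elsewhere {x} {y} x≢p y≢p with overlay-result T (col C) x y
      ... | inj₁ (_ , here refl , inj₁ (x≡p , _) , _) = ⊥-elim (x≢p x≡p)
      ... | inj₁ (_ , here refl , inj₂ (_ , y≡p) , _) = ⊥-elim (y≢p y≡p)
      ... | inj₂ (_ , eq)                             = eq

  open import Data.List.Membership.DecPropositional (Fin._≟_ {n}) using (_∈?_)

  induced : List (Fin n) → Subgraph
  induced L = record
    { E     = λ x y → x ∈ L × y ∈ L × Edge A x y
    ; E?    = λ x y → (x ∈? L) ×-dec (y ∈? L) ×-dec (A x y Bool.≟ true)
    ; E-sym = λ (x∈ , y∈ , e) → y∈ , x∈ , A-sym e
    ; E⇒A   = λ (_ , _ , e) → e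
    }

  infixl 6 _∖_

  abstract
    _∖_ : List (Fin n) → List (Fin n) → List (Fin n)
    L ∖ D = filter (λ x → ¬? (x ∈? D)) L

    ∖-shorter : ∀ L D {x} → x ∈ L → x ∈ D → length (L ∖ D) < length L
    ∖-shorter L D x∈L x∈D = filter-notAll (λ x → ¬? (x ∈? D)) L (lose x∈L λ x∉D → x∉D x∈D)

    ∖-out : ∀ {L D x y} → E (induced (L ∖ D)) x y → x ∉ D × y ∉ D
    ∖-out {L} {D} (x∈ , y∈ , _) = proj₂ (∈-filter⁻ (λ x → ¬? (x ∈? D)) {xs = L} x∈) , proj₂ (∈-filter⁻ (λ x → ¬? (x ∈? D)) {xs = L} y∈)

    ∖-sub : ∀ {L D x y} → E (induced (L ∖ D)) x y → E (induced L) x y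
    ∖-sub {L} {D} (x∈ , y∈ , e) = proj₁ (∈-filter⁻ (λ x → ¬? (x ∈? D)) {xs = L} x∈) , proj₁ (∈-filter⁻ (λ x → ¬? (x ∈? D)) {xs = L} y∈) , e

    ∖-in : ∀ {L D x y} → E (induced L) x y → x ∉ D → y ∉ D → E (induced (L ∖ D)) x y
    ∖-in {L} {D} (x∈ , y∈ , e) x∉ y∉ = ∈-filter⁺ (λ x → ¬? (x ∈? D)) x∈ x∉ , ∈-filter⁺ (λ x → ¬? (x ∈? D)) y∈ y∉ , e

    ∖-AllPairs : ∀ {R : Fin n → Fin n → Set} {L} D → AllPairs R L → AllPairs R (L ∖ D)
    ∖-AllPairs D = AllPairs.filter⁺ (λ x → ¬? (x ∈? D))

  delete-edge : Subgraph → Fin n → Fin n → Subgraph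
  delete-edge G p q = record
    -- `Joins` reads only the ends of an entry; the pair `first` is a placeholder.
    { E     = λ x y → E G x y × ¬ Joins x y (p , q , first)
    ; E?    = λ x y → E? G x y ×-dec ¬? (joins? x y (p , q , first))
    ; E-sym = λ (e , ¬j) → E-sym G e , (λ j → ¬j (Joins-swap {e = p , q , first} j))
    ; E⇒A   = λ (e , _) → E⇒A G e
    }

-- Reducible configurations

Within : ∀ {V : Set} → (V → V → Set) → V → List V → Set
Within E v xs = ∀ {y} → E v y → y ∈ xs

-- The vertex type is arbitrary because configurations are found among indices on the circle and
-- then transferred to vertices. `Within` only bounds a neighbourhood, so a listed neighbour may be
-- absent.
data Reducible {V : Set} (Alive : V → Set) (E : V → V → Set) : Set where
  leaf     : ∀ v u → Alive v → Within E v (u ∷ []) → Reducible Alive E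
  adjacent : ∀ p q i j → E p q → Within E p (i ∷ q ∷ []) → Within E q (j ∷ p ∷ []) → Reducible Alive E
  ear      : ∀ z p q → E z p → E z q → E p q → Within E z (p ∷ q ∷ []) → Reducible Alive E
  ladder   : ∀ ℓ₁ ℓ₂ ℓ₃ (φ : Slot → V) → let open Ladder ℓ₁ ℓ₂ ℓ₃ in
             All (Alive ∘ φ) used → AllPairs (λ s t → φ s ≢ φ t) used →
             E (φ 0F) (φ 2F) → E (φ 3F) (φ 1F) → E (φ 0F) (φ a′) → E (φ 3F) (φ d′) →
             All (λ s → Within E (φ s) (map φ (neighbours s))) interior → Reducible Alive E

-- Extending a colouring over each configuration

module Reduce {n : ℕ} (A : Fin n → Fin n → Bool) (simple : IsSimple A)
  (degree≤3 : ∀ {x} {ys : List (Fin n)} → Unique ys → All (Edge A x) ys → length ys ℕ.≤ 3) where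

  open Overlay (Fin._≟_ {n})
  open Ambient A simple degree≤3
  open Subgraph
  open PairColouring
  open import Data.List.Membership.DecPropositional (Fin._≟_ {n}) using (_∈?_)

  ∖-cover : ∀ {L} D {x y} → E (induced L) x y → E (induced (L ∖ D)) x y ⊎ (x ∈ D ⊎ y ∈ D)
  ∖-cover D {x} {y} e with x ∈? D | y ∈? D
  ... | yes x∈ | _      = inj₂ (inj₁ x∈)
  ... | no  _  | yes y∈ = inj₂ (inj₂ y∈)
  ... | no  x∉ | no  y∉ = inj₁ (∖-in e x∉ y∉)

  ∖-cover₁ : ∀ {L} p D {x y} → E (induced (L ∖ D)) x y → E (induced (L ∖ (p ∷ D))) x y ⊎ (x ≡ p ⊎ y ≡ p)
  ∖-cover₁ p D {x} {y} e with x Fin.≟ p | y Fin.≟ p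
  ... | yes x≡ | _      = inj₂ (inj₁ x≡)
  ... | no  _  | yes y≡ = inj₂ (inj₂ y≡)
  ... | no  x≢ | no  y≢ = inj₁ (∖-in (∖-sub e) (λ { (here x≡) → x≢ x≡ ; (there x∈) → proj₁ (∖-out e) x∈ })
                                                (λ { (here y≡) → y≢ y≡ ; (there y∈) → proj₂ (∖-out e) y∈ }))

  reduce-leaf : ∀ L v u → Within (E (induced L)) v (u ∷ []) → Colouring (induced (L ∖ (v ∷ []))) → Colouring (induced L)
  reduce-leaf L v u within C = Pendant.C⁺ (pendant {induced (L ∖ (v ∷ []))} {induced L} C v first (λ e → proj₁ (∖-out e) (here refl))
    (λ e e′ → both (within e) (within e′))
    (λ e → Sum.map₂ (Sum.map (λ { (here eq) → eq }) (λ { (here eq) → eq })) (∖-cover (v ∷ []) e)))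
    where
    both : ∀ {y z} → y ∈ u ∷ [] → z ∈ u ∷ [] → y ≡ z
    both (here refl) (here refl) = refl

  -- Without the edge between them, `p` and `q` have at most one edge each, and can be restored in
  -- turn as pendant vertices. The pair at `p` serves as `R` for `q`, so the two pairs differ as
  -- sets.
  attach-two : ∀ {L D p q} → p ≢ q → p ∉ D → q ∉ D →
    (∀ {y z} → E (induced (L ∖ D)) p y → E (induced (L ∖ D)) p z → y ≢ q → z ≢ q → y ≡ z) →
    (∀ {y z} → E (induced (L ∖ D)) q y → E (induced (L ∖ D)) q z → y ≢ p → z ≢ p → y ≡ z) →
    Colouring (induced (L ∖ (p ∷ q ∷ D))) → let G = delete-edge (induced (L ∖ D)) p q in
    Σ (Colouring G) λ C → ∃ λ P → ∃ λ Q → Proper P × Proper Q × ¬ proj₁ Q ∈ₚ P ×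
      (∀ {y} → E G p y → col C p y ≡ P) × (∀ {y} → E G q y → col C q y ≡ Q)
  attach-two {L} {D} {p} {q} p≢q p∉D q∉D p-unique q-unique C =
    Q.C⁺ , P.P , Q.P , P.P-proper , Q.P-proper , Q.P∉R , at-p , Q.at-p
    where
    G : Subgraph
    G = delete-edge (induced (L ∖ D)) p q

    first-pendant : Pendant (induced (L ∖ (p ∷ q ∷ D))) (induced (L ∖ (q ∷ D))) C p first
    first-pendant = pendant C p first (λ e → proj₁ (∖-out e) (here refl))
      (λ e e′ → p-unique (restore e) (restore e′) (λ eq → proj₂ (∖-out e) (here eq)) (λ eq → proj₂ (∖-out e′) (here eq)))
      (∖-cover₁ p (q ∷ D))
      where
      restore : ∀ {x y} → E (induced (L ∖ (q ∷ D))) x y → E (induced (L ∖ D)) x y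
      restore e = ∖-in (∖-sub e) (proj₁ (∖-out e) ∘ there) (proj₂ (∖-out e) ∘ there)

    module P = Pendant first-pendant

    second-pendant : Pendant (induced (L ∖ (q ∷ D))) G P.C⁺ q P.P
    second-pendant = pendant {G = G} P.C⁺ q P.P (λ e → proj₁ (∖-out e) (here refl))
      (λ (e , ¬j) (e′ , ¬j′) → q-unique e e′ (λ eq → ¬j (inj₂ (refl , eq))) (λ eq → ¬j′ (inj₂ (refl , eq))))
      (λ (e , _) → ∖-cover₁ q D e)

    module Q = Pendant second-pendant

    at-p : ∀ {y} → E G p y → col Q.C⁺ p y ≡ P.P
    at-p {y} (e , ¬j) = trans (Q.elsewhere p≢q y≢q) (P.at-p (∖-in (∖-sub e) p∉ y∉))
      where
      y≢q : y ≢ q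
      y≢q eq = ¬j (inj₁ (refl , eq))
      p∉ : p ∉ q ∷ D
      p∉ (here eq) = p≢q eq
      p∉ (there p∈) = p∉D p∈
      y∉ : y ∉ q ∷ D
      y∉ (here eq) = y≢q eq
      y∉ (there y∈) = proj₂ (∖-out e) y∈

  coloured : ∀ {P Q R : Pair 7} → R ≡ P → Q # P → R # Q
  coloured {P} {Q} refl d = #-sym {P = Q} {Q = P} d

  other : ∀ {a b y z : Fin n} → y ∈ a ∷ b ∷ [] → z ∈ a ∷ b ∷ [] → y ≢ b → z ≢ b → y ≡ z
  other (here refl)         (here refl)         _   _   = refl
  other (there (here refl)) _                   y≢b _   = ⊥-elim (y≢b refl)
  other _                   (there (here refl)) _   z≢b = ⊥-elim (z≢b refl)

  -- Once both pendant edges are coloured, the edge `p q` meets only these two, so `pick` finds a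
  -- pair for it.
  reduce-adjacent : ∀ L p q i j → E (induced L) p q → Within (E (induced L)) p (i ∷ q ∷ []) →
    Within (E (induced L)) q (j ∷ p ∷ []) → Colouring (induced (L ∖ (p ∷ q ∷ []))) → Colouring (induced L)
  reduce-adjacent L p q i j p-q Np Nq C
    with C′ , P , Q , _ , _ , _ , at-p , at-q ← attach-two {L} {[]} (A-irr (E⇒A (induced L) p-q)) (λ ()) (λ ())
      (λ e e′ y≢ z≢ → other (Np (∖-sub e)) (Np (∖-sub e′)) y≢ z≢)
      (λ e e′ y≢ z≢ → other (Nq (∖-sub e)) (Nq (∖-sub e′)) y≢ z≢) C
    with Z , pr , Z#P , Z#Q , _ ← pick P Q first
    = extend (E-sym (delete-edge (induced (L ∖ [])) p q)) C′ ((p , q , Z) ∷ []) ([] ∷ []) (pr ∷ [])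
        (((λ e → coloured (at-p e) Z#P) , (λ e → coloured (at-q e) Z#Q)) ∷ []) cover
    where
    cover : ∀ {Z x y} → E (induced L) x y → E (delete-edge (induced (L ∖ [])) p q) x y ⊎ Any (Joins x y) ((p , q , Z) ∷ [])
    cover {x = x} {y} e with joins? x y (p , q , first)
    ... | yes j = inj₂ (here j)
    ... | no ¬j = inj₁ (∖-in e (λ ()) (λ ()) , ¬j)

  three-others : ∀ {x z q y y′} → Edge A x z → Edge A x q → Edge A x y → Edge A x y′ →
    z ≢ q → z ≢ y → z ≢ y′ → q ≢ y → q ≢ y′ → y ≡ y′
  three-others {y = y} {y′} e₁ e₂ e₃ e₄ d₁ d₂ d₃ d₄ d₅ with y Fin.≟ y′
  ... | yes eq = eq
  ... | no  ne = ⊥-elim (ℕ.<-irrefl refl (degree≤3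
          ((d₁ ∷ d₂ ∷ d₃ ∷ []) ∷ (d₄ ∷ d₅ ∷ []) ∷ (ne ∷ []) ∷ [] ∷ []) (e₁ ∷ e₂ ∷ e₃ ∷ e₄ ∷ [])))

  reduce-ear : ∀ L z p q → E (induced L) z p → E (induced L) z q → E (induced L) p q →
    Within (E (induced L)) z (p ∷ q ∷ []) → Colouring (induced (L ∖ (p ∷ q ∷ z ∷ []))) → Colouring (induced L)
  reduce-ear L z p q z-p z-q p-q Nz C = go
    where
    zp = E⇒A (induced L) z-p
    zq = E⇒A (induced L) z-q
    pq = E⇒A (induced L) p-q
    G : Subgraph
    G = delete-edge (induced (L ∖ (z ∷ []))) p q
    outside : ∀ {x y} → E (induced (L ∖ (z ∷ []))) x y → z ≢ y
    outside e eq = proj₂ (∖-out e) (here (sym eq))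
    absent : ∀ {y} → ¬ E G z y
    absent (e , _) = proj₁ (∖-out e) (here refl)
    cover : ∀ {P Q R x y} → E (induced L) x y → E G x y ⊎ Any (Joins x y) ((z , p , P) ∷ (z , q , Q) ∷ (p , q , R) ∷ [])
    cover {x = x} {y} e with x Fin.≟ z | y Fin.≟ z
    ... | yes refl | _ with Nz e
    ...   | here refl         = inj₂ (here (inj₁ (refl , refl)))
    ...   | there (here refl) = inj₂ (there (here (inj₁ (refl , refl))))
    cover {x = x} {y} e | no _ | yes refl with Nz (E-sym (induced L) e)
    ...   | here refl         = inj₂ (here (inj₂ (refl , refl)))
    ...   | there (here refl) = inj₂ (there (here (inj₂ (refl , refl))))
    cover {x = x} {y} e | no x≢z | no y≢z with joins? x y (p , q , first)
    ... | yes j = inj₂ (there (there (here j)))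
    ... | no ¬j = inj₁ (∖-in e (λ { (here eq) → x≢z eq }) (λ { (here eq) → y≢z eq }) , ¬j)
    go : Colouring (induced L)
    go
      with C′ , P , Q , p-pr , q-pr , Q∉P , at-p , at-q ← attach-two {L} {z ∷ []} (A-irr pq)
        (λ { (here refl) → A-irr zp refl }) (λ { (here refl) → A-irr zq refl })
        (λ e e′ y≢ z≢ → three-others (A-sym zp) pq (E⇒A (induced (L ∖ (z ∷ []))) e) (E⇒A (induced (L ∖ (z ∷ []))) e′)
          (A-irr zq) (outside e) (outside e′) (y≢ ∘ sym) (z≢ ∘ sym))
        (λ e e′ y≢ z≢ → three-others (A-sym zq) (A-sym pq) (E⇒A (induced (L ∖ (z ∷ []))) e) (E⇒A (induced (L ∖ (z ∷ []))) e′)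
          (A-irr zp) (outside e) (outside e′) (y≢ ∘ sym) (z≢ ∘ sym)) C
      -- The roles of `p` and `q` are exchanged, because it is the pair at `q` whose first colour
      -- avoids the other pair.
      with zq′ , zp′ , pq′ , zq-pr , zp-pr , pq-pr , zq#Q , pq#Q , zp#P , pq#P , zq#zp , zq#pq , zp#pq ← triangle Q P q-pr p-pr Q∉P
      = extend (E-sym G) C′ ((z , p , zp′) ∷ (z , q , zq′) ∷ (p , q , pq′) ∷ [])
          (((λ _ → #-sym {P = zq′} {Q = zp′} zq#zp) ∷ (λ _ → zp#pq) ∷ []) ∷ ((λ _ → zq#pq) ∷ []) ∷ [] ∷ [])
          (zp-pr ∷ zq-pr ∷ pq-pr ∷ [])
          ( ((λ e → ⊥-elim (absent e)) , (λ e → coloured (at-p e) zp#P))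
          ∷ ((λ e → ⊥-elim (absent e)) , (λ e → coloured (at-q e) zq#Q))
          ∷ ((λ e → coloured (at-p e) pq#P) , (λ e → coloured (at-q e) pq#Q)) ∷ [])
          cover

  -- After the deletion `a` and `d` have at most one edge each, with pairs `S` and `T`. A frame for
  -- `S` and `T` renames the colours of the matching line of the table.
  reduce-ladder : ∀ L ℓ₁ ℓ₂ ℓ₃ (φ : Slot → Fin n) → let open Ladder ℓ₁ ℓ₂ ℓ₃ in
    AllPairs (λ s t → φ s ≢ φ t) used →
    E (induced L) (φ 0F) (φ 2F) → E (induced L) (φ 3F) (φ 1F) → E (induced L) (φ 0F) (φ a′) → E (induced L) (φ 3F) (φ d′) →
    All (λ s → Within (E (induced L)) (φ s) (map φ (neighbours s))) interior →
    Colouring (induced (L ∖ map φ interior)) → Colouring (induced L)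
  reduce-ladder L ℓ₁ ℓ₂ ℓ₃ φ distinct a-c d-b a-a′ d-d′ within C = go
    where
    open Ladder ℓ₁ ℓ₂ ℓ₃
    module V {f} = Valid (ladder-valid ℓ₁ ℓ₂ ℓ₃ f)
    D = map φ interior
    G′ = induced (L ∖ D)

    φ-injective : ∀ {s t} → s ∈ used → t ∈ used → φ s ≡ φ t → s ≡ t
    φ-injective s∈ t∈ eq with ∈-AllPairs₂ distinct s∈ t∈
    ... | inj₁ s≡t       = s≡t
    ... | inj₂ (inj₁ ne) = ⊥-elim (ne eq)
    ... | inj₂ (inj₂ ne) = ⊥-elim (ne (sym eq))

    out : ∀ {s y x} → s ∈ interior → E G′ x y → φ s ≢ y
    out s∈ e refl = proj₂ (∖-out e) (∈-map⁺ φ s∈)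

    outer : ∀ {x s t} → E (induced L) x (φ s) → E (induced L) x (φ t) → s ∈ interior → t ∈ interior → s ≢ t →
      ∀ {y y′} → E G′ x y → E G′ x y′ → y ≡ y′
    outer e e′ s∈ t∈ s≢t f f′ = three-others (E⇒A (induced L) e) (E⇒A (induced L) e′) (E⇒A G′ f) (E⇒A G′ f′)
      (s≢t ∘ φ-injective (All.lookup (V.inside {same}) s∈) (All.lookup (V.inside {same}) t∈))
      (out s∈ f) (out s∈ f′) (out t∈ f) (out t∈ f′)

    module _ {S T} (F : Frame S T) (at-a : ∀ {y} → E G′ (φ 0F) y → col C (φ 0F) y ≡ S)
             (at-d : ∀ {y} → E G′ (φ 3F) y → col C (φ 3F) y ≡ T) where
      open Frame F

      place : Entry Slot → Entry (Fin n)
      place (s , t , P) = φ s , φ t , recolour c P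

      placed : List (Entry (Fin n))
      placed = map place (entries form)

      place-meet : ∀ {e e′} → Used e → Used e′ → Meet (place e) (place e′) → Meet e e′
      place-meet (s∈ , t∈) (s′∈ , t′∈) = Sum.map
        (Sum.map (φ-injective s∈ s′∈) (φ-injective s∈ t′∈)) (Sum.map (φ-injective t∈ s′∈) (φ-injective t∈ t′∈))

      Compatible : Entry (Fin n) → Entry (Fin n) → Set
      Compatible e e′ = Meet e e′ → colour e # colour e′

      compatible-places : ∀ {e e′} → Used e × Used e′ × (Meet e e′ → colour e ## colour e′) →
        Compatible (place e) (place e′)
      compatible-places {e} {e′} (u , u′ , d) m = ##⇒# inj {colour e} {colour e′} (d (place-meet {e} {e′} u u′ m))

      compat : AllPairs Compatible placed
      compat = AllPairs.map⁺ (AllPairs.map (λ {e} {e′} → compatible-places {e} {e′}) V.compatible)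

      free-end : ∀ s P → End form s P → ∀ {w} → E G′ (φ s) w → col C (φ s) w # recolour c P
      free-end s P (inj₁ s∈) e = ⊥-elim (proj₁ (∖-out e) (∈-map⁺ φ s∈))
      free-end s P (inj₂ (inj₁ (refl , d))) e x∈ x∈′ =
        ##⇒# inj {P} {first} d x∈′ (S⊆ (subst (_ ∈ₚ_) (at-a e) x∈))
      free-end s P (inj₂ (inj₂ (refl , d))) e x∈ x∈′ =
        ##⇒# inj {P} {second form} d x∈′ (T⊆ (subst (_ ∈ₚ_) (at-d e) x∈))

      place-joins : ∀ {s t} → Any (Joins s t) (entries form) → Any (Joins (φ s) (φ t)) placed
      place-joins = Any.map⁺ ∘ Any.map (λ { (inj₁ (refl , refl)) → inj₁ (refl , refl) ; (inj₂ (refl , refl)) → inj₂ (refl , refl) })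

      from-interior : ∀ {s y} → s ∈ interior → E (induced L) (φ s) y → Any (Joins (φ s) y) placed
      from-interior s∈ e with t , t∈ , refl ← ∈-map⁻ φ (All.lookup within s∈ e) =
        place-joins (All.lookup (All.lookup V.complete s∈) t∈)

      cover : ∀ {x y} → E (induced L) x y → E G′ x y ⊎ Any (Joins x y) placed
      cover e with ∖-cover D e
      ... | inj₁ e′ = inj₁ e′
      ... | inj₂ (inj₁ x∈) with s , s∈ , refl ← ∈-map⁻ φ x∈ = inj₂ (from-interior s∈ e)
      ... | inj₂ (inj₂ y∈) with s , s∈ , refl ← ∈-map⁻ φ y∈ =
              inj₂ (Any.map (λ {e} → Joins-swap {e = e}) (from-interior s∈ (E-sym (induced L) e)))

      fill : Colouring (induced L)
      fill = extend (E-sym G′) C placed compat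
        (All.map⁺ (All.map (λ p eq → p (inj eq)) V.properness))
        (All.map⁺ (All.map (λ {e} (p , q) → free-end (proj₁ e) (colour e) p , free-end (proj₁ (proj₂ e)) (colour e) q) V.ends))
        cover

    go : Colouring (induced L)
    go
      with S , S-pr , at-a ← palette₁ G′ C (φ 0F)
        (outer a-c a-a′ (there (here refl)) (proj₁ (V.a′-inside {same})) (proj₂ (V.a′-inside {same}) ∘ sym))
      with T , T-pr , at-d ← palette₁ G′ C (φ 3F)
        (outer d-b d-d′ (here refl) (proj₁ (V.d′-inside {same})) (proj₂ (V.d′-inside {same}) ∘ sym))
      = fill (frame S T S-pr T-pr) at-a at-d

  -- The induction hypothesis records that `L′` arises from `L` by deletion, which lets its user
  -- conclude that `L′` is still sorted.
  reduce : ∀ L → Reducible (_∈ L) (E (induced L)) → (∀ L′ D → L′ ≡ L ∖ D → length L′ < length L → Colouring (induced L′)) → Colouring (induced L)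
  reduce L (leaf v u v∈ within) ih = reduce-leaf L v u within (ih _ _ refl (∖-shorter L _ v∈ (here refl)))
  reduce L (adjacent p q i j p-q Np Nq) ih = reduce-adjacent L p q i j p-q Np Nq (ih _ _ refl (∖-shorter L _ (proj₁ p-q) (here refl)))
  reduce L (ear z p q z-p z-q p-q Nz) ih = reduce-ear L z p q z-p z-q p-q Nz (ih _ _ refl (∖-shorter L _ (proj₁ p-q) (here refl)))
  reduce L (ladder ℓ₁ ℓ₂ ℓ₃ φ _ d a-c d-b a-a′ d-d′ within) ih = reduce-ladder L ℓ₁ ℓ₂ ℓ₃ φ d a-c d-b a-a′ d-d′ within
    (ih _ _ refl (∖-shorter L _ (proj₁ (proj₂ d-b)) (here refl)))

-- Closed intervals of the circular order

module Structure (N : ℕ) (E : ℕ → ℕ → Set) (E? : ∀ i j → Dec (E i j)) (E-sym : ∀ {i j} → E i j → E j i)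
  (E-irr : ∀ {i} → ¬ E i i) (E<N : ∀ {i j} → E i j → j < N)
  (degree≤3 : ∀ {i} {js : List ℕ} → Unique js → All (E i) js → length js ≤ 3)
  (crossed-once : ∀ {i k j l j′ l′} → E i k → i < j → j < k → l < i ⊎ k < l → E j l →
                  i < j′ → j′ < k → l′ < i ⊎ k < l′ → E j′ l′ → j ≡ j′ × l ≡ l′) where

  Found : Set
  Found = Reducible (_< N) E

  -- The ends may have neighbours outside. Accordingly, a configuration found in a closed interval
  -- constrains the neighbourhoods of inner vertices only.
  Closed : ℕ → ℕ → Set
  Closed i j = ∀ {m x} → i < m → m < j → E m x → i ≤ x × x ≤ j

  without₁ : ∀ {x a as} → Within E x (a ∷ as) → ¬ E x a → Within E x as
  without₁ W ne e with W e
  ... | here refl = ⊥-elim (ne e)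
  ... | there y∈  = y∈

  without₂ : ∀ {x a b as} → Within E x (a ∷ b ∷ as) → ¬ E x b → Within E x (a ∷ as)
  without₂ W ne e with W e
  ... | here eq           = here eq
  ... | there (here refl) = ⊥-elim (ne e)
  ... | there (there y∈)  = there y∈

  without₃ : ∀ {x a b c as} → Within E x (a ∷ b ∷ c ∷ as) → ¬ E x c → Within E x (a ∷ b ∷ as)
  without₃ W ne e with W e
  ... | here eq                   = here eq
  ... | there (here eq)           = there (here eq)
  ... | there (there (here refl)) = ⊥-elim (ne e)
  ... | there (there (there y∈))  = there (there y∈)

  swap₁₂ : ∀ {x a b as} → Within E x (a ∷ b ∷ as) → Within E x (b ∷ a ∷ as)
  swap₁₂ W e with W e
  ... | here eq         = there (here eq)
  ... | there (here eq) = here eq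
  ... | there (there y∈) = there (there y∈)

  weaken₂ : ∀ {x a b c} → Within E x (a ∷ b ∷ []) → Within E x (a ∷ c ∷ b ∷ [])
  weaken₂ W e with W e
  ... | here eq         = here eq
  ... | there (here eq) = there (there (here eq))

  E≢ : ∀ {i j} → E i j → i ≢ j
  E≢ e refl = E-irr e

  -- Twins form a ladder all of whose links are edges; the middle one need not be present.
  twins : ∀ {i p q j} → i ≢ j → p ≢ q → E i p → E i q → E j p → E j q →
    Within E p (i ∷ q ∷ j ∷ []) → Within E q (i ∷ p ∷ j ∷ []) → Found
  twins {i} {p} {q} {j} i≢j p≢q ip iq jp jq Wp Wq = ladder short short short φ
    (E<N (E-sym ip) ∷ E<N ip ∷ E<N iq ∷ E<N (E-sym jp) ∷ [])
    ((E≢ ip ∷ E≢ iq ∷ i≢j ∷ []) ∷ (p≢q ∷ (E≢ jp ∘ sym) ∷ []) ∷ ((E≢ jq ∘ sym) ∷ []) ∷ [] ∷ [])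
    iq jp ip jq (Wp ∷ Wq ∷ [])
    where
    φ : Slot → ℕ
    φ 0F = i
    φ 1F = p
    φ 2F = q
    φ _  = j

  split : ∀ {i x} → i ≤ x → x ≡ i ⊎ suc i ≤ x
  split i≤x with ℕ.m≤n⇒m<n∨m≡n i≤x
  ... | inj₁ i<x = inj₂ i<x
  ... | inj₂ eq  = inj₁ (sym eq)

  -- The five possible edges at `p` and `q` decide: a vertex with at most one edge is a leaf, two
  -- adjacent vertices of degree 2 or a triangle at a vertex of degree 2 are reducible, and
  -- otherwise `p` and `q` are twins over `i` and `j`.
  two-inside : ∀ i → 3 ℕ.+ i < N → Closed i (3 ℕ.+ i) → Found
  two-inside i j<N closed = go
    where
    p q j : ℕ
    p = 1 ℕ.+ i
    q = 2 ℕ.+ i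
    j = 3 ℕ.+ i
    q<N : q < N
    q<N = ℕ.<-trans ℕ.≤-refl j<N
    p<N : p < N
    p<N = ℕ.<-trans ℕ.≤-refl q<N
    Wp : Within E p (i ∷ q ∷ j ∷ [])
    Wp e with i≤x , x≤j ← closed ℕ.≤-refl (s≤s (s≤s (ℕ.n≤1+n i))) e with split i≤x
    ... | inj₁ eq = here eq
    ... | inj₂ p≤x with split p≤x
    ...   | inj₁ refl = ⊥-elim (E-irr e)
    ...   | inj₂ q≤x with split q≤x
    ...     | inj₁ eq = there (here eq)
    ...     | inj₂ j≤x = there (there (here (ℕ.≤-antisym x≤j j≤x)))
    Wq : Within E q (i ∷ p ∷ j ∷ [])
    Wq e with i≤x , x≤j ← closed (s≤s (ℕ.n≤1+n i)) ℕ.≤-refl e with split i≤x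
    ... | inj₁ eq = here eq
    ... | inj₂ p≤x with split p≤x
    ...   | inj₁ eq = there (here eq)
    ...   | inj₂ q≤x with split q≤x
    ...     | inj₁ refl = ⊥-elim (E-irr e)
    ...     | inj₂ j≤x = there (there (here (ℕ.≤-antisym x≤j j≤x)))
    go : Found
    go with E? p q
    go | no ¬pq with E? p i | E? p j | E? q i | E? q j
    ... | no ¬pi | _      | _      | _      = leaf p j p<N (without₁ (without₂ Wp ¬pq) ¬pi)
    ... | _      | no ¬pj | _      | _      = leaf p i p<N (without₂ (without₂ Wp ¬pq) ¬pj)
    ... | _      | _      | no ¬qi | _      = leaf q j q<N (without₁ (without₂ Wq (¬pq ∘ E-sym)) ¬qi)
    ... | _      | _      | _      | no ¬qj = leaf q i q<N (without₂ (without₂ Wq (¬pq ∘ E-sym)) ¬qj)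
    ... | yes pi | yes pj | yes qi | yes qj =
      twins (λ ()) (λ ()) (E-sym pi) (E-sym qi) (E-sym pj) (E-sym qj) Wp Wq
    go | yes pq with E? p i | E? p j | E? q i | E? q j
    ... | no ¬pi | no ¬pj | _      | _      = leaf p q p<N (without₂ (without₁ Wp ¬pi) ¬pj)
    ... | _      | _      | no ¬qi | no ¬qj = leaf q p q<N (without₂ (without₁ Wq ¬qi) ¬qj)
    ... | yes pi | yes pj | yes qi | yes qj =
      twins (λ ()) (λ ()) (E-sym pi) (E-sym qi) (E-sym pj) (E-sym qj) Wp Wq
    ... | no ¬pi | yes pj | _      | yes qj = ear p q j pq pj qj (without₁ Wp ¬pi)
    ... | no ¬pi | yes pj | yes qi | no ¬qj = adjacent p q j i pq (swap₁₂ (without₁ Wp ¬pi)) (without₃ Wq ¬qj)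
    ... | yes pi | no ¬pj | yes qi | _      = ear p i q pi pq (E-sym qi) (without₃ Wp ¬pj)
    ... | yes pi | no ¬pj | no ¬qi | yes qj = adjacent p q i j pq (without₃ Wp ¬pj) (swap₁₂ (without₁ Wq ¬qi))
    ... | yes pi | yes pj | no ¬qi | yes qj = ear q p j (E-sym pq) qj pj (without₁ Wq ¬qi)
    ... | yes pi | yes pj | yes qi | no ¬qj = ear q i p qi (E-sym pq) (E-sym pi) (without₃ Wq ¬qj)

  -- By `after` and `before`, the link carries the only edge of `u` and of `v` into the interval.
  -- `order` inserts its inner vertex into an increasing chain.
  record LinkAt (u v : ℕ) (ℓ : Link) : Set where
    field
      z      : ℕ
      below  : E u (via ℓ v z)
      above  : E v (via ℓ u z)
      after  : ∀ {x} → u < x → x ≤ v → E u x → x ≡ via ℓ v z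
      before : ∀ {x} → u ≤ x → x < v → E v x → x ≡ via ℓ u z
      order  : ∀ {r} → Linked _<_ (v ∷ r) → Linked _<_ (u ∷ inner ℓ z ++ v ∷ r)
      within : All (λ z → Within E z (u ∷ v ∷ [])) (inner ℓ z)
      alive  : All (_< N) (inner ℓ z)

  data Joined (u v : ℕ) : Set where
    unlinked : (∀ {x} → u ≤ x → x ≤ v → E u x → ⊥) → (∀ {x} → u ≤ x → x ≤ v → E v x → ⊥) → Joined u v
    linked   : ∀ ℓ → LinkAt u v ℓ → Joined u v

  -- In a gap of length 2, the middle vertex is a leaf unless it is joined to both ends; then an
  -- edge `u v` would complete an ear, and its absence leaves a long link. A gap of length 1 is a
  -- short link or unlinked.
  joined : ∀ {u v} → u < v → v ≤ 2 ℕ.+ u → v < N → Closed u v → Joined u v ⊎ Found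
  joined {u} {v} u<v v≤2+u v<N closed with split u<v
  joined {u} {v} u<v v≤2+u v<N closed | inj₁ refl with E? u v
  ... | yes e = inj₁ (linked short record
    -- A short link has no inner vertex; `u` is a placeholder.
    { z = u ; below = e ; above = E-sym e
    ; after  = λ u<x x≤v _ → ℕ.≤-antisym x≤v u<x
    ; before = λ u≤x x<v _ → ℕ.≤-antisym (ℕ.≤-pred x<v) u≤x
    ; order  = ℕ.≤-refl ∷_ ; within = [] ; alive = [] })
  ... | no ¬e = inj₁ (unlinked at-u at-v)
    where
    at-u : ∀ {x} → u ≤ x → x ≤ v → E u x → ⊥
    at-u u≤x x≤v e with split u≤x
    ... | inj₁ refl = E-irr e
    ... | inj₂ u<x with refl ← ℕ.≤-antisym x≤v u<x = ¬e e
    at-v : ∀ {x} → u ≤ x → x ≤ v → E v x → ⊥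
    at-v u≤x x≤v e with split u≤x
    ... | inj₁ refl = ¬e (E-sym e)
    ... | inj₂ u<x with refl ← ℕ.≤-antisym x≤v u<x = E-irr e
  joined {u} {v} u<v v≤2+u v<N closed | inj₂ 2+u≤v with ℕ.≤-antisym v≤2+u 2+u≤v
  ... | refl = go
    where
    m : ℕ
    m = suc u
    Wm : Within E m (u ∷ v ∷ [])
    Wm e with u≤x , x≤v ← closed ℕ.≤-refl ℕ.≤-refl e with split u≤x
    ... | inj₁ eq = here eq
    ... | inj₂ m≤x with split m≤x
    ...   | inj₁ refl = ⊥-elim (E-irr e)
    ...   | inj₂ v≤x = there (here (ℕ.≤-antisym x≤v v≤x))
    m<N : m < N
    m<N = ℕ.<-trans ℕ.≤-refl v<N
    go : Joined u v ⊎ Found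
    go with E? m u | E? m v | E? u v
    ... | no ¬mu | _      | _      = inj₂ (leaf m v m<N (without₁ Wm ¬mu))
    ... | yes _  | no ¬mv | _      = inj₂ (leaf m u m<N (without₂ Wm ¬mv))
    ... | yes mu | yes mv | yes e  = inj₂ (ear m u v mu mv e Wm)
    ... | yes mu | yes mv | no ¬e  = inj₁ (linked long record
      { z = m ; below = E-sym mu ; above = E-sym mv ; after = after ; before = before
      ; order = λ l → ℕ.≤-refl ∷ ℕ.≤-refl ∷ l ; within = Wm ∷ [] ; alive = m<N ∷ [] })
      where
      after : ∀ {x} → u < x → x ≤ v → E u x → x ≡ m
      after u<x x≤v e with split u<x
      ... | inj₁ eq = eq
      ... | inj₂ v≤x with refl ← ℕ.≤-antisym x≤v v≤x = ⊥-elim (¬e e)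
      before : ∀ {x} → u ≤ x → x < v → E v x → x ≡ m
      before u≤x x<v e with split u≤x
      ... | inj₁ refl = ⊥-elim (¬e (E-sym e))
      ... | inj₂ m≤x  = ℕ.≤-antisym (ℕ.≤-pred x<v) m≤x

  via-map : ∀ ℓ (φ : Slot → ℕ) s t → φ (via ℓ s t) ≡ via ℓ (φ s) (φ t)
  via-map short φ s t = refl
  via-map long  φ s t = refl

  inner-map : ∀ ℓ (φ : Slot → ℕ) s {r} → map φ (inner ℓ s ++ r) ≡ inner ℓ (φ s) ++ map φ r
  inner-map short φ s = refl
  inner-map long  φ s = refl

  module Crossing {a b c d} (a<b : a < b) (b<c : b < c) (c<d : c < d) (ac : E a c) (bd : E b d) where

    private
      b<d = ℕ.<-trans b<c c<d
      a<c = ℕ.<-trans a<b b<c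

    only-bd : ∀ {m x} → E m x → a < m → m < c → x < a ⊎ c < x → b ≡ m × d ≡ x
    only-bd e a<m m<c x∉ = crossed-once ac a<b b<c (inj₂ c<d) bd a<m m<c x∉ e

    only-ca : ∀ {m x} → E m x → b < m → m < d → x < b ⊎ d < x → c ≡ m × a ≡ x
    only-ca e b<m m<d x∉ = crossed-once bd b<c c<d (inj₁ a<b) (E-sym ac) b<m m<d x∉ e

    in-ac : ∀ {m x} → E m x → a < m → m < c → b ≢ m → a ≤ x × x ≤ c
    in-ac {m} {x} e a<m m<c b≢m with a ℕ.≤? x | x ℕ.≤? c
    ... | yes p | yes q = p , q
    ... | no  p | _     = ⊥-elim (b≢m (proj₁ $ only-bd e a<m m<c (inj₁ (ℕ.≰⇒> p))))
    ... | yes _ | no  q = ⊥-elim (b≢m (proj₁ $ only-bd e a<m m<c (inj₂ (ℕ.≰⇒> q))))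

    in-bd : ∀ {m x} → E m x → b < m → m < d → c ≢ m → b ≤ x × x ≤ d
    in-bd {m} {x} e b<m m<d c≢m with b ℕ.≤? x | x ℕ.≤? d
    ... | yes p | yes q = p , q
    ... | no  p | _     = ⊥-elim (c≢m (proj₁ $ only-ca e b<m m<d (inj₁ (ℕ.≰⇒> p))))
    ... | yes _ | no  q = ⊥-elim (c≢m (proj₁ $ only-ca e b<m m<d (inj₂ (ℕ.≰⇒> q))))

    -- An edge from inside to beyond `c` or before `a` would cross `ac`, and one to a vertex after
    -- `b` and at most `c` would cross `bd`. The only edges that do so are `bd` and `ac`, neither of
    -- which has an end strictly between `a` and `b`.
    closed-ab : Closed a b
    closed-ab {m} {x} a<m m<b e with in-ac e a<m (ℕ.<-trans m<b b<c) (ℕ.<⇒≢ m<b ∘ sym)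
    ... | a≤x , x≤c with x ℕ.≤? b
    ...   | yes x≤b = a≤x , x≤b
    ...   | no  x≰b with only-ca (E-sym e) (ℕ.≰⇒> x≰b) (ℕ.≤-<-trans x≤c c<d) (inj₁ m<b)
    ...     | _ , a≡m = ⊥-elim (ℕ.<⇒≢ a<m a≡m)

    closed-bc : Closed b c
    closed-bc b<m m<c e =
      proj₁ (in-bd e b<m (ℕ.<-trans m<c c<d) (ℕ.<⇒≢ m<c ∘ sym)) ,
      proj₂ (in-ac e (ℕ.<-trans a<b b<m) m<c (ℕ.<⇒≢ b<m))

    closed-cd : Closed c d
    closed-cd {m} {x} c<m m<d e with in-bd e (ℕ.<-trans b<c c<m) m<d (ℕ.<⇒≢ c<m)
    ... | b≤x , x≤d with c ℕ.≤? x
    ...   | yes c≤x = c≤x , x≤d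
    ...   | no  c≰x with only-bd (E-sym e) (ℕ.<-≤-trans a<b b≤x) (ℕ.≰⇒> c≰x) (inj₂ c<m)
    ...     | _ , d≡m = ⊥-elim (ℕ.<⇒≢ m<d (sym d≡m))

    inside-b : ∀ {x} → E b x → (a ≤ x × x < b) ⊎ (b < x × x ≤ c) ⊎ x ≡ d
    inside-b {x} e with x ℕ.≟ d
    ... | yes x≡d = inj₂ (inj₂ x≡d)
    ... | no  x≢d with a ℕ.≤? x | x ℕ.≤? c
    ...   | no a≰x | _ = ⊥-elim (x≢d (sym (proj₂ (only-bd e a<b b<c (inj₁ (ℕ.≰⇒> a≰x))))))
    ...   | yes _  | no x≰c = ⊥-elim (x≢d (sym (proj₂ (only-bd e a<b b<c (inj₂ (ℕ.≰⇒> x≰c))))))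
    ...   | yes a≤x | yes x≤c with ℕ.<-cmp x b
    ...     | tri< x<b _ _  = inj₁ (a≤x , x<b)
    ...     | tri≈ _ refl _ = ⊥-elim (E-irr e)
    ...     | tri> _ _ b<x  = inj₂ (inj₁ (b<x , x≤c))

    inside-c : ∀ {x} → E c x → x ≡ a ⊎ (b ≤ x × x < c) ⊎ (c < x × x ≤ d)
    inside-c {x} e with x ℕ.≟ a
    ... | yes x≡a = inj₁ x≡a
    ... | no  x≢a with b ℕ.≤? x | x ℕ.≤? d
    ...   | no b≰x | _ = ⊥-elim (x≢a (sym (proj₂ (only-ca e b<c c<d (inj₁ (ℕ.≰⇒> b≰x))))))
    ...   | yes _  | no x≰d = ⊥-elim (x≢a (sym (proj₂ (only-ca e b<c c<d (inj₂ (ℕ.≰⇒> x≰d))))))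
    ...   | yes b≤x | yes x≤d with ℕ.<-cmp x c
    ...     | tri< x<c _ _  = inj₂ (inj₁ (b≤x , x<c))
    ...     | tri≈ _ refl _ = ⊥-elim (E-irr e)
    ...     | tri> _ _ c<x  = inj₂ (inj₂ (c<x , x≤d))

    left-b right-b left-c right-c : List ℕ → Set
    left-b   as = ∀ {x} → a ≤ x → x < b → E b x → x ∈ as
    right-b  as = ∀ {x} → b < x → x ≤ c → E b x → x ∈ as
    left-c   as = ∀ {x} → b ≤ x → x < c → E c x → x ∈ as
    right-c  as = ∀ {x} → c < x → x ≤ d → E c x → x ∈ as

    within-b : ∀ {as bs} → left-b as → right-b bs → Within E b (as ++ bs ++ d ∷ [])
    within-b {as} {bs} l r e with inside-b e
    ... | inj₁ (p , q)        = ∈-++⁺ˡ (l p q e)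
    ... | inj₂ (inj₁ (p , q)) = ∈-++⁺ʳ as (∈-++⁺ˡ (r p q e))
    ... | inj₂ (inj₂ eq)      = ∈-++⁺ʳ as (∈-++⁺ʳ bs (here eq))

    within-c : ∀ {as bs} → left-c as → right-c bs → Within E c (a ∷ as ++ bs)
    within-c {as} l r e with inside-c e
    ... | inj₁ eq             = here eq
    ... | inj₂ (inj₁ (p , q)) = there (∈-++⁺ˡ (l p q e))
    ... | inj₂ (inj₂ (p , q)) = there (∈-++⁺ʳ as (r p q e))

    -- A missing link lowers the degrees of `b` or `c`. Without `bc`, the two are twins over `a` and
    -- `d` if both other links are short; a long one gives adjacent vertices of degree 2. Without
    -- `ab`, `b` is a leaf, has an adjacent vertex of degree 2, is the tip of the ear `b c d`, or is
    -- a twin of the inner vertex of `cd`. The absence of `cd` is symmetric, and three links form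
    -- the ladder.
    reducible : d < N → Joined a b → Joined b c → Joined c d → Found
    reducible d<N J₁ J₂ J₃ = go J₁ J₂ J₃
      where
      b<N = ℕ.<-trans b<d d<N
      c<N = ℕ.<-trans c<d d<N
      open LinkAt
      before-∈ : ∀ {u v ℓ} (L : LinkAt u v ℓ) → ∀ {x} → u ≤ x → x < v → E v x → x ∈ via ℓ u (z L) ∷ []
      before-∈ L p q e = here (before L p q e)
      after-∈ : ∀ {u v ℓ} (L : LinkAt u v ℓ) → ∀ {x} → u < x → x ≤ v → E u x → x ∈ via ℓ v (z L) ∷ []
      after-∈ L p q e = here (after L p q e)
      none-before : ∀ {u v} → (∀ {x} → u ≤ x → x ≤ v → E v x → ⊥) → ∀ {x} → u ≤ x → x < v → E v x → x ∈ []
      none-before f p q e = ⊥-elim (f p (ℕ.<⇒≤ q) e)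
      none-after : ∀ {u v} → (∀ {x} → u ≤ x → x ≤ v → E u x → ⊥) → ∀ {x} → u < x → x ≤ v → E u x → x ∈ []
      none-after f p q e = ⊥-elim (f (ℕ.<⇒≤ p) q e)

      go : Joined a b → Joined b c → Joined c d → Found
      go (unlinked _ ¬b₁) (unlinked ¬b₂ _) _ = leaf b d b<N (within-b (none-before ¬b₁) (none-after ¬b₂))
      go (linked _ _) (unlinked _ ¬c₂) (unlinked ¬c₃ _) = leaf c a c<N (within-c (none-before ¬c₂) (none-after ¬c₃))
      go (linked long L₁) (unlinked ¬b₂ _) (linked _ _) = adjacent b (z L₁) d a (above L₁)
        (swap₁₂ (within-b (before-∈ L₁) (none-after ¬b₂))) (All.head (within L₁))
      go (linked short L₁) (unlinked _ ¬c₂) (linked long L₃) = adjacent c (z L₃) a d (below L₃)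
        (within-c (none-before ¬c₂) (after-∈ L₃)) (swap₁₂ (All.head (within L₃)))
      go (linked short L₁) (unlinked ¬b₂ ¬c₂) (linked short L₃) =
        twins (ℕ.<⇒≢ (ℕ.<-trans a<b b<d)) (ℕ.<⇒≢ b<c) (below L₁) ac (E-sym bd) (above L₃)
          (weaken₂ (within-b (before-∈ L₁) (none-after ¬b₂))) (weaken₂ (within-c (none-before ¬c₂) (after-∈ L₃)))
      go (unlinked _ ¬b₁) (linked long L₂) _ = adjacent b (z L₂) d c (below L₂)
        (swap₁₂ (within-b (none-before ¬b₁) (after-∈ L₂))) (swap₁₂ (All.head (within L₂)))
      go (linked _ _) (linked long L₂) (unlinked ¬c₃ _) = adjacent c (z L₂) a b (above L₂)
        (within-c (before-∈ L₂) (none-after ¬c₃)) (All.head (within L₂))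
      go (unlinked _ ¬b₁) (linked short L₂) (unlinked ¬c₃ _) = adjacent b c d a (below L₂)
        (swap₁₂ (within-b (none-before ¬b₁) (after-∈ L₂))) (within-c (before-∈ L₂) (none-after ¬c₃))
      go (unlinked _ ¬b₁) (linked short L₂) (linked short L₃) = ear b c d (below L₂) bd (below L₃)
        (within-b (none-before ¬b₁) (after-∈ L₂))
      go (linked short L₁) (linked short L₂) (unlinked ¬c₃ _) = ear c a b (E-sym ac) (above L₂) (below L₁)
        (within-c (before-∈ L₂) (none-after ¬c₃))
      go (unlinked _ ¬b₁) (linked short L₂) (linked long L₃) =
        twins (ℕ.<⇒≢ c<d) (ℕ.<⇒≢ (ℕ.<-trans b<c (Linked.head (order L₃ [-])))) (above L₂) (below L₃) (E-sym bd) (above L₃)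
          (weaken₂ (within-b (none-before ¬b₁) (after-∈ L₂))) (weaken₂ (All.head (within L₃)))
      go (linked long L₁) (linked short L₂) (unlinked ¬c₃ _) =
        twins (ℕ.<⇒≢ a<b) (ℕ.<⇒≢ (ℕ.<-trans (Linked.head (Linked.tail (order L₁ [-]))) b<c)) (below L₁) ac (above L₁) (below L₂)
          (weaken₂ (All.head (within L₁))) (weaken₂ (within-c (before-∈ L₂) (none-after ¬c₃)))
      go (linked ℓ₁ L₁) (linked ℓ₂ L₂) (linked ℓ₃ L₃) = ladder ℓ₁ ℓ₂ ℓ₃ φ
        (All.map⁻ (subst (All (_< N)) (sym used-map) (E<N (E-sym ac) ∷
          All.++⁺ (alive L₁) (b<N ∷ All.++⁺ (alive L₂) (c<N ∷ All.++⁺ (alive L₃) (d<N ∷ []))))))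
        (AllPairs.map ℕ.<⇒≢ (AllPairs.map⁻ (Linked.Linked⇒AllPairs ℕ.<-trans (subst (Linked _<_) (sym used-map)
          (order L₁ (order L₂ (order L₃ [-])))))))
        ac (E-sym bd)
        (subst (E a) (sym (via-map ℓ₁ φ 1F 4F)) (below L₁)) (subst (E d) (sym (via-map ℓ₃ φ 2F 6F)) (above L₃))
        (subst₂ (λ p q → Within E b (p ∷ q ∷ d ∷ [])) (sym (via-map ℓ₁ φ 0F 4F)) (sym (via-map ℓ₂ φ 2F 5F))
           (within-b (before-∈ L₁) (after-∈ L₂))
        ∷ subst₂ (λ p q → Within E c (a ∷ p ∷ q ∷ [])) (sym (via-map ℓ₂ φ 1F 5F)) (sym (via-map ℓ₃ φ 3F 6F))
           (within-c (before-∈ L₂) (after-∈ L₃))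
        ∷ All.++⁺ (inner-within ℓ₁ {4F} refl (within L₁))
             (All.++⁺ (inner-within ℓ₂ {5F} refl (within L₂)) (inner-within ℓ₃ {6F} refl (within L₃))))
        where
        φ : Slot → ℕ
        φ 0F = a
        φ 1F = b
        φ 2F = c
        φ 3F = d
        φ 4F = z L₁
        φ 5F = z L₂
        φ 6F = z L₃
        open Ladder ℓ₁ ℓ₂ ℓ₃
        used-map : map φ used ≡ a ∷ inner ℓ₁ (z L₁) ++ b ∷ inner ℓ₂ (z L₂) ++ c ∷ inner ℓ₃ (z L₃) ++ d ∷ []
        used-map = cong (a ∷_) (trans (inner-map ℓ₁ φ 4F) (cong (λ r → inner ℓ₁ (z L₁) ++ b ∷ r)
          (trans (inner-map ℓ₂ φ 5F) (cong (λ r → inner ℓ₂ (z L₂) ++ c ∷ r) (inner-map ℓ₃ φ 6F)))))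
        inner-within : ∀ ℓ {s u v} → neighbours s ≡ u ∷ v ∷ [] → All (λ z → Within E z (φ u ∷ φ v ∷ [])) (inner ℓ (φ s)) →
          All (λ s → Within E (φ s) (map φ (neighbours s))) (inner ℓ s)
        inner-within short {s} eq []       = []
        inner-within long  {s} eq (W ∷ []) = subst (λ as → Within E (φ s) (map φ as)) (sym eq) W ∷ []

  -- An edge leaving the span of the chord would cross it inside the larger interval.
  sub-closed : ∀ {i j p q} → (∀ {a b c d} → i ≤ a → a < b → b < c → c < d → d ≤ j → E a c → E b d → ⊥) →
    Closed i j → i ≤ p → q ≤ j → E p q → Closed p q
  sub-closed {p = p} {q} uncrossed closed i≤p q≤j pq {m} {x} p<m m<q e
    with i≤x , x≤j ← closed (ℕ.≤-<-trans i≤p p<m) (ℕ.<-≤-trans m<q q≤j) e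
    with p ℕ.≤? x | x ℕ.≤? q
  ... | yes p≤x | yes x≤q = p≤x , x≤q
  ... | no  p≰x | _       = ⊥-elim (uncrossed i≤x (ℕ.≰⇒> p≰x) p<m m<q q≤j (E-sym e) pq)
  ... | yes _   | no x≰q  = ⊥-elim (uncrossed i≤p p<m m<q (ℕ.≰⇒> x≰q) x≤j pq e)

  -- If the chord from `i + 2` to `i + 4` is missing, the interval from `i` to `i + 3` is closed; if
  -- the one from `i` to `i + 2` is missing, that from `i + 1` to `i + 4` is. If both are present,
  -- they confine `i + 1` and `i + 3` to two neighbours each; one of these is a leaf, or `i + 2`
  -- would have degree 4.
  short-chords : ∀ i j → 3 ℕ.+ i ≤ j → j < N →
    (∀ {a b c d} → i ≤ a → a < b → b < c → c < d → d ≤ j → E a c → E b d → ⊥) → Closed i j →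
    (∀ {p q} → i ≤ p → q ≤ j → i < p ⊎ q < j → E p q → q ≤ 2 ℕ.+ p) → Found
  short-chords i j 3+i≤j j<N uncrossed closed le₂ with split 3+i≤j
  ... | inj₁ refl = two-inside i j<N closed
  ... | inj₂ 4+i≤j with E? (2 ℕ.+ i) (4 ℕ.+ i)
  ...   | no ¬e = two-inside i (ℕ.<-trans 4+i≤j j<N) λ {m} {x} → inside {m} {x}
    where
    inside : Closed i (3 ℕ.+ i)
    inside {m} {x} i<m m<3+i e with i≤x , x≤j ← closed i<m (ℕ.<-trans m<3+i 4+i≤j) e
      with le₂ (ℕ.<⇒≤ i<m) x≤j (inj₁ i<m) e
    ... | x≤2+m with split i<m
    ...   | inj₁ refl = i≤x , x≤2+m
    ...   | inj₂ 2+i≤m with refl ← ℕ.≤-antisym 2+i≤m (ℕ.≤-pred m<3+i) with ℕ.m≤n⇒m<n∨m≡n x≤2+m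
    ...     | inj₁ x<4+i = i≤x , ℕ.≤-pred x<4+i
    ...     | inj₂ refl  = ⊥-elim (¬e e)
  ...   | yes e₂₄ with E? i (2 ℕ.+ i)
  ...     | no ¬e = two-inside (1 ℕ.+ i) (ℕ.≤-<-trans 4+i≤j j<N) λ {m} {x} → inside {m} {x}
    where
    inside : Closed (1 ℕ.+ i) (4 ℕ.+ i)
    inside {m} {x} 1+i<m m<4+i e
      with i≤x , x≤j ← closed (ℕ.<-trans ℕ.≤-refl 1+i<m) (ℕ.<-≤-trans m<4+i 4+i≤j) e with split 1+i<m
    ... | inj₁ refl = lower , le₂ (ℕ.m≤n+m i 2) x≤j (inj₁ (s≤s (ℕ.n≤1+n i))) e
      where
      lower : 1 ℕ.+ i ≤ x
      lower with split i≤x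
      ... | inj₁ refl = ⊥-elim (¬e (E-sym e))
      ... | inj₂ p    = p
    ... | inj₂ 3+i≤m with refl ← ℕ.≤-antisym 3+i≤m (ℕ.≤-pred m<4+i) =
      ℕ.≤-pred (ℕ.≤-pred (le₂ i≤x (ℕ.≤-trans (ℕ.n≤1+n _) 4+i≤j) (inj₂ 4+i≤j) (E-sym e))) , upper
      where
      upper : x ≤ 4 ℕ.+ i
      upper with x ℕ.≤? 4 ℕ.+ i
      ... | yes p = p
      ... | no  q = ⊥-elim (uncrossed (ℕ.m≤n+m i 2) ℕ.≤-refl ℕ.≤-refl (ℕ.≰⇒> q) x≤j e₂₄ e)
  ...     | yes e₀₂ = tripod
    where
    W₁ : Within E (1 ℕ.+ i) (i ∷ 2 ℕ.+ i ∷ [])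
    W₁ {x} e with i≤x , x≤j ← closed ℕ.≤-refl (ℕ.<-trans ℕ.≤-refl 3+i≤j) e with split i≤x
    ... | inj₁ eq = here eq
    ... | inj₂ p with split p
    ...   | inj₁ refl = ⊥-elim (E-irr e)
    ...   | inj₂ q with split q
    ...     | inj₁ eq = there (here eq)
    ...     | inj₂ r  = ⊥-elim (uncrossed ℕ.≤-refl ℕ.≤-refl ℕ.≤-refl r x≤j e₀₂ e)
    W₃ : Within E (3 ℕ.+ i) (4 ℕ.+ i ∷ 2 ℕ.+ i ∷ [])
    W₃ {x} e with i≤x , x≤j ← closed (s≤s (ℕ.m≤n+m i 2)) 4+i≤j e with ℕ.<-cmp x (2 ℕ.+ i)
    ... | tri≈ _ eq _ = there (here eq)
    ... | tri< x<2+i _ _ = ⊥-elim (not-below (split i≤x))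
      where
      not-below : x ≡ i ⊎ suc i ≤ x → ⊥
      not-below (inj₁ refl) = ℕ.1+n≰n (le₂ ℕ.≤-refl 3+i≤j (inj₂ 4+i≤j) (E-sym e))
      not-below (inj₂ i<x) with refl ← ℕ.≤-antisym i<x (ℕ.≤-pred x<2+i) =
        uncrossed ℕ.≤-refl ℕ.≤-refl ℕ.≤-refl ℕ.≤-refl 3+i≤j e₀₂ (E-sym e)
    ... | tri> _ _ p with split p
    ...   | inj₁ refl = ⊥-elim (E-irr e)
    ...   | inj₂ q with split q
    ...     | inj₁ eq = here eq
    ...     | inj₂ r  = ⊥-elim (uncrossed (ℕ.m≤n+m i 2) ℕ.≤-refl ℕ.≤-refl r x≤j e₂₄ e)
    N₄ : 4 ℕ.+ i < N
    N₄ = ℕ.≤-<-trans 4+i≤j j<N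
    N₃ : 3 ℕ.+ i < N
    N₃ = ℕ.<-trans ℕ.≤-refl N₄
    tripod : Found
    tripod with E? (1 ℕ.+ i) (2 ℕ.+ i) | E? (3 ℕ.+ i) (2 ℕ.+ i)
    ... | no ¬e | _     = leaf (1 ℕ.+ i) i (ℕ.<-trans (s≤s (ℕ.n≤1+n _)) N₃) (without₂ W₁ ¬e)
    ... | _     | no ¬e = leaf (3 ℕ.+ i) (4 ℕ.+ i) N₃ (without₂ W₃ ¬e)
    ... | yes e₁₂ | yes e₃₂ = ⊥-elim (ℕ.<-irrefl refl (degree≤3
      {js = i ∷ 1 ℕ.+ i ∷ 3 ℕ.+ i ∷ 4 ℕ.+ i ∷ []}
      (((λ ()) ∷ (λ ()) ∷ (λ ()) ∷ []) ∷ ((λ ()) ∷ (λ ()) ∷ []) ∷ ((λ ()) ∷ []) ∷ [] ∷ [])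
      (E-sym e₀₂ ∷ E-sym e₁₂ ∷ E-sym e₃₂ ∷ e₂₄ ∷ [])))

  -- `fuel` bounds the length `j - i`. Length at least 3 is kept throughout, since shorter gaps have
  -- at most one inner vertex and are handled as links instead.
  find-reducible : ∀ fuel i j → 3 ℕ.+ i ≤ j → j ≤ fuel ℕ.+ i → j < N → Closed i j → Found
  find-reducible zero       i j 3+i≤j j≤i j<N closed = ⊥-elim (ℕ.<-irrefl refl (ℕ.≤-trans (ℕ.m≤n+m (suc i) 2) (ℕ.≤-trans 3+i≤j j≤i)))
  find-reducible (suc fuel) i j 3+i≤j j≤f j<N closed = go
    where
    smaller : ∀ {u v} → i ≤ u → v ≤ j → i < u ⊎ v < j → 3 ℕ.+ u ≤ v → Closed u v → Found
    smaller {u} {v} i≤u v≤j proper 3+u≤v = find-reducible fuel u v 3+u≤v (bound proper) (ℕ.≤-<-trans v≤j j<N)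
      where
      bound : i < u ⊎ v < j → v ≤ fuel ℕ.+ u
      bound (inj₁ i<u) = ℕ.≤-trans v≤j (ℕ.≤-trans j≤f (subst (ℕ._≤ fuel ℕ.+ u) (ℕ.+-suc fuel i) (ℕ.+-monoʳ-≤ fuel i<u)))
      bound (inj₂ v<j) = ℕ.≤-pred (ℕ.≤-trans v<j (ℕ.≤-trans j≤f (s≤s (ℕ.+-monoʳ-≤ fuel i≤u))))

    join : ∀ {u v} → i ≤ u → v ≤ j → i < u ⊎ v < j → u < v → Closed u v → Joined u v ⊎ Found
    join {u} {v} i≤u v≤j proper u<v closed with 3 ℕ.+ u ℕ.≤? v
    ... | yes long-gap = inj₂ (smaller i≤u v≤j proper long-gap closed)
    ... | no  ¬long    = joined u<v (ℕ.≤-pred (ℕ.≰⇒> ¬long)) (ℕ.≤-<-trans v≤j j<N) closed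

    Crossing-inside : Set
    Crossing-inside = ∃ λ a → a < suc j × ∃ λ b → b < suc j × ∃ λ c → c < suc j × ∃ λ d → d < suc j ×
      (i ≤ a × a < b × b < c × c < d × E a c × E b d)

    crossing? : Dec Crossing-inside
    crossing? = ℕ.anyUpTo? (λ a → ℕ.anyUpTo? (λ b → ℕ.anyUpTo? (λ c → ℕ.anyUpTo? (λ d →
      (i ℕ.≤? a) ×-dec (a ℕ.<? b) ×-dec (b ℕ.<? c) ×-dec (c ℕ.<? d) ×-dec E? a c ×-dec E? b d)
      (suc j)) (suc j)) (suc j)) (suc j)

    uncrossed : ¬ Crossing-inside → ∀ {a b c d} → i ≤ a → a < b → b < c → c < d → d ≤ j → E a c → E b d → ⊥
    uncrossed ¬crossing i≤a a<b b<c c<d d≤j ac bd = ¬crossing (_ , s≤s (ℕ.<⇒≤ (ℕ.<-trans a<b b<j)) , _ , s≤s (ℕ.<⇒≤ b<j)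
      , _ , s≤s (ℕ.<⇒≤ c<j) , _ , s≤s d≤j , i≤a , a<b , b<c , c<d , ac , bd)
      where
      c<j = ℕ.<-≤-trans c<d d≤j
      b<j = ℕ.<-trans b<c c<j

    -- The chord from `i` to `j` is excluded, because passing to its span would not shorten the
    -- interval.
    chord? : Dec (∃ λ p → p < suc j × ∃ λ q → q < suc j × (i ≤ p × 3 ℕ.+ p ≤ q × (i < p ⊎ q < j) × E p q))
    chord? = ℕ.anyUpTo? (λ p → ℕ.anyUpTo? (λ q →
      (i ℕ.≤? p) ×-dec (3 ℕ.+ p ℕ.≤? q) ×-dec ((i ℕ.<? p) ⊎-dec (q ℕ.<? j)) ×-dec E? p q) (suc j)) (suc j)

    at-crossing : ∀ {a b c d} → i ≤ a → a < b → b < c → c < d → d ≤ j → E a c → E b d → Found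
    at-crossing i≤a a<b b<c c<d d≤j ac bd =
      case join i≤a (ℕ.<⇒≤ b<j) (inj₂ b<j) a<b closed-ab of λ where
        (inj₂ found) → found
        (inj₁ J₁) → case join (ℕ.<⇒≤ i<b) (ℕ.<⇒≤ c<j) (inj₁ i<b) b<c closed-bc of λ where
          (inj₂ found) → found
          (inj₁ J₂) → case join (ℕ.<⇒≤ i<c) d≤j (inj₁ i<c) c<d closed-cd of λ where
            (inj₂ found) → found
            (inj₁ J₃) → reducible (ℕ.≤-<-trans d≤j j<N) J₁ J₂ J₃
      where
      open Crossing a<b b<c c<d ac bd
      c<j = ℕ.<-≤-trans c<d d≤j
      b<j = ℕ.<-trans b<c c<j
      i<b = ℕ.≤-<-trans i≤a a<b
      i<c = ℕ.<-trans i<b b<c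

    go : Found
    go with crossing?
    ... | yes (a , _ , b , _ , c , _ , d , s≤s d≤j , i≤a , a<b , b<c , c<d , ac , bd) =
      at-crossing i≤a a<b b<c c<d d≤j ac bd
    ... | no ¬crossing with chord?
    ...   | yes (p , _ , q , s≤s q≤j , i≤p , 3+p≤q , proper , pq) =
      smaller i≤p q≤j proper 3+p≤q (λ {m} {x} → sub-closed (uncrossed ¬crossing) closed i≤p q≤j pq {m} {x})
    ...   | no ¬chord = short-chords i j 3+i≤j j<N (uncrossed ¬crossing) closed at-most-2
      where
      at-most-2 : ∀ {p q} → i ≤ p → q ≤ j → i < p ⊎ q < j → E p q → q ≤ 2 ℕ.+ p
      at-most-2 {p} {q} i≤p q≤j proper pq with 3 ℕ.+ p ℕ.≤? q
      ... | no ¬3+p≤q = ℕ.≤-pred (ℕ.≰⇒> ¬3+p≤q)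
      ... | yes 3+p≤q = ⊥-elim (¬chord (p , s≤s (ℕ.≤-trans (ℕ.m≤n+m p 3) (ℕ.≤-trans 3+p≤q q≤j)) , q , s≤s q≤j , i≤p , 3+p≤q , proper , pq))

  from-0 : N ≤ 3 → Within E 0 (1 ∷ 2 ∷ [])
  from-0 N≤3 {0} e = ⊥-elim (E-irr e)
  from-0 N≤3 {1} e = here refl
  from-0 N≤3 {2} e = there (here refl)
  from-0 N≤3 {suc (suc (suc y))} e = ⊥-elim (ℕ.<⇒≱ (E<N e) (ℕ.≤-trans N≤3 (s≤s (s≤s (s≤s z≤n)))))

  from-1 : N ≤ 3 → Within E 1 (0 ∷ 2 ∷ [])
  from-1 N≤3 {0} e = here refl
  from-1 N≤3 {1} e = ⊥-elim (E-irr e)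
  from-1 N≤3 {2} e = there (here refl)
  from-1 N≤3 {suc (suc (suc y))} e = ⊥-elim (ℕ.<⇒≱ (E<N e) (ℕ.≤-trans N≤3 (s≤s (s≤s (s≤s z≤n)))))

  at-most-three : N ≤ 3 → 0 < N → Found
  at-most-three N≤3 0<N with E? 0 1 | E? 0 2
  ... | no ¬e  | _      = leaf 0 2 0<N (without₁ (from-0 N≤3) ¬e)
  ... | yes _  | no ¬e  = leaf 0 1 0<N (without₂ (from-0 N≤3) ¬e)
  ... | yes e₁ | yes e₂ with E? 1 2
  ...   | yes e₁₂ = ear 0 1 2 e₁ e₂ e₁₂ (from-0 N≤3)
  ...   | no ¬e   = leaf 1 0 (E<N e₁) (without₂ (from-1 N≤3) ¬e)

  -- With at least four vertices, the descent starts from the interval of all indices, which is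
  -- closed because it contains every neighbour.
  reducible-exists : 0 < N → Found
  reducible-exists 0<N with 4 ℕ.≤? N
  ... | no  4≰N = at-most-three (ℕ.≤-pred (ℕ.≰⇒> 4≰N)) 0<N
  ... | yes 4≤N = find-reducible N 0 (ℕ.pred N) (ℕ.pred-mono-≤ 4≤N)
      (ℕ.≤-trans ℕ.pred[n]≤n (ℕ.m≤m+n N 0)) (pred< 0<N) λ _ _ e → z≤n , ℕ.pred-mono-≤ (E<N e)
    where
    pred< : ∀ {n} → 0 < n → ℕ.pred n < n
    pred< (s≤s _) = ℕ.≤-refl

-- Out of range, nth returns the default d.
nth : ∀ {X : Set} → X → List X → ℕ → X
nth d []       _       = d
nth d (x ∷ xs) zero    = x
nth d (x ∷ xs) (suc i) = nth d xs i

nth-∈ : ∀ {X : Set} {d : X} xs {i} → i < length xs → nth d xs i ∈ xs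
nth-∈ (x ∷ xs) {zero}  _         = here refl
nth-∈ (x ∷ xs) {suc i} (s≤s i<) = there (nth-∈ xs i<)

nth-surjective : ∀ {X : Set} {d y : X} {xs} → y ∈ xs → ∃ λ i → i < length xs × nth d xs i ≡ y
nth-surjective (here refl) = 0 , s≤s z≤n , refl
nth-surjective (there y∈) with i , i< , eq ← nth-surjective y∈ = suc i , s≤s i< , eq

nth-AllPairs : ∀ {X : Set} {R : X → X → Set} {d xs i j} → AllPairs R xs → i < j → j < length xs → R (nth d xs i) (nth d xs j)
nth-AllPairs {i = zero}  {suc j} (rs ∷ _) _         (s≤s j<) = All.lookup rs (nth-∈ _ j<)
nth-AllPairs {i = suc i} {suc j} (_ ∷ ps) (s≤s i<j) (s≤s j<) = nth-AllPairs ps i<j j<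

-- The upper bound: from positions on the circle to indices

module Upper {n : ℕ} (A : Fin n → Fin n → Bool) (simple : IsSimple A) (outer : OuterOnePlanar A)
  (maxdeg : MaxDegreeAtMost A 3) where

  degree≤3 : ∀ {x} {ys : List (Fin n)} → Unique ys → All (Edge A x) ys → length ys ≤ 3
  degree≤3 {x} u es = ℕ.≤-trans (Unique-⊆⇒length≤ u λ y∈ →
    ∈-filter⁺ (Bool.T? ∘ A x) (∈-allFin _) (subst Bool.T (sym (All.lookup es y∈)) tt)) (maxdeg x)

  open Ambient A simple degree≤3
  open Reduce A simple degree≤3
  open Subgraph

  pos : Fin n → Fin n
  pos = proj₁ outer

  pos-injective : Injective _≡_ _≡_ pos
  pos-injective = proj₁ (proj₂ outer)

  _≺_ : Fin n → Fin n → Set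
  a ≺ b = pos a Fin.< pos b

  module Indexed (a₀ : Fin n) (as : List (Fin n)) (sorted : AllPairs _≺_ (a₀ ∷ as)) where

    L : List (Fin n)
    L = a₀ ∷ as

    N : ℕ
    N = length L

    at : ℕ → Fin n
    at = nth a₀ L

    EI : ℕ → ℕ → Set
    EI i j = i < N × j < N × Edge A (at i) (at j)

    at-mono : ∀ {i j} → i < j → j < N → at i ≺ at j
    at-mono = nth-AllPairs sorted

    at-injective : ∀ {i j} → i < N → j < N → at i ≡ at j → i ≡ j
    at-injective {i} {j} i< j< eq with ℕ.<-cmp i j
    ... | tri≈ _ i≡j _ = i≡j
    ... | tri< i<j _ _ = ⊥-elim (ℕ.<-irrefl (cong (toℕ ∘ pos) eq) (at-mono i<j j<))
    ... | tri> _ _ j<i = ⊥-elim (ℕ.<-irrefl (cong (toℕ ∘ pos) (sym eq)) (at-mono j<i i<))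

    induced⇒indexed : ∀ {i y} → i < N → E (induced L) (at i) y → ∃ λ j → y ≡ at j × EI i j
    induced⇒indexed i< (_ , y∈ , e) with j , j< , refl ← nth-surjective {d = a₀} y∈ = j , refl , i< , j< , e

    indexed⇒induced : ∀ {i j} → EI i j → E (induced L) (at i) (at j)
    indexed⇒induced (i< , j< , e) = nth-∈ L i< , nth-∈ L j< , e

    within-at : ∀ {i js} → i < N → Within EI i js → Within (E (induced L)) (at i) (map at js)
    within-at i< W e with j , refl , e′ ← induced⇒indexed i< e = ∈-map⁺ at (W e′)

    at-reducible : Reducible (_< N) EI → Reducible (_∈ L) (E (induced L))
    at-reducible (leaf v u v< W) = leaf (at v) (at u) (nth-∈ L v<) (within-at v< W)
    at-reducible (adjacent p q i j e Wp Wq) = adjacent (at p) (at q) (at i) (at j) (indexed⇒induced e)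
      (within-at (proj₁ e) Wp) (within-at (proj₁ (proj₂ e)) Wq)
    at-reducible (ear z p q zp zq pq W) = ear (at z) (at p) (at q)
      (indexed⇒induced zp) (indexed⇒induced zq) (indexed⇒induced pq) (within-at (proj₁ zp) W)
    at-reducible (ladder ℓ₁ ℓ₂ ℓ₃ φ alive distinct ac db aa′ dd′ W) = ladder ℓ₁ ℓ₂ ℓ₃ (at ∘ φ)
      (All.map (nth-∈ L) alive) (distinct-at alive distinct)
      (indexed⇒induced ac) (indexed⇒induced db) (indexed⇒induced aa′) (indexed⇒induced dd′)
      (All.tabulate λ {s} s∈ e → subst (_ ∈_) (sym (map-∘ (Ladder.neighbours ℓ₁ ℓ₂ ℓ₃ s)))
        (within-at (All.lookup alive (All.lookup (Ladder.Valid.inside (ladder-valid ℓ₁ ℓ₂ ℓ₃ same)) s∈)) (All.lookup W s∈) e))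
      where
      distinct-at : ∀ {ss} → All (λ s → φ s < N) ss → AllPairs (λ s t → φ s ≢ φ t) ss →
        AllPairs (λ s t → at (φ s) ≢ at (φ t)) ss
      distinct-at []       []       = []
      distinct-at (a ∷ al) (d ∷ ds) =
        All.zipWith (λ (b , ne) eq → ne (at-injective a b eq)) (al , d) ∷ distinct-at al ds

    indexed-cross : ∀ {i k j l} → i < j → j < k → l < i ⊎ k < l → k < N → l < N →
      Cross A pos (at i) (at k) (at j) (at l)
    indexed-cross {i} {k} {j} {l} i<j j<k l∉ k< l< =
      ( (ℕ.<⇒≢ i<j ∘ at-injective i< j<) , i≢l l∉ ∘ at-injective i< l<
      , (ℕ.<⇒≢ j<k ∘ sym ∘ at-injective k< j<) , k≢l l∉ ∘ at-injective k< l< ) ,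
      inj₁ (inj₁ (at-mono i<j j< , at-mono j<k k<) ,
        λ { (inj₁ (p , q)) → outside l∉ p q ; (inj₂ (p , q)) → ℕ.<-asym (at-mono i<k k<) (ℕ.<-trans p q) })
      where
      i<k = ℕ.<-trans i<j j<k
      j< = ℕ.<-trans j<k k<
      i< = ℕ.<-trans i<k k<
      i≢l : l < i ⊎ k < l → i ≢ l
      i≢l (inj₁ l<i) refl = ℕ.<-irrefl refl l<i
      i≢l (inj₂ k<i) refl = ℕ.<-asym k<i i<k
      k≢l : l < i ⊎ k < l → k ≢ l
      k≢l (inj₁ k<i) refl = ℕ.<-asym k<i i<k
      k≢l (inj₂ k<l) refl = ℕ.<-irrefl refl k<l
      outside : l < i ⊎ k < l → at i ≺ at l → at l ≺ at k → ⊥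
      outside (inj₁ l<i) p q = ℕ.<-asym p (at-mono l<i i<)
      outside (inj₂ k<l) p q = ℕ.<-asym q (at-mono k<l l<)

    crossed-once : ∀ {i k j l j′ l′} → EI i k → i < j → j < k → l < i ⊎ k < l → EI j l →
      i < j′ → j′ < k → l′ < i ⊎ k < l′ → EI j′ l′ → j ≡ j′ × l ≡ l′
    crossed-once {i} {k} {j} {l} {j′} {l′} (i< , k< , ik) i<j j<k l∉ (j< , l< , jl) i<j′ j′<k l′∉ (j′< , l′< , j′l′)
      with proj₂ (proj₂ outer) (at i) (at k) (at j) (at l) (at j′) (at l′) ik jl j′l′
             (indexed-cross i<j j<k l∉ k< l<) (indexed-cross i<j′ j′<k l′∉ k< l′<)
    ... | inj₁ (p , q) = at-injective j< j′< p , at-injective l< l′< q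
    -- The two edges cannot coincide in reverse: `j` lies strictly between `i` and `k`, and `l′`
    -- does not.
    ... | inj₂ (p , _) with refl ← at-injective j< l′< p = ⊥-elim (Sum.[ ℕ.<-asym i<j , ℕ.<-asym j<k ] l′∉)

    degree≤3-indexed : ∀ {i js} → Unique js → All (EI i) js → length js ≤ 3
    degree≤3-indexed {i} {js} u es = subst (_≤ 3) (length-map at js)
      (degree≤3 (AllPairs.map⁺ (distinct es u)) (All.map⁺ (All.map (proj₂ ∘ proj₂) es)))
      where
      distinct : ∀ {js} → All (EI i) js → Unique js → AllPairs (λ j k → at j ≢ at k) js
      distinct []       []       = []
      distinct (e ∷ es) (d ∷ ds) = All.zipWith (λ (f , ne) eq → ne (at-injective (proj₁ (proj₂ e)) (proj₁ (proj₂ f)) eq)) (es , d)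
        ∷ distinct es ds

    open Structure N EI (λ i j → (i ℕ.<? N) ×-dec (j ℕ.<? N) ×-dec (A (at i) (at j) Bool.≟ true))
      (λ (i< , j< , e) → j< , i< , A-sym e) (λ (_ , _ , e) → A-irr e refl) (proj₁ ∘ proj₂) degree≤3-indexed crossed-once

    reducible : Reducible (_∈ L) (E (induced L))
    reducible = at-reducible (reducible-exists (s≤s z≤n))

  colouring : ∀ fuel L → length L ≤ fuel → AllPairs _≺_ L → Colouring (induced L)
  colouring _ [] _ _ = record { col = λ _ _ → first ; proper = λ { (() , _) } ; flip = λ _ → id ; disj = λ { (() , _) } }
  colouring (suc fuel) L@(a ∷ as) (s≤s le) sorted = reduce L (Indexed.reducible a as sorted)
    λ { L′ D refl shorter → colouring fuel L′ (ℕ.≤-trans (ℕ.≤-pred shorter) le) (∖-AllPairs D sorted) }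

  order : DecTotalOrder _ _ _
  order = On.decTotalOrder (Fin.≤-decTotalOrder n) pos

  vertices : List (Fin n)
  vertices = sort order (allFin n)

  -- Sorting gives only weak inequalities; they are strict because a permutation of a list without
  -- repetitions has none and `pos` is injective.
  vertices-sorted : AllPairs _≺_ vertices
  vertices-sorted = AllPairs.map (λ (p , ne) → ℕ.≤∧≢⇒< p (ne ∘ pos-injective ∘ Fin.toℕ-injective))
    (AllPairs.zip (Sorted.Sorted⇒AllPairs (DecTotalOrder.totalOrder order) (sort-↗ order (allFin n)) ,
      Permutation.AllPairs-resp-↭ (setoid (Fin n)) (λ ne → ne ∘ sym) (subst₂ _≢_ refl , (λ { refl ne → ne }))
        (↭⇒↭ₛ (↭-sym (sort-↭ order (allFin n)))) (allFin⁺ n)))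

  7-colourable : IncColourable A 7
  7-colourable = toIncidence simple (pull id id (λ e → ∈-vertices , ∈-vertices , e)
    (colouring (length vertices) vertices ℕ.≤-refl vertices-sorted))
    where
    ∈-vertices : ∀ {a} → a ∈ vertices
    ∈-vertices = ∈-resp-↭ (↭-sym (sort-↭ order (allFin n))) (∈-allFin _)

theorem3p13 : (n : ℕ) (A : Fin n → Fin n → Bool) →
    InP⁺ A → ConflictFreeIncChromatic≡ A 7
theorem3p13 n A P = Upper.7-colourable A simple outer1 maxdeg , 𝒫⁺-lower-bound P
  where open InP⁺ P
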